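{- There exists a polynomial-time approximation scheme for the Maximum Bipartite Subgraph problem on unit disks that runs in $O(n^{O(1)}\cdot n^{O(1/\epsilon)})$ time for any $\epsilon>0$. That is, for every $\epsilon>0$ there is an algorithm which, given a set $S$ of $n$ unit disks in the plane, computes within this time a subset $S'\subseteq S$ whose intersection graph is bipartite and such that $|S'|\ge(1-\epsilon)\cdot|S^*|$, where $S^*\subseteq S$ is a maximum-size subset whose intersection graph is bipartite.
   Context: Unit disks are disks of radius 1 in the plane. The intersection graph of a set of disks has one vertex per disk, two vertices being adjacent if and only if the corresponding disks intersect. The Maximum Bipartite Subgraph (MBS) problem asks for a maximum-size subset $S'\subseteq S$ whose intersection graph is bipartite. Running times count elementary operations, including arithmetic on real numbers, at unit cost. -}

module Defs where

open import Data.Bool using (Bool; true; false; not; _∧_; if_then_else_)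
open import Data.Fin using (Fin; toℕ; fromℕ<)
open import Data.Fin.Subset using (Subset; _∈_; ∣_∣)
open import Data.Nat as ℕ using (ℕ; suc)
open import Data.Product using (Σ; ∃; ∃-syntax; _×_; _,_; proj₁; proj₂)
open import Data.Vec using (tabulate)
open import Function.Definitions using (Injective)
open import Relation.Binary using (Rel; IsDecTotalOrder)
open import Relation.Binary.PropositionalEquality using (_≡_; _≢_)
open import Relation.Nullary using (¬_; yes; no)
open import Relation.Nullary.Decidable using (⌊_⌋)
open import Algebra.Structures using (IsCommutativeRing)

------------------------------------------------------------------------
-- The real numbers

record OrderedField : Set₁ where
  infix  8 _⁻¹
  infix  8 -_
  infixl 7 _*_
  infixl 6 _+_ _-_
  infix  4 _≈_ _≤_ _<_

  field
    Carrier           : Set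
    _≈_               : Rel Carrier _
    _≤_               : Rel Carrier _
    _+_ _*_           : Carrier → Carrier → Carrier
    -_                : Carrier → Carrier
    0# 1#             : Carrier
    _⁻¹               : Carrier → Carrier
    isCommutativeRing : IsCommutativeRing _≈_ _+_ _*_ -_ 0# 1#
    isDecTotalOrder   : IsDecTotalOrder _≈_ _≤_
    0≉1               : ¬ (0# ≈ 1#)
    ⁻¹-cong           : ∀ {x y} → x ≈ y → x ⁻¹ ≈ y ⁻¹
    ⁻¹-inverse        : ∀ x → ¬ (x ≈ 0#) → x * x ⁻¹ ≈ 1#
    ⁻¹-zero           : 0# ⁻¹ ≈ 0#
    +-monoˡ-≤         : ∀ {x y} z → x ≤ y → x + z ≤ y + z
    *-nonneg          : ∀ {x y} → 0# ≤ x → 0# ≤ y → 0# ≤ x * y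

  UpperBound : (Carrier → Set) → Carrier → Set
  UpperBound P u = ∀ x → P x → x ≤ u

  fromℕ : ℕ → Carrier
  fromℕ 0       = 0#
  fromℕ (suc n) = 1# + fromℕ n

  _-_ : Carrier → Carrier → Carrier
  x - y = x + (- y)

  _<_ : Rel Carrier _
  x < y = x ≤ y × ¬ (x ≈ y)

  open IsCommutativeRing isCommutativeRing public
    hiding (_-_; reflexive; refl; sym; trans; isEquivalence; isPartialEquivalence)
  open IsDecTotalOrder isDecTotalOrder public
    renaming (refl to ≤-refl; trans to ≤-trans; reflexive to ≤-reflexive)

-- ℝ axiomatised, up to isomorphism, as a complete ordered field.  The
-- order is decidable because comparing two reals is an elementary
-- operation.  `archimedean` follows from `supremum` classically, but a
-- constructive proof would not produce the natural number.

record RealField : Set₁ where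
  field
    orderedField : OrderedField

  open OrderedField orderedField public

  field
    supremum    : (P : Carrier → Set) → ∃ P → ∃ (UpperBound P) →
                  ∃[ s ] UpperBound P s × (∀ u → UpperBound P u → s ≤ u)
    archimedean : ∀ x → ∃[ n ] x ≤ fromℕ n

------------------------------------------------------------------------
-- Graphs

record Graph : Set₁ where
  field
    Vertex   : Set
    Adjacent : Vertex → Vertex → Set

Bipartite : Graph → Set
Bipartite G = Σ (Vertex → Bool) λ side →
  ∀ u v → Adjacent u v → side u ≢ side v
  where open Graph G

------------------------------------------------------------------------
-- Programs of a real RAM
--
-- Memory consists of named arrays of natural numbers and named arrays of
-- reals; a scalar variable is cell 0 of an array.  Naturals serve for
-- counting and addressing and support only + and ∸, so that unit cost
-- cannot be exploited by repeatedly squaring them.  Reals can neither be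
-- rounded nor converted to naturals, and 0 and 1 are the only real
-- constants.

infixr 4 _⨾_
infixr 5 _and_
infix  6 _[_]≔ᴺ_ _[_]≔ᴿ_ _≤ᴺ_ _≤ᴿ_
infixl 7 _⊕_ _⊖_
infixl 8 _⊗_ _⊘_
infix  9 _[_]

data NatExp : Set where
  lit       : ℕ → NatExp
  _[_]      : ℕ → NatExp → NatExp
  _⊕_ _⊖_   : NatExp → NatExp → NatExp

data RealExp : Set where
  zeroᴿ oneᴿ            : RealExp
  _[_]                  : ℕ → NatExp → RealExp
  _⊕_ _⊖_ _⊗_ _⊘_       : RealExp → RealExp → RealExp

data Cond : Set where
  _≤ᴺ_ : NatExp → NatExp → Cond
  _≤ᴿ_ : RealExp → RealExp → Cond
  notᶜ : Cond → Cond
  _and_ : Cond → Cond → Cond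

data Program : Set where
  skip          : Program
  _[_]≔ᴺ_       : ℕ → NatExp → NatExp → Program
  _[_]≔ᴿ_       : ℕ → NatExp → RealExp → Program
  _⨾_           : Program → Program → Program
  ifᶜ_then_else_ : Cond → Program → Program → Program
  while_loop_   : Cond → Program → Program

-- The cost of evaluating an expression is the number of its nodes, each
-- being one constant, memory access, arithmetic operation, comparison or
-- connective.

costᴺ : NatExp → ℕ
costᴺ (lit k)   = 1
costᴺ (a [ i ]) = suc (costᴺ i)
costᴺ (d ⊕ e)   = suc (costᴺ d ℕ.+ costᴺ e)
costᴺ (d ⊖ e)   = suc (costᴺ d ℕ.+ costᴺ e)

costᴿ : RealExp → ℕ
costᴿ zeroᴿ     = 1
costᴿ oneᴿ      = 1
costᴿ (a [ i ]) = suc (costᴺ i)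
costᴿ (d ⊕ e)   = suc (costᴿ d ℕ.+ costᴿ e)
costᴿ (d ⊖ e)   = suc (costᴿ d ℕ.+ costᴿ e)
costᴿ (d ⊗ e)   = suc (costᴿ d ℕ.+ costᴿ e)
costᴿ (d ⊘ e)   = suc (costᴿ d ℕ.+ costᴿ e)

costᶜ : Cond → ℕ
costᶜ (d ≤ᴺ e)  = suc (costᴺ d ℕ.+ costᴺ e)
costᶜ (d ≤ᴿ e)  = suc (costᴿ d ℕ.+ costᴿ e)
costᶜ (notᶜ b)  = suc (costᶜ b)
costᶜ (b and c) = suc (costᶜ b ℕ.+ costᶜ c)

Memory : Set → Set
Memory A = ℕ → ℕ → A

write : {A : Set} → Memory A → ℕ → ℕ → A → Memory A
write m a i x b j = if (a ℕ.≡ᵇ b) ∧ (i ℕ.≡ᵇ j) then x else m b j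

module RealRAM (ℝ : RealField) where
  open RealField ℝ

  record State : Set where
    constructor ⟪_,_⟫
    field
      nats  : Memory ℕ
      reals : Memory Carrier
  open State public

  evalᴺ : State → NatExp → ℕ
  evalᴺ σ (lit k)   = k
  evalᴺ σ (a [ i ]) = nats σ a (evalᴺ σ i)
  evalᴺ σ (d ⊕ e)   = evalᴺ σ d ℕ.+ evalᴺ σ e
  evalᴺ σ (d ⊖ e)   = evalᴺ σ d ℕ.∸ evalᴺ σ e

  evalᴿ : State → RealExp → Carrier
  evalᴿ σ zeroᴿ     = 0#
  evalᴿ σ oneᴿ      = 1#
  evalᴿ σ (a [ i ]) = reals σ a (evalᴺ σ i)
  evalᴿ σ (d ⊕ e)   = evalᴿ σ d + evalᴿ σ e
  evalᴿ σ (d ⊖ e)   = evalᴿ σ d - evalᴿ σ e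
  evalᴿ σ (d ⊗ e)   = evalᴿ σ d * evalᴿ σ e
  evalᴿ σ (d ⊘ e)   = evalᴿ σ d * evalᴿ σ e ⁻¹

  evalᶜ : State → Cond → Bool
  evalᶜ σ (d ≤ᴺ e)  = evalᴺ σ d ℕ.≤ᵇ evalᴺ σ e
  evalᶜ σ (d ≤ᴿ e)  = ⌊ evalᴿ σ d ≤? evalᴿ σ e ⌋
  evalᶜ σ (notᶜ b)  = not (evalᶜ σ b)
  evalᶜ σ (b and c) = evalᶜ σ b ∧ evalᶜ σ c

  -- ⟨ p , σ ⟩⇓⟨ τ , t ⟩: started in σ, the program p halts in τ after t
  -- elementary operations.

  data ⟨_,_⟩⇓⟨_,_⟩ : Program → State → State → ℕ → Set where

    skip : ∀ {σ} → ⟨ skip , σ ⟩⇓⟨ σ , 1 ⟩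

    assignᴺ : ∀ {σ a i e} →
      ⟨ a [ i ]≔ᴺ e , σ ⟩⇓⟨ ⟪ write (nats σ) a (evalᴺ σ i) (evalᴺ σ e) , reals σ ⟫
                          , suc (costᴺ i ℕ.+ costᴺ e) ⟩

    assignᴿ : ∀ {σ a i e} →
      ⟨ a [ i ]≔ᴿ e , σ ⟩⇓⟨ ⟪ nats σ , write (reals σ) a (evalᴺ σ i) (evalᴿ σ e) ⟫
                          , suc (costᴺ i ℕ.+ costᴿ e) ⟩

    seq : ∀ {p q σ τ υ s t} →
      ⟨ p , σ ⟩⇓⟨ τ , s ⟩ → ⟨ q , τ ⟩⇓⟨ υ , t ⟩ →
      ⟨ p ⨾ q , σ ⟩⇓⟨ υ , s ℕ.+ t ⟩

    if-true : ∀ {b p q σ τ t} → evalᶜ σ b ≡ true →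
      ⟨ p , σ ⟩⇓⟨ τ , t ⟩ →
      ⟨ ifᶜ b then p else q , σ ⟩⇓⟨ τ , suc (costᶜ b ℕ.+ t) ⟩

    if-false : ∀ {b p q σ τ t} → evalᶜ σ b ≡ false →
      ⟨ q , σ ⟩⇓⟨ τ , t ⟩ →
      ⟨ ifᶜ b then p else q , σ ⟩⇓⟨ τ , suc (costᶜ b ℕ.+ t) ⟩

    while-true : ∀ {b p σ τ υ s t} → evalᶜ σ b ≡ true →
      ⟨ p , σ ⟩⇓⟨ τ , s ⟩ → ⟨ while b loop p , τ ⟩⇓⟨ υ , t ⟩ →
      ⟨ while b loop p , σ ⟩⇓⟨ υ , suc (costᶜ b ℕ.+ (s ℕ.+ t)) ⟩

    while-false : ∀ {b p σ} → evalᶜ σ b ≡ false →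
      ⟨ while b loop p , σ ⟩⇓⟨ σ , suc (costᶜ b) ⟩

------------------------------------------------------------------------
-- Maximum Bipartite Subgraph on unit disks

module MBS (ℝ : RealField) where
  open RealField ℝ
  open RealRAM ℝ

  Point : Set
  Point = Carrier × Carrier

  _≈ᴾ_ : Rel Point _
  (x , y) ≈ᴾ (x′ , y′) = x ≈ x′ × y ≈ y′

  record UnitDisk : Set where
    constructor disk
    field centre : Point
  open UnitDisk public

  -- Closed disks; both sides of "distance ≤ 1" are squared.
  _∈ᴰ_ : Point → UnitDisk → Set
  (x , y) ∈ᴰ disk (a , b) = (x - a) * (x - a) + (y - b) * (y - b) ≤ 1# * 1#

  Intersect : UnitDisk → UnitDisk → Set
  Intersect D E = ∃[ p ] p ∈ᴰ D × p ∈ᴰ E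

  -- Injectivity: the disks form a set, so no disk is listed twice.
  record DiskSet (n : ℕ) : Set where
    field
      disks    : Fin n → UnitDisk
      distinct : Injective _≡_ _≈ᴾ_ (λ i → centre (disks i))
  open DiskSet public

  intersectionGraph : ∀ {n} → DiskSet n → Subset n → Graph
  intersectionGraph S T = record
    { Vertex   = ∃[ i ] i ∈ T
    ; Adjacent = λ u v → proj₁ u ≢ proj₁ v ×
                         Intersect (disks S (proj₁ u)) (disks S (proj₁ v))
    }

  BipartiteSubset : ∀ {n} → DiskSet n → Subset n → Set
  BipartiteSubset S T = Bipartite (intersectionGraph S T)

  MaximumBipartiteSubset : ∀ {n} → DiskSet n → Subset n → Set
  MaximumBipartiteSubset S T =
    BipartiteSubset S T × (∀ U → BipartiteSubset S U → ∣ U ∣ ℕ.≤ ∣ T ∣)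

  -- Input: n in cell 0 of array 0 of naturals, and the coordinates of the
  -- centres in arrays 0 and 1 of reals; everything else is 0.

  inputNats : ℕ → Memory ℕ
  inputNats n 0 0 = n
  inputNats n _ _ = 0

  coordinate : ∀ {n} → DiskSet n → (Point → Carrier) → ℕ → Carrier
  coordinate {n} S π i with i ℕ.<? n
  ... | yes i<n = π (centre (disks S (fromℕ< i<n)))
  ... | no  _   = 0#

  inputReals : ∀ {n} → DiskSet n → Memory Carrier
  inputReals S 0 i = coordinate S proj₁ i
  inputReals S 1 i = coordinate S proj₂ i
  inputReals S _ i = 0#

  input : ∀ {n} → DiskSet n → State
  input {n} S = ⟪ inputNats n , inputReals S ⟫

  -- Output: disk i is selected iff cell i of array 1 of naturals is nonzero.
  output : ∀ n → State → Subset n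
  output n τ = tabulate λ i → 0 ℕ.<ᵇ nats τ 1 (toℕ i)

  Computes_on_result_time_ : ∀ {n} → Program → DiskSet n → Subset n → ℕ → Set
  Computes_on_result_time_ {n} A S T t =
    ∃[ τ ] ⟨ A , input S ⟩⇓⟨ τ , t ⟩ × output n τ ≡ T

-- A 2-coloured set of unit disks is an independent set of items: each disk
-- yields one item per colour, and two items conflict if they belong to the
-- same disk or to intersecting disks of the same colour.  Rows and columns
-- are layers of width 1, so items of one row, column and colour conflict,
-- while conflicting items are at most two rows and two columns apart.  For
-- each of k shifts, cut the rows into strips of k and drop the last two rows
-- of every strip.  Let a group be two consecutive columns within one strip.
-- A group holds at most 4k independent items, and groups can be listed so
-- that conflicts join only equal or consecutive ones; a dynamic program over
-- the tuples of 4k items therefore finds a best set of surviving items in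
-- time n^O(k).  Each item is dropped for at most two of the k shifts, so the
-- best shift loses at most a fraction 2/k of the optimum, and k is chosen as
-- the least integer with 2/k ≤ ε.

module Submission where

-- The machine shapes the construction. It neither rounds reals nor divides naturals, and the
-- dynamic program keeps one number per tuple. So layers replace rounding, quotients are tabulated
-- by repeated addition, and the weights encode the chosen set, which spares back pointers. Colours
-- become heights 0 and 2 in space, because both kinds of conflict are then the single test
-- "distance at most 2": between different heights it succeeds only for equal centres, that is, for
-- one disk. Intersecting disks have centres at distance at most 2, hence at most two layers of
-- width 1 apart. This is why two dropped rows separate strips and why a group takes two columns.
-- With k rows, 2 columns and 2 colours a group has 4k cells, each of them a clique. Every time
-- bound is a power of B = 2n + 64. Sequencing and nesting add exponents, so the point to watch is
-- that the exponent of each program stays linear in k. For ε at least 1 the empty set suffices;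
-- below 1, rounding 2/ε up to k changes the exponent by a constant factor only.

open import Defs

-- Finite sums and maxima, and a program logic for running times.

module FiniteSumsAndRunningTimes where

  open import Data.Bool using (Bool; true; false; not; _∧_; if_then_else_; T)
  open import Data.Empty using (⊥-elim)
  open import Data.Nat
  open import Data.Nat.DivMod
  open import Data.Nat.Divisibility using (∣-refl)
  open import Data.Nat.Properties
  open import Data.Nat.Solver using (module +-*-Solver)
  open import Data.Product using (∃-syntax; _×_; _,_; proj₁; proj₂)
  open import Data.Sum using (_⊎_; inj₁; inj₂)
  open import Data.Unit using (tt)
  open import Function using (_∘_)
  open import Relation.Binary.PropositionalEquality
  open import Relation.Nullary using (yes; no)

  module Finite where

    true≢false : {b : Bool} {A : Set} → b ≡ true → b ≡ false → A
    true≢false refl ()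

    maxTo : ℕ → (ℕ → ℕ) → ℕ
    maxTo zero    f = 0
    maxTo (suc n) f = maxTo n f ⊔ f n

    sumTo : ℕ → (ℕ → ℕ) → ℕ
    sumTo zero    f = 0
    sumTo (suc n) f = sumTo n f + f n

    allTo : ℕ → (ℕ → Bool) → Bool
    allTo zero    p = true
    allTo (suc n) p = p n ∧ allTo n p

    only : Bool → ℕ → ℕ
    only b x = if b then x else 0

    m<1+n-cases : ∀ {m n} → m < suc n → m < n ⊎ m ≡ n
    m<1+n-cases (s≤s m≤n) = m≤n⇒m<n∨m≡n m≤n

    maxTo-upper : ∀ {n i} f → i < n → f i ≤ maxTo n f
    maxTo-upper {suc n} f i<1+n with m<1+n-cases i<1+n
    ... | inj₁ i<n  = ≤-trans (maxTo-upper f i<n) (m≤m⊔n _ _)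
    ... | inj₂ refl = m≤n⊔m (maxTo n f) _

    maxTo-attained : ∀ n f → maxTo n f ≡ 0 ⊎ (∃[ i ] i < n × maxTo n f ≡ f i)
    maxTo-attained zero    f = inj₁ refl
    maxTo-attained (suc n) f with ≤-total (maxTo n f) (f n) | maxTo-attained n f
    ... | inj₁ le | _ = inj₂ (n , ≤-refl , m≤n⇒m⊔n≡n le)
    ... | inj₂ ge | inj₁ eq = inj₁ (trans (m≥n⇒m⊔n≡m ge) eq)
    ... | inj₂ ge | inj₂ (i , i<n , eq) =
      inj₂ (i , m<n⇒m<1+n i<n , trans (m≥n⇒m⊔n≡m ge) eq)

    maxTo-least : ∀ n {f b} → (∀ i → i < n → f i ≤ b) → maxTo n f ≤ b
    maxTo-least zero    h = z≤n
    maxTo-least (suc n) h = ⊔-lub (maxTo-least n λ i i<n → h i (m<n⇒m<1+n i<n)) (h n ≤-refl)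

    maxTo-mono : ∀ n {f g} → (∀ i → i < n → f i ≤ g i) → maxTo n f ≤ maxTo n g
    maxTo-mono n {f} {g} h = maxTo-least n λ i i<n → ≤-trans (h i i<n) (maxTo-upper g i<n)

    maxTo-cong : ∀ n {f g} → (∀ i → i < n → f i ≡ g i) → maxTo n f ≡ maxTo n g
    maxTo-cong zero    h = refl
    maxTo-cong (suc n) h = cong₂ _⊔_ (maxTo-cong n λ i i<n → h i (m<n⇒m<1+n i<n)) (h n ≤-refl)

    sumTo-cong : ∀ n {f g} → (∀ i → i < n → f i ≡ g i) → sumTo n f ≡ sumTo n g
    sumTo-cong zero    h = refl
    sumTo-cong (suc n) h = cong₂ _+_ (sumTo-cong n λ i i<n → h i (m<n⇒m<1+n i<n)) (h n ≤-refl)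

    sumTo-mono : ∀ n {f g} → (∀ i → i < n → f i ≤ g i) → sumTo n f ≤ sumTo n g
    sumTo-mono zero    h = z≤n
    sumTo-mono (suc n) h = +-mono-≤ (sumTo-mono n λ i i<n → h i (m<n⇒m<1+n i<n)) (h n ≤-refl)

    sumTo-strict : ∀ n {f g i} → (∀ i → i < n → f i ≤ g i) → i < n → f i < g i →
                   sumTo n f < sumTo n g
    sumTo-strict (suc n) h i<1+n lt with m<1+n-cases i<1+n
    ... | inj₁ i<n  = +-mono-<-≤ (sumTo-strict n (λ j j<n → h j (m<n⇒m<1+n j<n)) i<n lt) (h n ≤-refl)
    ... | inj₂ refl = +-mono-≤-< (sumTo-mono n (λ j j<n → h j (m<n⇒m<1+n j<n))) lt

    +-interchange : ∀ a b c d → (a + b) + (c + d) ≡ (a + c) + (b + d)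
    +-interchange = solve 4 (λ a b c d → (a :+ b) :+ (c :+ d) := (a :+ c) :+ (b :+ d)) refl
      where open +-*-Solver

    sumTo-+ : ∀ n f g → sumTo n (λ i → f i + g i) ≡ sumTo n f + sumTo n g
    sumTo-+ zero    f g = refl
    sumTo-+ (suc n) f g = trans (cong (_+ (f n + g n)) (sumTo-+ n f g))
                                (+-interchange (sumTo n f) (sumTo n g) (f n) (g n))

    sumTo-* : ∀ n f c → sumTo n (λ i → f i * c) ≡ sumTo n f * c
    sumTo-* zero    f c = refl
    sumTo-* (suc n) f c = trans (cong (_+ f n * c) (sumTo-* n f c)) (sym (*-distribʳ-+ c (sumTo n f) (f n)))

    sumTo-const : ∀ n c → sumTo n (λ _ → c) ≡ n * c
    sumTo-const zero    c = refl
    sumTo-const (suc n) c = trans (cong (_+ c) (sumTo-const n c)) (+-comm (n * c) c)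

    sumTo-zero : ∀ n {f} → (∀ i → i < n → f i ≡ 0) → sumTo n f ≡ 0
    sumTo-zero n h = trans (sumTo-cong n h) (trans (sumTo-const n 0) (*-zeroʳ n))

    sumTo-swap : ∀ m n (f : ℕ → ℕ → ℕ) →
                 sumTo m (λ i → sumTo n (f i)) ≡ sumTo n (λ j → sumTo m (λ i → f i j))
    sumTo-swap zero    n f = sym (sumTo-zero n λ _ _ → refl)
    sumTo-swap (suc m) n f = trans (cong (_+ sumTo n (f m)) (sumTo-swap m n f))
                                   (sym (sumTo-+ n (λ j → sumTo m (λ i → f i j)) (f m)))

    sumTo-upper : ∀ {n i} f → i < n → f i ≤ sumTo n f
    sumTo-upper {suc n} f i<1+n with m<1+n-cases i<1+n
    ... | inj₁ i<n  = ≤-trans (sumTo-upper f i<n) (m≤m+n _ _)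
    ... | inj₂ refl = m≤n+m _ (sumTo n f)

    sumTo-append : ∀ m n f → sumTo (m + n) f ≡ sumTo m f + sumTo n (λ i → f (m + i))
    sumTo-append m zero    f rewrite +-identityʳ m = sym (+-identityʳ _)
    sumTo-append m (suc n) f rewrite +-suc m n =
      trans (cong (_+ f (m + n)) (sumTo-append m n f)) (+-assoc (sumTo m f) _ _)

    ∧-elim : ∀ {a b} → a ∧ b ≡ true → a ≡ true × b ≡ true
    ∧-elim {true} {true} _ = refl , refl

    allTo-elim : ∀ {n i} p → allTo n p ≡ true → i < n → p i ≡ true
    allTo-elim {suc n} p eq i<1+n with ∧-elim {p n} eq | m<1+n-cases i<1+n
    ... | _ , rest | inj₁ i<n  = allTo-elim p rest i<n
    ... | pn , _   | inj₂ refl = pn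

    allTo-intro : ∀ n {p} → (∀ i → i < n → p i ≡ true) → allTo n p ≡ true
    allTo-intro zero    h = refl
    allTo-intro (suc n) h rewrite h n ≤-refl = allTo-intro n λ i i<n → h i (m<n⇒m<1+n i<n)

    allTo-cong : ∀ n {f g} → (∀ i → i < n → f i ≡ g i) → allTo n f ≡ allTo n g
    allTo-cong zero    h = refl
    allTo-cong (suc n) h = cong₂ _∧_ (h n ≤-refl) (allTo-cong n λ i i<n → h i (m<n⇒m<1+n i<n))

    ≤ᵇ-true : ∀ {m n} → m ≤ n → (m ≤ᵇ n) ≡ true
    ≤ᵇ-true {m} {n} le with m ≤ᵇ n | ≤⇒≤ᵇ le
    ... | true | _ = refl

    ≤ᵇ-false : ∀ {m n} → n < m → (m ≤ᵇ n) ≡ false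
    ≤ᵇ-false {m} {n} lt with m ≤ᵇ n in eq
    ... | false = refl
    ... | true  = ⊥-elim (<⇒≱ lt (≤ᵇ⇒≤ m n (subst T (sym eq) tt)))

    ≤ᵇ-true⁻ : ∀ {m n} → (m ≤ᵇ n) ≡ true → m ≤ n
    ≤ᵇ-true⁻ {m} {n} eq = ≤ᵇ⇒≤ m n (subst T (sym eq) tt)

    ≤ᵇ-false⁻ : ∀ {m n} → (m ≤ᵇ n) ≡ false → n < m
    ≤ᵇ-false⁻ {m} {n} eq with m ≤? n
    ... | yes le = true≢false (≤ᵇ-true le) eq
    ... | no ≰   = ≰⇒> ≰

    ≡ᵇ-true : ∀ {m n} → m ≡ n → (m ≡ᵇ n) ≡ true
    ≡ᵇ-true {m} {n} e with m ≡ᵇ n | ≡⇒≡ᵇ m n e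
    ... | true | _ = refl

    ≡ᵇ-true⁻ : ∀ {m n} → (m ≡ᵇ n) ≡ true → m ≡ n
    ≡ᵇ-true⁻ {m} {n} eq = ≡ᵇ⇒≡ m n (subst T (sym eq) tt)

    ≡ᵇ-false : ∀ {m n} → m ≢ n → (m ≡ᵇ n) ≡ false
    ≡ᵇ-false {m} {n} ne with m ≡ᵇ n in eq
    ... | false = refl
    ... | true  = ⊥-elim (ne (≡ᵇ-true⁻ eq))

    -- The remainder modulo `k` recovers the low digit. Groups, slots and rows of the table of
    -- tuples are all numbered in mixed radix and told apart by this lemma.
    digits-unique : ∀ {k x x′} y y′ → x < k → x′ < k → x + k * y ≡ x′ + k * y′ → x ≡ x′ × y ≡ y′
    digits-unique {k} {x} {x′} y y′ x<k x′<k eq = x≡x′ , y≡y′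
      where
      instance
        k≢0 : NonZero k
        k≢0 = >-nonZero (≤-<-trans z≤n x<k)
      rem : ∀ z w → z < k → (z + k * w) % k ≡ z
      rem z w z<k = trans (cong (λ v → (z + v) % k) (*-comm k w))
                          (trans ([m+kn]%n≡m%n z w k) (m<n⇒m%n≡m z<k))
      x≡x′ : x ≡ x′
      x≡x′ = trans (sym (rem x y x<k)) (trans (cong (_% k) eq) (rem x′ y′ x′<k))
      y≡y′ : y ≡ y′
      y≡y′ = *-cancelˡ-≡ y y′ k (+-cancelˡ-≡ x (k * y) (k * y′)
               (trans eq (cong (_+ k * y′) (sym x≡x′))))

    [m+n]/n : ∀ m n .{{_ : NonZero n}} → (m + n) / n ≡ suc (m / n)
    [m+n]/n m n = trans (cong (_/ n) (+-comm m n))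
                    (trans (+-distrib-/-∣ˡ m (∣-refl {n})) (cong (_+ m / n) (n/n≡1 n)))

    n<2^n : ∀ n → n < 2 ^ n
    n<2^n zero    = s≤s z≤n
    n<2^n (suc n) = begin-strict
      suc n          ≤⟨ n<2^n n ⟩
      2 ^ n          <⟨ m<m+n (2 ^ n) (m^n>0 2 n) ⟩
      2 ^ n + 2 ^ n  ≡⟨ cong (2 ^ n +_) (sym (+-identityʳ (2 ^ n))) ⟩
      2 ^ suc n      ∎
      where open ≤-Reasoning

    -- Count the pairs (j, a) with `t j ≡ a` in two ways: every `a` selected by `p` occurs at least
    -- once, and every `j` accounts for at most one `a`.
    sumTo-cover : ∀ M m (p : ℕ → Bool) (t w : ℕ → ℕ) →
                  (∀ a → a < M → p a ≡ true → ∃[ j ] j < m × t j ≡ a) →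
                  sumTo M (λ a → only (p a) (w a)) ≤ sumTo m (w ∘ t)
    sumTo-cover M m p t w h = begin
      sumTo M (λ a → only (p a) (w a))
        ≤⟨ sumTo-mono M row ⟩
      sumTo M (λ a → sumTo m (λ j → only (t j ≡ᵇ a) (w a)))
        ≡⟨ sumTo-swap M m _ ⟩
      sumTo m (λ j → sumTo M (λ a → only (t j ≡ᵇ a) (w a)))
        ≤⟨ sumTo-mono m (λ j _ → single M (t j)) ⟩
      sumTo m (w ∘ t) ∎
      where
      open ≤-Reasoning
      row : ∀ a → a < M → only (p a) (w a) ≤ sumTo m (λ j → only (t j ≡ᵇ a) (w a))
      row a a<M with p a in pa
      ... | false = z≤n
      ... | true with h a a<M pa
      ... | j , j<m , refl =
        ≤-trans (≤-reflexive (cong (λ b → only b (w (t j))) (sym (≡ᵇ-true {t j} refl))))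
                (sumTo-upper (λ i → only (t i ≡ᵇ t j) (w (t j))) j<m)
      single : ∀ n b → sumTo n (λ a → only (b ≡ᵇ a) (w a)) ≤ w b
      single zero b = z≤n
      single (suc n) b with b ≟ n
      ... | yes refl rewrite ≡ᵇ-true {b} refl
                           | sumTo-zero n {λ a → only (n ≡ᵇ a) (w a)}
                               (λ i i<n → cong (λ c → only c (w i)) (≡ᵇ-false (>⇒≢ i<n))) = ≤-refl
      ... | no b≢n rewrite ≡ᵇ-false b≢n | +-identityʳ (sumTo n (λ a → only (b ≡ᵇ a) (w a))) = single n b

  -- Boolean rather than relational: for a concrete program and array, `T (keepsᴺ p a)` computes to
  -- the unit type, so that most frame conditions are filled in as implicit arguments.
  keepsᴺ keepsᴿ : Program → ℕ → Bool
  keepsᴺ skip                    a = true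
  keepsᴺ (b [ _ ]≔ᴺ _)           a = not (b ≡ᵇ a)
  keepsᴺ (b [ _ ]≔ᴿ _)           a = true
  keepsᴺ (p ⨾ q)                 a = keepsᴺ p a ∧ keepsᴺ q a
  keepsᴺ (ifᶜ _ then p else q)   a = keepsᴺ p a ∧ keepsᴺ q a
  keepsᴺ (while _ loop p)        a = keepsᴺ p a
  keepsᴿ skip                    a = true
  keepsᴿ (b [ _ ]≔ᴺ _)           a = true
  keepsᴿ (b [ _ ]≔ᴿ _)           a = not (b ≡ᵇ a)
  keepsᴿ (p ⨾ q)                 a = keepsᴿ p a ∧ keepsᴿ q a
  keepsᴿ (ifᶜ _ then p else q)   a = keepsᴿ p a ∧ keepsᴿ q a
  keepsᴿ (while _ loop p)        a = keepsᴿ p a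

  pattern var v = _[_] v (lit 0)

  -- Conditions offer only `≤`, so `v < e` is tested as `v + 1 ≤ e`. The bound is evaluated anew in
  -- each round, hence rules for this loop must know that its value persists.
  forᶜ_below_loop_ : ℕ → NatExp → Program → Program
  forᶜ v below e loop p =
    v [ lit 0 ]≔ᴺ lit 0 ⨾
    while (var v ⊕ lit 1 ≤ᴺ e) loop (p ⨾ v [ lit 0 ]≔ᴺ var v ⊕ lit 1)

  -- Running times are bounded by powers of B: with B ≥ 64 every program
  -- construct costs at most one more factor of B.

  module Execution (ℝ : RealField) (B : ℕ) (64≤B : 64 ≤ B) where
    open RealField ℝ using (Carrier)
    open RealRAM ℝ
    open Finite

    open ≤-Reasoning

    instance
      B≢0 : NonZero B
      B≢0 = >-nonZero (≤-trans (s≤s z≤n) 64≤B)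

    1≤B^ : ∀ e → 1 ≤ B ^ e
    1≤B^ e = m^n>0 B e

    small : ∀ {c} {_ : T (c ≤ᵇ 64)} → c ≤ B ^ 1
    small {c} {ok} = ≤-trans (≤ᵇ⇒≤ c 64 ok) (≤-trans 64≤B (≤-reflexive (sym (*-identityʳ B))))

    B^-mono : ∀ {d e} → d ≤ e → B ^ d ≤ B ^ e
    B^-mono = ^-monoʳ-≤ B

    B^-* : ∀ {x y} d e → x ≤ B ^ d → y ≤ B ^ e → x * y ≤ B ^ (d + e)
    B^-* d e p q = ≤-trans (*-mono-≤ p q) (≤-reflexive (sym (^-distribˡ-+-* B d e)))

    -- Each of the four terms is at most its coefficient times `B ^ (d + e)`, and the coefficients
    -- sum to at most 64, which the extra factor `B` absorbs.
    B^-bilinear : ∀ {x y} d e {p q r s} → {_ : T (p + q + r + s ≤ᵇ 64)} →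
                  x ≤ B ^ d → y ≤ B ^ e → p + q * x + r * y + s * (x * y) ≤ B ^ suc (d + e)
    B^-bilinear {x} {y} d e {p} {q} {r} {s} {ok} hx hy = begin
      p + q * x + r * y + s * (x * y)
        ≤⟨ +-mono-≤ (+-mono-≤ (+-mono-≤ (m≤m*n p z {{nz}}) (*-monoʳ-≤ q x≤z)) (*-monoʳ-≤ r y≤z)) (*-monoʳ-≤ s xy≤z) ⟩
      p * z + q * z + r * z + s * z  ≡⟨ collect p q r s z ⟩
      (p + q + r + s) * z  ≤⟨ *-monoˡ-≤ z (≤-trans (≤ᵇ⇒≤ (p + q + r + s) 64 ok) 64≤B) ⟩
      B * z ∎
      where
      z = B ^ (d + e)
      nz : NonZero z
      nz = >-nonZero (1≤B^ (d + e))
      x≤z = ≤-trans hx (B^-mono (m≤m+n d e))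
      y≤z = ≤-trans hy (B^-mono (m≤n+m e d))
      xy≤z = B^-* d e hx hy
      collect : ∀ p q r s z → p * z + q * z + r * z + s * z ≡ (p + q + r + s) * z
      collect = solve 5 (λ p q r s z → p :* z :+ q :* z :+ r :* z :+ s :* z := (p :+ q :+ r :+ s) :* z) refl
        where open +-*-Solver

    B^-+ : ∀ {x y} d e → x ≤ B ^ d → y ≤ B ^ e → suc (x + y) ≤ B ^ suc (d + e)
    B^-+ {x} {y} d e hx hy = ≤-trans (≤-reflexive (shape x y)) (B^-bilinear d e {1} {1} {1} {0} hx hy)
      where
      shape : ∀ x y → suc (x + y) ≡ 1 + 1 * x + 1 * y + 0 * (x * y)
      shape = solve 2 (λ x y → con 1 :+ (x :+ y)
                := con 1 :+ con 1 :* x :+ con 1 :* y :+ con 0 :* (x :* y)) refl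
        where open +-*-Solver

    setᴺ : State → ℕ → ℕ → ℕ → State
    setᴺ σ a i x = ⟪ write (nats σ) a i x , reals σ ⟫

    setᴿ : State → ℕ → ℕ → Carrier → State
    setᴿ σ a i x = ⟪ nats σ , write (reals σ) a i x ⟫

    module _ {A : Set} where

      write-hit : ∀ (m : Memory A) a {i j x} → i ≡ j → write m a i x a j ≡ x
      write-hit m a {i} refl rewrite ≡ᵇ-true {a} refl | ≡ᵇ-true {i} refl = refl

      write-miss : ∀ (m : Memory A) a {i j x} → i ≢ j → write m a i x a j ≡ m a j
      write-miss m a {i} i≢j rewrite ≡ᵇ-false i≢j with a ≡ᵇ a
      ... | true  = refl
      ... | false = refl

      write-miss-at : ∀ (m : Memory A) a {i i′ j x} → i ≡ i′ → i′ ≢ j → write m a i x a j ≡ m a j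
      write-miss-at m a refl = write-miss m a

      write-elsewhere : ∀ (m : Memory A) a {b} i {j} x → (a ≡ᵇ b) ≡ false → write m a i x b j ≡ m b j
      write-elsewhere m a i x eq rewrite eq = refl

    -- Indexed by a program instead of a list of arrays, so that each round of a loop can be told
    -- what the loop as a whole preserves.
    record Same (p : Program) (σ τ : State) : Set where
      constructor same
      field
        sameᴺ : ∀ a {_ : T (keepsᴺ p a)} i → nats τ a i ≡ nats σ a i
        sameᴿ : ∀ a {_ : T (keepsᴿ p a)} i → reals τ a i ≡ reals σ a i
    open Same public

    T-∧ : ∀ a {b} → T (a ∧ b) → T a × T b
    T-∧ true t = tt , t

    T-∧-intro : ∀ {a b} → T a → T b → T (a ∧ b)
    T-∧-intro {true} _ t = t

    T-not : ∀ {a} → T (not a) → a ≡ false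
    T-not {false} _ = refl

    Same-refl : ∀ {p σ} → Same p σ σ
    Same-refl = same (λ _ _ → refl) (λ _ _ → refl)

    Same-trans : ∀ {p σ τ υ} → Same p σ τ → Same p τ υ → Same p σ υ
    Same-trans (same n r) (same n′ r′) =
      same (λ a {k} i → trans (n′ a {k} i) (n a {k} i)) (λ a {k} i → trans (r′ a {k} i) (r a {k} i))

    Same-weaken : ∀ {p q σ τ} → (∀ a → T (keepsᴺ q a) → T (keepsᴺ p a)) →
                  (∀ a → T (keepsᴿ q a) → T (keepsᴿ p a)) → Same p σ τ → Same q σ τ
    Same-weaken f g (same n r) = same (λ a {k} → n a {f a k}) (λ a {k} → r a {g a k})

    Same-⨾ˡ : ∀ {p q σ τ} → Same p σ τ → Same (p ⨾ q) σ τ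
    Same-⨾ˡ {p} = Same-weaken (λ a → proj₁ ∘ T-∧ (keepsᴺ p a)) (λ a → proj₁ ∘ T-∧ (keepsᴿ p a))

    Same-⨾ʳ : ∀ {p q σ τ} → Same q σ τ → Same (p ⨾ q) σ τ
    Same-⨾ʳ {p} = Same-weaken (λ a → proj₂ ∘ T-∧ (keepsᴺ p a)) (λ a → proj₂ ∘ T-∧ (keepsᴿ p a))

    frame : ∀ {p σ τ t} → ⟨ p , σ ⟩⇓⟨ τ , t ⟩ → Same p σ τ
    frame skip = Same-refl
    frame {σ = σ} (assignᴺ {a = a} {i = i} {e = e}) =
      same (λ b {k} j → write-elsewhere (nats σ) a (evalᴺ σ i) (evalᴺ σ e) (T-not k)) (λ _ _ → refl)
    frame {σ = σ} (assignᴿ {a = a} {i = i} {e = e}) =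
      same (λ _ _ → refl) (λ b {k} j → write-elsewhere (reals σ) a (evalᴺ σ i) (evalᴿ σ e) (T-not k))
    frame {p ⨾ q} (seq d e) = Same-trans (Same-⨾ˡ {p} {q} (frame d)) (Same-⨾ʳ {p} {q} (frame e))
    frame {ifᶜ _ then p else q} (if-true _ d)  =
      Same-weaken (λ a → proj₁ ∘ T-∧ (keepsᴺ p a)) (λ a → proj₁ ∘ T-∧ (keepsᴿ p a)) (frame d)
    frame {ifᶜ _ then p else q} (if-false _ d) =
      Same-weaken (λ a → proj₂ ∘ T-∧ (keepsᴺ p a)) (λ a → proj₂ ∘ T-∧ (keepsᴿ p a)) (frame d)
    frame {while b loop p} (while-true _ d e) =
      Same-trans (Same-weaken {p} {while b loop p} (λ _ k → k) (λ _ k → k) (frame d)) (frame e)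
    frame (while-false _) = Same-refl

    -- A Hoare triple for total correctness with a time bound. Only the exponent of `B` is recorded,
    -- which keeps the bookkeeping additive.
    record Runs (p : Program) (σ : State) (e : ℕ) (Q : State → Set) : Set where
      constructor runs
      field
        {final} : State
        {time}  : ℕ
        exec    : ⟨ p , σ ⟩⇓⟨ final , time ⟩
        time≤   : time ≤ B ^ e
        post    : Q final

    runs-weaken : ∀ {p σ d e P Q} → d ≤ e → Runs p σ d P →
                  (∀ τ → Same p σ τ → P τ → Q τ) → Runs p σ e Q
    runs-weaken d≤e (runs x t h) f = runs x (≤-trans t (B^-mono d≤e)) (f _ (frame x) h)

    runs-skip : ∀ {σ Q} → Q σ → Runs skip σ 1 Q
    runs-skip h = runs skip small h

    runs-≔ᴺ : ∀ {σ a i e c Q} → suc (costᴺ i + costᴺ e) ≤ B ^ c →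
              Q (setᴺ σ a (evalᴺ σ i) (evalᴺ σ e)) → Runs (a [ i ]≔ᴺ e) σ c Q
    runs-≔ᴺ t h = runs assignᴺ t h

    runs-≔ᴿ : ∀ {σ a i e c Q} → suc (costᴺ i + costᴿ e) ≤ B ^ c →
              Q (setᴿ σ a (evalᴺ σ i) (evalᴿ σ e)) → Runs (a [ i ]≔ᴿ e) σ c Q
    runs-≔ᴿ t h = runs assignᴿ t h

    runs-⨾ : ∀ {p q σ d e P Q} → Runs p σ d P →
             (∀ τ → Same p σ τ → P τ → Runs q τ e Q) → Runs (p ⨾ q) σ (suc (d + e)) Q
    runs-⨾ {d = d} {e} (runs x t h) k with k _ (frame x) h
    ... | runs y u h′ = runs (seq x y) (≤-trans (n≤1+n _) (B^-+ d e t u)) h′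

    runs-if : ∀ {b p q σ c e Q} → costᶜ b ≤ B ^ c →
              (evalᶜ σ b ≡ true → Runs p σ e Q) → (evalᶜ σ b ≡ false → Runs q σ e Q) →
              Runs (ifᶜ b then p else q) σ (suc (c + e)) Q
    runs-if {b} {σ = σ} {c} {e} hc yes-case no-case with evalᶜ σ b in eq
    ... | true  = let runs x t h = yes-case refl in runs (if-true eq x) (B^-+ c e hc t) h
    ... | false = let runs x t h = no-case refl in runs (if-false eq x) (B^-+ c e hc t) h

    -- The invariant I i describes the state in which the loop variable has
    -- just been set to i; what the loop does not write is known throughout.
    runs-for : ∀ {v e p σ} N d t {_ : T (costᴺ e ≤ᵇ 9)} {_ : T (keepsᴺ p v)} (I : ℕ → State → Set) →
               let loop = forᶜ v below e loop p in
               N ≤ B ^ d →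
               (∀ τ → Same loop σ τ → evalᴺ τ e ≡ N) →
               I 0 (setᴺ σ v 0 0) →
               (∀ i τ → i < N → nats τ v 0 ≡ i → Same loop σ τ → I i τ →
                 Runs p τ t λ τ′ → I (suc i) (setᴺ τ′ v 0 (suc i))) →
               Runs loop σ (suc (d + t)) (I N)
    runs-for {v} {e} {p} {σ} N d t {ce} {kv} I N≤ bound start step =
      finish (go N 0 (setᴺ σ v 0 0) (+-identityʳ N) (write-hit (nats σ) v refl)
                 (frame {v [ lit 0 ]≔ᴺ lit 0} assignᴺ ⊕ʷ) start)
      where
      loop = forᶜ v below e loop p
      inc  = v [ lit 0 ]≔ᴺ var v ⊕ lit 1
      body = p ⨾ inc
      wh   = while (var v ⊕ lit 1 ≤ᴺ e) loop body

      _⊕ʷ : ∀ {σ τ} → Same (v [ lit 0 ]≔ᴺ lit 0) σ τ → Same loop σ τ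
      _⊕ʷ = Same-⨾ˡ {v [ lit 0 ]≔ᴺ lit 0} {wh}

      record Rest (r : ℕ) (τ : State) : Set where
        constructor rest
        field
          {τ∞}  : State
          {s}   : ℕ
          exec∞ : ⟨ wh , τ ⟩⇓⟨ τ∞ , s ⟩
          -- A test of the loop condition costs `6 + costᴺ e`, at most 16 because `costᴺ e` is at
          -- most 9; the increment of the loop variable adds 6 in each of the `r` remaining rounds.
          s≤    : s ≤ 16 + r * (22 + B ^ t)
          post∞ : I N τ∞

      cost≤ : 6 + costᴺ e ≤ 16
      cost≤ = ≤-trans (+-monoʳ-≤ 6 (≤ᵇ⇒≤ (costᴺ e) 9 ce)) (n≤1+n 15)

      go : ∀ r i τ → r + i ≡ N → nats τ v 0 ≡ i → Same loop σ τ → I i τ → Rest r τ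
      go zero i τ refl vi sm inv =
        rest (while-false test) (≤-trans cost≤ (≤-reflexive (sym (+-identityʳ 16)))) inv
        where
        test : (nats τ v 0 + 1 ≤ᵇ evalᴺ τ e) ≡ false
        test rewrite vi | bound τ sm = ≤ᵇ-false (≤-reflexive (+-comm 1 i))
      go (suc r) i τ eq vi sm inv = rest (while-true test (seq x assignᴺ) y) total inv′
        where
        i<N : i < N
        i<N = subst (i <_) eq (s≤s (m≤n+m i r))
        test : (nats τ v 0 + 1 ≤ᵇ evalᴺ τ e) ≡ true
        test rewrite vi | bound τ sm = ≤ᵇ-true (subst (_≤ N) (+-comm 1 i) i<N)
        open Runs (step i τ i<N vi sm inv) renaming (final to τ′; exec to x; time≤ to t≤; post to h)
        vi′ : nats τ′ v 0 + 1 ≡ suc i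
        vi′ = trans (cong (_+ 1) (trans (sameᴺ (frame x) v {kv} 0) vi)) (+-comm i 1)
        sm′ : Same loop σ (setᴺ τ′ v 0 (nats τ′ v 0 + 1))
        sm′ = Same-trans sm (Same-⨾ʳ {v [ lit 0 ]≔ᴺ lit 0} {wh}
                (Same-weaken {body} {wh} (λ _ k → k) (λ _ k → k) (frame (seq x assignᴺ))))
        open Rest (go r (suc i) (setᴺ τ′ v 0 (nats τ′ v 0 + 1)) (trans (+-suc r i) eq)
                    (trans (write-hit (nats τ′) v refl) vi′) sm′
                    (subst (λ z → I (suc i) (setᴺ τ′ v 0 z)) (sym vi′) h))
          renaming (exec∞ to y; s≤ to s≤; post∞ to inv′)
        total : suc (costᶜ (var v ⊕ lit 1 ≤ᴺ e) + ((Runs.time (step i τ i<N vi sm inv) + 6) + s)) ≤ 16 + suc r * (22 + B ^ t)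
        total = begin
          (6 + costᴺ e) + ((_ + 6) + s)                          ≤⟨ +-mono-≤ cost≤ (+-mono-≤ (+-monoˡ-≤ 6 t≤) s≤) ⟩
          16 + ((B ^ t + 6) + (16 + r * (22 + B ^ t)))           ≡⟨ shape (B ^ t) (r * (22 + B ^ t)) ⟩
          16 + suc r * (22 + B ^ t)                              ∎
          where
          shape : ∀ x y → 16 + ((x + 6) + (16 + y)) ≡ 16 + (22 + x + y)
          shape = solve 2 (λ x y → con 16 :+ ((x :+ con 6) :+ (con 16 :+ y)) := con 16 :+ (con 22 :+ x :+ y)) refl
            where open +-*-Solver

      finish : Rest N (setᴺ σ v 0 0) → Runs loop σ (suc (d + t)) (I N)
      finish R = runs (seq assignᴺ (Rest.exec∞ R)) total (Rest.post∞ R)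
        where
        total : 3 + Rest.s R ≤ B ^ suc (d + t)
        total = begin
          3 + Rest.s R                                           ≤⟨ +-monoʳ-≤ 3 (Rest.s≤ R) ⟩
          3 + (16 + N * (22 + B ^ t))                            ≡⟨ shape N (B ^ t) ⟩
          19 + 22 * N + 0 * B ^ t + 1 * (N * B ^ t)              ≤⟨ B^-bilinear d t {19} {22} {0} {1} N≤ ≤-refl ⟩
          B ^ suc (d + t)                                        ∎
          where
          shape : ∀ x y → 3 + (16 + x * (22 + y)) ≡ 19 + 22 * x + 0 * y + 1 * (x * y)
          shape = solve 2 (λ x y → con 3 :+ (con 16 :+ x :* (con 22 :+ y))
                    := con 19 :+ con 22 :* x :+ con 0 :* y :+ con 1 :* (x :* y)) refl
            where open +-*-Solver

-- Ordered fields: distances, layers of reals, and the embedding of the naturals.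

module RealNumbers where

  open import Algebra.Bundles using (CommutativeRing)
  import Algebra.Properties.Ring
  import Algebra.Solver.Ring.NaturalCoefficients.Default
  open import Data.Bool using (Bool; true; false; not)
  open import Data.Empty using (⊥-elim)
  open import Data.Nat as ℕ using (ℕ; zero; suc; z≤n; s≤s)
  import Data.Nat.Properties as ℕₚ
  open import Data.Product using (∃-syntax; _×_; _,_)
  open import Data.Sum using (inj₁; inj₂)
  open import Function using (case_of_)
  open import Relation.Binary.PropositionalEquality as ≡ using (_≡_)
  open import Relation.Nullary using (¬_; yes; no)
  open import Relation.Nullary.Decidable using (⌊_⌋)
  open FiniteSumsAndRunningTimes

  module OrderedFieldProperties (F : OrderedField) where
    open OrderedField F

    commutativeRing : CommutativeRing _ _
    commutativeRing = record { isCommutativeRing = isCommutativeRing }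

    open CommutativeRing commutativeRing public
      using (commutativeSemiring; ring; refl; sym; trans; setoid)
    open Algebra.Properties.Ring ring public
      using (-‿distribˡ-*; -‿distribʳ-*; -‿involutive; -‿+-comm; x∙y⁻¹≈ε⇒x≈y; -0#≈0#)
    open Algebra.Solver.Ring.NaturalCoefficients.Default commutativeSemiring public
      using (solve; _:+_; _:*_; _:=_; con)

    2# : Carrier
    2# = 1# + 1#

    ≤-respˡ : ∀ {x y z} → x ≈ y → x ≤ z → y ≤ z
    ≤-respˡ e = ≤-trans (≤-reflexive (sym e))

    ≤-respʳ : ∀ {x y z} → x ≈ y → z ≤ x → z ≤ y
    ≤-respʳ e le = ≤-trans le (≤-reflexive e)

    ≰⇒≥ : ∀ {x y} → ¬ (x ≤ y) → y ≤ x
    ≰⇒≥ {x} {y} x≰y with total x y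
    ... | inj₁ x≤y = ⊥-elim (x≰y x≤y)
    ... | inj₂ y≤x = y≤x

    +-mono-≤ : ∀ {w x y z} → w ≤ x → y ≤ z → w + y ≤ x + z
    +-mono-≤ {w} {x} {y} {z} w≤x y≤z =
      ≤-trans (+-monoˡ-≤ y w≤x) (≤-respˡ (+-comm y x) (≤-respʳ (+-comm z x) (+-monoˡ-≤ x y≤z)))

    x+z-z : ∀ x z → x + z - z ≈ x
    x+z-z x z = trans (+-assoc x z (- z)) (trans (+-cong refl (-‿inverseʳ z)) (+-identityʳ x))

    x-z+z : ∀ x z → x - z + z ≈ x
    x-z+z x z = trans (+-assoc x (- z) z) (trans (+-cong refl (-‿inverseˡ z)) (+-identityʳ x))

    +-cancelʳ-≤ : ∀ {x y} z → x + z ≤ y + z → x ≤ y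
    +-cancelʳ-≤ {x} {y} z le = ≤-respˡ (x+z-z x z) (≤-respʳ (x+z-z y z) (+-monoˡ-≤ (- z) le))

    ≤+⇒-≤ : ∀ {x y z} → x ≤ y + z → x - y ≤ z
    ≤+⇒-≤ {x} {y} {z} le = ≤-respʳ (x+z-z z y) (+-monoˡ-≤ (- y) (≤-respʳ (+-comm y z) le))

    -≤⇒≤+ : ∀ {x y z} → x - y ≤ z → x ≤ y + z
    -≤⇒≤+ {x} {y} {z} le = ≤-respˡ (x-z+z x y) (≤-respʳ (+-comm z y) (+-monoˡ-≤ y le))

    0≤⇒-≤0 : ∀ {x} → x ≤ 0# → 0# ≤ - x
    0≤⇒-≤0 {x} le = ≤-respˡ (-‿inverseʳ x) (≤-respʳ (+-identityˡ (- x)) (+-monoˡ-≤ (- x) le))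

    neg-sq : ∀ x → (- x) * (- x) ≈ x * x
    neg-sq x = trans (sym (-‿distribˡ-* x (- x)))
                 (trans (-‿cong (sym (-‿distribʳ-* x x))) (-‿involutive (x * x)))

    0≤sq : ∀ x → 0# ≤ x * x
    0≤sq x with total 0# x
    ... | inj₁ 0≤x = *-nonneg 0≤x 0≤x
    ... | inj₂ x≤0 = ≤-respʳ (neg-sq x) (*-nonneg (0≤⇒-≤0 x≤0) (0≤⇒-≤0 x≤0))

    0≤1 : 0# ≤ 1#
    0≤1 = ≤-respʳ (*-identityˡ 1#) (0≤sq 1#)

    x≤x+y : ∀ {x y} → 0# ≤ y → x ≤ x + y
    x≤x+y {x} {y} 0≤y = ≤-respˡ (+-identityʳ x) (+-mono-≤ ≤-refl 0≤y)

    +-nonneg : ∀ {x y} → 0# ≤ x → 0# ≤ y → 0# ≤ x + y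
    +-nonneg 0≤x 0≤y = ≤-trans 0≤x (x≤x+y 0≤y)

    1≤2 : 1# ≤ 2#
    1≤2 = x≤x+y 0≤1

    0≤2 : 0# ≤ 2#
    0≤2 = ≤-trans 0≤1 1≤2

    2≉0 : ¬ (2# ≈ 0#)
    2≉0 e = 0≉1 (antisym 0≤1 (≤-trans 1≤2 (≤-reflexive e)))

    0≤-⇒≤ : ∀ {x y} → 0# ≤ y - x → x ≤ y
    0≤-⇒≤ {x} {y} le = ≤-respˡ (+-identityˡ x) (≤-respʳ (x-z+z y x) (+-monoˡ-≤ x le))

    ≤⇒0≤- : ∀ {x y} → x ≤ y → 0# ≤ y - x
    ≤⇒0≤- {x} {y} le = ≤-respˡ (-‿inverseʳ x) (+-monoˡ-≤ (- x) le)

    *-monoˡ-≤ : ∀ {x y c} → 0# ≤ c → x ≤ y → c * x ≤ c * y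
    *-monoˡ-≤ {x} {y} {c} 0≤c x≤y =
      0≤-⇒≤ (≤-respʳ (trans (distribˡ c y (- x)) (+-cong refl (sym (-‿distribʳ-* c x))))
                     (*-nonneg 0≤c (≤⇒0≤- x≤y)))

    *-cancelˡ : ∀ {x y c} → ¬ (c ≈ 0#) → c * x ≈ c * y → x ≈ y
    *-cancelˡ {x} {y} {c} c≉0 e = trans (sym (undo x)) (trans (*-cong refl e) (undo y))
      where
      undo : ∀ z → c ⁻¹ * (c * z) ≈ z
      undo z = trans (sym (*-assoc (c ⁻¹) c z))
                 (trans (*-cong (trans (*-comm (c ⁻¹) c) (⁻¹-inverse c c≉0)) refl) (*-identityˡ z))

    -- If instead `y ≤ x`, then multiplying back gives equality of the products by antisymmetry, and
    -- equality can be cancelled. This avoids showing that inverses are positive.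
    *-cancelˡ-≤ : ∀ {x y c} → 0# ≤ c → ¬ (c ≈ 0#) → c * x ≤ c * y → x ≤ y
    *-cancelˡ-≤ {x} {y} 0≤c c≉0 le with total x y
    ... | inj₁ x≤y = x≤y
    ... | inj₂ y≤x = ≤-reflexive (*-cancelˡ c≉0 (antisym le (*-monoˡ-≤ 0≤c y≤x)))

    double : ∀ x → 2# * x ≈ x + x
    double x = trans (distribʳ x 1# 1#) (+-cong (*-identityˡ x) (*-identityˡ x))

    sq≤4⇒≤2 : ∀ {d} → d * d ≤ 2# * 2# → d ≤ 2#
    sq≤4⇒≤2 {d} le with total d 2#
    ... | inj₁ d≤2 = d≤2
    ... | inj₂ 2≤d = *-cancelˡ-≤ 0≤2 2≉0 (≤-trans (≤-respˡ (*-comm d 2#) (*-monoˡ-≤ (≤-trans 0≤2 2≤d) 2≤d)) le)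

    -- The squared length of a vector in space; the third component is a difference of heights.
    -- Squares spare a square root, which the machine does not have.
    dist² : Carrier → Carrier → Carrier → Carrier
    dist² u v w = u * u + v * v + w * w

    neg-- : ∀ x y → - (x - y) ≈ y - x
    neg-- x y = trans (sym (-‿+-comm x (- y))) (trans (+-cong refl (-‿involutive y)) (+-comm (- x) y))

    -sq-sym : ∀ x y → (x - y) * (x - y) ≈ (y - x) * (y - x)
    -sq-sym x y = trans (sym (neg-sq (x - y))) (*-cong (neg-- x y) (neg-- x y))

    sq≤1 : ∀ {x y} → x ≤ y + 1# → y ≤ x + 1# → (x - y) * (x - y) ≤ 1#
    sq≤1 {x} {y} x≤ y≤ with total x y
    ... | inj₂ y≤x = small (≤⇒0≤- y≤x) (≤+⇒-≤ x≤)
      where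
      small : ∀ {d} → 0# ≤ d → d ≤ 1# → d * d ≤ 1#
      small {d} 0≤d d≤1 = ≤-trans (≤-respʳ (*-identityʳ d) (*-monoˡ-≤ 0≤d d≤1)) d≤1
    ... | inj₁ x≤y = ≤-respˡ (-sq-sym y x) (small (≤⇒0≤- x≤y) (≤+⇒-≤ y≤))
      where
      small : ∀ {d} → 0# ≤ d → d ≤ 1# → d * d ≤ 1#
      small {d} 0≤d d≤1 = ≤-trans (≤-respʳ (*-identityʳ d) (*-monoˡ-≤ 0≤d d≤1)) d≤1

    sq≈0⇒≈ : ∀ {x y} → (x - y) * (x - y) ≤ 0# → x ≈ y
    sq≈0⇒≈ {x} {y} le with (x - y) ≟ 0#
    ... | yes e = x∙y⁻¹≈ε⇒x≈y x y e
    ... | no ne = ⊥-elim (ne (*-cancelˡ ne (trans (antisym le (0≤sq (x - y))) (sym (zeroʳ (x - y))))))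

    sum≤4⇒near : ∀ {x y s} → 0# ≤ s → (x - y) * (x - y) + s ≤ 2# * 2# → x ≤ y + 2#
    sum≤4⇒near 0≤s le = -≤⇒≤+ (sq≤4⇒≤2 (≤-trans (x≤x+y 0≤s) le))

    dist²-nearˡ : ∀ {x y v w} → dist² (x - y) v w ≤ 2# * 2# → x ≤ y + 2#
    dist²-nearˡ {x} {y} {v} {w} le =
      sum≤4⇒near (+-nonneg (0≤sq v) (0≤sq w)) (≤-respˡ (+-assoc _ _ _) le)

    dist²-nearʳ : ∀ {x y u w} → dist² u (x - y) w ≤ 2# * 2# → x ≤ y + 2#
    dist²-nearʳ {x} {y} {u} {w} le =
      sum≤4⇒near (+-nonneg (0≤sq u) (0≤sq w))
        (≤-respˡ (trans (+-cong (+-comm (u * u) _) refl) (+-assoc _ _ _)) le)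

    dist²-sym : ∀ x x′ y y′ z z′ → dist² (x - x′) (y - y′) (z - z′) ≈ dist² (x′ - x) (y′ - y) (z′ - z)
    dist²-sym x x′ y y′ z z′ = +-cong (+-cong (-sq-sym x x′) (-sq-sym y y′)) (-sq-sym z z′)

    -- The squared distance is at most 1 + 1 + 0, well below 4: cells of side 1 are cliques.
    dist²-clique : ∀ {x x′ y y′ z} → x ≤ x′ + 1# → x′ ≤ x + 1# → y ≤ y′ + 1# → y′ ≤ y + 1# →
                   dist² (x - x′) (y - y′) (z - z) ≤ 2# * 2#
    dist²-clique {x} {x′} {y} {y′} {z} p q r s =
      ≤-trans (+-mono-≤ (+-mono-≤ (sq≤1 p q) (sq≤1 r s))
                        (≤-reflexive (trans (*-cong (-‿inverseʳ z) refl) (zeroˡ (z - z)))))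
              (≤-respˡ (sym (+-identityʳ 2#)) (≤-respʳ (sym (double 2#)) (x≤x+y 0≤2)))

    -- A height of 2 between the colours uses up the whole distance.
    dist²-apart : ∀ {x x′ y y′ w} → w * w ≈ 2# * 2# → dist² (x - x′) (y - y′) w ≤ 2# * 2# →
                  x ≈ x′ × y ≈ y′
    dist²-apart {x} {x′} {y} {y′} {w} e le =
      sq≈0⇒≈ (≤-trans (x≤x+y (0≤sq _)) sum≤0) , sq≈0⇒≈ (≤-trans (≤-respʳ (+-comm _ _) (x≤x+y (0≤sq _))) sum≤0)
      where
      sum≤0 : (x - x′) * (x - x′) + (y - y′) * (y - y′) ≤ 0#
      sum≤0 = +-cancelʳ-≤ (w * w) (≤-respʳ (trans (sym e) (sym (+-identityˡ _))) le)

    -- The parallelogram law with one square dropped: for `u = p - a` and `w = a - b` the two sides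
    -- differ by the square of `u + u + w`. Naming the differences makes the identity one of
    -- commutative semirings, as the solver requires.
    parallelogram : ∀ {p a b} → let s = (p - a) * (p - a) + (p - b) * (p - b) in (a - b) * (a - b) ≤ s + s
    parallelogram {p} {a} {b} =
      ≤-trans (x≤x+y (0≤sq (u + u + w))) (≤-reflexive (trans (identity u w) (+-cong s≈ s≈)))
      where
      u = p - a
      w = a - b
      u+w : u + w ≈ p - b
      u+w = trans (sym (+-assoc u a (- b))) (+-cong (x-z+z p a) refl)
      s≈ : u * u + (u + w) * (u + w) ≈ u * u + (p - b) * (p - b)
      s≈ = +-cong refl (*-cong u+w u+w)
      identity : ∀ u w → w * w + (u + u + w) * (u + u + w) ≈
                 (u * u + (u + w) * (u + w)) + (u * u + (u + w) * (u + w))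
      identity = solve 2 (λ u w → w :* w :+ (u :+ u :+ w) :* (u :+ u :+ w) :=
        (u :* u :+ (u :+ w) :* (u :+ w)) :+ (u :* u :+ (u :+ w) :* (u :+ w))) refl

    half : Carrier → Carrier
    half x = 2# ⁻¹ * x

    half+half : ∀ x → half x + half x ≈ x
    half+half x = trans (sym (double (half x))) (trans (sym (*-assoc 2# (2# ⁻¹) x))
                    (trans (*-cong (⁻¹-inverse 2# 2≉0) refl) (*-identityˡ x)))

    midpoint : Carrier → Carrier → Carrier
    midpoint a b = half (a + b)

    midpoint-twice : ∀ a b → (midpoint a b - a) + (midpoint a b - a) ≈ b - a
    midpoint-twice a b = trans (shuffle (midpoint a b) (- a)) (trans (+-cong (half+half (a + b)) refl)
        (trans (solve 3 (λ a b c → (a :+ b) :+ (c :+ c) := (a :+ c) :+ (b :+ c)) refl a b (- a))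
               (trans (+-cong (-‿inverseʳ a) refl) (+-identityˡ (b - a)))))
      where
      shuffle : ∀ p c → (p + c) + (p + c) ≈ (p + p) + (c + c)
      shuffle = solve 2 (λ p c → (p :+ c) :+ (p :+ c) := (p :+ p) :+ (c :+ c)) refl

    midpoint-comm : ∀ a b → midpoint a b ≈ midpoint b a
    midpoint-comm a b = *-cong refl (+-comm a b)

    -- Doubling the vector from one centre to the midpoint gives the vector between the centres, so
    -- the squared lengths differ by the factor 4.
    midpoint-near : ∀ {a b c d} → (b - a) * (b - a) + (d - c) * (d - c) ≤ 2# * 2# →
                    let h = midpoint a b - a ; k = midpoint c d - c in h * h + k * k ≤ 1# * 1#
    midpoint-near {a} {b} {c} {d} le =
      *-cancelˡ-≤ (*-nonneg 0≤2 0≤2) 4≉0 (≤-respˡ four (≤-respʳ (sym 4*1) le))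
      where
      h = midpoint a b - a
      k = midpoint c d - c
      4≉0 : ¬ (2# * 2# ≈ 0#)
      4≉0 e = 2≉0 (*-cancelˡ 2≉0 (trans e (sym (zeroʳ 2#))))
      4*1 : 2# * 2# * (1# * 1#) ≈ 2# * 2#
      4*1 = trans (*-cong refl (*-identityˡ 1#)) (*-identityʳ _)
      four : (b - a) * (b - a) + (d - c) * (d - c) ≈ 2# * 2# * (h * h + k * k)
      four = trans (+-cong (*-cong (sym (midpoint-twice a b)) (sym (midpoint-twice a b)))
                           (*-cong (sym (midpoint-twice c d)) (sym (midpoint-twice c d))))
                   (trans (identity h k) (sym (trans (*-assoc 2# 2# s) (trans (double (2# * s))
                     (+-cong (double s) (double s))))))
        where
        s = h * h + k * k
        identity : ∀ h k → (h + h) * (h + h) + (k + k) * (k + k) ≈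
                   (h * h + k * k + (h * h + k * k)) + (h * h + k * k + (h * h + k * k))
        identity = solve 2 (λ h k → (h :+ h) :* (h :+ h) :+ (k :+ k) :* (k :+ k) :=
          (h :* h :+ k :* k :+ (h :* h :+ k :* k)) :+ (h :* h :+ k :* k :+ (h :* h :+ k :* k))) refl

  module DecidableOrder (F : OrderedField) where
    open OrderedField F

    ≤?-true : ∀ {x y} → x ≤ y → ⌊ x ≤? y ⌋ ≡ true
    ≤?-true {x} {y} le with x ≤? y
    ... | yes _ = ≡.refl
    ... | no ≰  = ⊥-elim (≰ le)

    ≤?-true⁻ : ∀ {x y} → ⌊ x ≤? y ⌋ ≡ true → x ≤ y
    ≤?-true⁻ {x} {y} eq with x ≤? y
    ... | yes le = le
    ≤?-true⁻ () | no _

    ≤?-false : ∀ {x y} → ¬ (x ≤ y) → ⌊ x ≤? y ⌋ ≡ false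
    ≤?-false {x} {y} ≰ with x ≤? y
    ... | yes le = ⊥-elim (≰ le)
    ... | no _   = ≡.refl

    ≤?-false⁻ : ∀ {x y} → ⌊ x ≤? y ⌋ ≡ false → ¬ (x ≤ y)
    ≤?-false⁻ {x} {y} eq with x ≤? y
    ... | no ≰ = ≰
    ≤?-false⁻ () | yes _

  -- The semiorder "more than 1 below" layers M reals by the length of the
  -- longest chain ending at them.  The layers replace the rows of a grid,
  -- which a real RAM cannot compute for lack of rounding.

  module Layers (F : OrderedField) (M : ℕ) (y : ℕ → OrderedField.Carrier F) where
    open OrderedField F
    open OrderedFieldProperties F
    open DecidableOrder F
    open Finite

    below : ℕ → ℕ → Bool
    below b a = not ⌊ y a ≤? y b + 1# ⌋

    -- The number of steps of a longest chain ending at `a`, cut off at `ρ`. The cut-off makes the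
    -- recursion structural and doubles as the round number of the program that computes the layers.
    height : ℕ → ℕ → ℕ
    height zero    a = 0
    height (suc ρ) a = maxTo M λ b → only (below b a) (suc (height ρ b))

    layer : ℕ → ℕ
    layer = height M

    below⇒ : ∀ {b a} → below b a ≡ true → ¬ (y a ≤ y b + 1#)
    below⇒ {b} {a} eq with ⌊ y a ≤? y b + 1# ⌋ in e
    ... | false = ≤?-false⁻ e
    below⇒ () | true

    ¬below⇒ : ∀ {b a} → below b a ≡ false → y a ≤ y b + 1#
    ¬below⇒ {b} {a} eq with ⌊ y a ≤? y b + 1# ⌋ in e
    ... | true = ≤?-true⁻ e
    ¬below⇒ () | false

    below⇐ : ∀ {b a} → ¬ (y a ≤ y b + 1#) → below b a ≡ true
    below⇐ h = ≡.cong not (≤?-false h)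

    y≰ : ∀ {b a} → below b a ≡ true → ¬ (y a ≤ y b)
    y≰ bl le = below⇒ bl (≤-trans le (x≤x+y 0≤1))

    height-suc : ∀ ρ {b a} → b ℕ.< M → below b a ≡ true → height ρ b ℕ.< height (suc ρ) a
    height-suc ρ {b} {a} b<M bl = ℕₚ.≤-trans (ℕₚ.≤-reflexive (≡.cong (λ c → only c _) (≡.sym bl)))
                                    (maxTo-upper (λ b → only (below b a) (suc (height ρ b))) b<M)

    height-pred : ∀ ρ a {h} → height (suc ρ) a ≡ suc h →
                  ∃[ b ] b ℕ.< M × below b a ≡ true × h ≡ height ρ b
    height-pred ρ a eq with maxTo-attained M (λ b → only (below b a) (suc (height ρ b)))
    ... | inj₁ e = case ≡.trans (≡.sym eq) e of λ ()
    ... | inj₂ (b , b<M , e) with below b a in bl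
    ... | true  = b , b<M , bl , ℕₚ.suc-injective (≡.trans (≡.sym eq) e)
    ... | false = case ≡.trans (≡.sym eq) e of λ ()

    height≤ : ∀ ρ a → height ρ a ℕ.≤ ρ
    height≤ zero    a = z≤n
    height≤ (suc ρ) a = maxTo-least M λ b _ → only≤ (below b a) (s≤s (height≤ ρ b))
      where
      only≤ : ∀ c {x z} → x ℕ.≤ z → only c x ℕ.≤ z
      only≤ true  le = le
      only≤ false le = z≤n

    height-mono : ∀ ρ a → height ρ a ℕ.≤ height (suc ρ) a
    height-mono zero    a = z≤n
    height-mono (suc ρ) a = maxTo-mono M λ b _ → only-mono (below b a) (s≤s (height-mono ρ b))
      where
      only-mono : ∀ c {x z} → x ℕ.≤ z → only c x ℕ.≤ only c z
      only-mono true  le = le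
      only-mono false le = z≤n

    -- A measure that bounds chains: it grows strictly along `below` and never exceeds `M`, which
    -- shows that `M` rounds reach the full length of every chain.
    rank : ℕ → ℕ
    rank a = sumTo M λ b → only (not ⌊ y a ≤? y b ⌋) 1

    rank≤ : ∀ a → rank a ℕ.≤ M
    rank≤ a = ℕₚ.≤-trans (sumTo-mono M λ b _ → one (not ⌊ y a ≤? y b ⌋))
                         (ℕₚ.≤-reflexive (≡.trans (sumTo-const M 1) (ℕₚ.*-identityʳ M)))
      where
      one : ∀ c → only c 1 ℕ.≤ 1
      one true  = s≤s z≤n
      one false = z≤n

    rank-< : ∀ {b a} → b ℕ.< M → below b a ≡ true → rank b ℕ.< rank a
    rank-< {b} {a} b<M bl = sumTo-strict M (λ c _ → step c) b<M strict
      where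
      b≤a : y b ≤ y a
      b≤a = ≰⇒≥ (y≰ bl)
      step : ∀ c → only (not ⌊ y b ≤? y c ⌋) 1 ℕ.≤ only (not ⌊ y a ≤? y c ⌋) 1
      step c with y b ≤? y c | y a ≤? y c
      ... | yes _  | _      = z≤n
      ... | no _   | no _   = s≤s z≤n
      ... | no b≰c | yes a≤c = ⊥-elim (b≰c (≤-trans b≤a a≤c))
      strict : only (not ⌊ y b ≤? y b ⌋) 1 ℕ.< only (not ⌊ y a ≤? y b ⌋) 1
      strict rewrite ≤?-true (≤-refl {y b}) | ≤?-false (y≰ bl) = s≤s z≤n

    -- The last element before `a` on a longest chain has smaller rank, so by induction its height
    -- has already settled one round earlier.
    height-stable : ∀ ρ a → rank a ℕ.≤ ρ → height (suc ρ) a ℕ.≤ height ρ a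
    height-stable ρ a r≤ with height (suc ρ) a in eq
    ... | zero  = z≤n
    ... | suc h with height-pred ρ a eq
    height-stable zero a r≤ | suc h | b , b<M , bl , _ = ⊥-elim (ℕₚ.<⇒≱ (rank-< b<M bl) (ℕₚ.≤-trans r≤ z≤n))
    height-stable (suc ρ) a r≤ | suc h | b , b<M , bl , ≡.refl =
      ℕₚ.≤-trans (s≤s (height-stable ρ b (ℕₚ.≤-pred (ℕₚ.≤-trans (rank-< b<M bl) r≤)))) (height-suc ρ b<M bl)

    layer-< : ∀ {b a} → b ℕ.< M → below b a ≡ true → layer b ℕ.< layer a
    layer-< {b} {a} b<M bl = ℕₚ.≤-trans (height-suc M b<M bl) (height-stable M a (rank≤ a))

    layer-pred : ∀ a {h} → suc h ℕ.≤ layer a → ∃[ b ] b ℕ.< M × below b a ≡ true × h ℕ.≤ layer b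
    layer-pred a {h} h< with layer a in eq
    ... | suc l with height-pred M a (≡.trans (ℕₚ.≤-antisym (height-stable M a (rank≤ a)) (height-mono M a)) eq)
    ... | b , b<M , bl , ≡.refl = b , b<M , bl , ℕₚ.≤-pred h<

    layer≤M : ∀ a → layer a ℕ.≤ M
    layer≤M = height≤ M

    same-layer : ∀ {a b} → b ℕ.< M → layer a ≡ layer b → y a ≤ y b + 1#
    same-layer {a} {b} b<M eq with below b a in bl
    ... | false = ¬below⇒ bl
    ... | true  = ⊥-elim (ℕₚ.<⇒≢ (layer-< b<M bl) (≡.sym eq))

    -- Were `a` three layers above `b`, a chain would descend from `a` to some `c`, `d` and `e`,
    -- with `d` more than 2 below `a` and the layer of `e` at least that of `b`. If `d` is above
    -- `b`, then `a` is more than 2 above `b`. Otherwise `e` is more than 1 below `b`, so its layer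
    -- is smaller than that of `b`. Both are contradictions.
    near-layers : ∀ {a b} → b ℕ.< M → y a ≤ y b + 2# → layer a ℕ.≤ 2 ℕ.+ layer b
    near-layers {a} {b} b<M le with layer a ℕ.≤? 2 ℕ.+ layer b
    ... | yes ok = ok
    ... | no ≰ with layer-pred a (ℕₚ.≰⇒> ≰)
    ... | c , c<M , ca , lc with layer-pred c lc
    ... | d , d<M , dc , ld with y d ≤? y b
    ... | no d≰b = ⊥-elim (below⇒ ca (≤-trans le (≤-respˡ (+-assoc (y b) 1# 1#)
                     (+-monoˡ-≤ 1# (≤-trans (+-monoˡ-≤ 1# (≰⇒≥ d≰b)) (≰⇒≥ (below⇒ dc)))))))
    ... | yes d≤b with layer-pred d ld
    ... | e , e<M , ed , le′ = ⊥-elim (ℕₚ.<⇒≱ (layer-< e<M (below⇐ λ b≤ → below⇒ ed (≤-trans d≤b b≤))) le′)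

  module Embedding (F : OrderedField) where
    open OrderedField F
    open OrderedFieldProperties F

    fromℕ-+ : ∀ m n → fromℕ (m ℕ.+ n) ≈ fromℕ m + fromℕ n
    fromℕ-+ zero    n = sym (+-identityˡ (fromℕ n))
    fromℕ-+ (suc m) n = trans (+-cong refl (fromℕ-+ m n)) (sym (+-assoc 1# (fromℕ m) (fromℕ n)))

    fromℕ-* : ∀ m n → fromℕ (m ℕ.* n) ≈ fromℕ m * fromℕ n
    fromℕ-* zero    n = sym (zeroˡ (fromℕ n))
    fromℕ-* (suc m) n = trans (fromℕ-+ n (m ℕ.* n)) (trans (+-cong (sym (*-identityˡ (fromℕ n))) (fromℕ-* m n))
                          (sym (distribʳ (fromℕ n) 1# (fromℕ m))))

    fromℕ-nonneg : ∀ n → 0# ≤ fromℕ n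
    fromℕ-nonneg zero    = ≤-refl
    fromℕ-nonneg (suc n) = +-nonneg 0≤1 (fromℕ-nonneg n)

    fromℕ-mono : ∀ {m n} → m ℕ.≤ n → fromℕ m ≤ fromℕ n
    fromℕ-mono {n = n} z≤n = fromℕ-nonneg n
    fromℕ-mono (s≤s le)    = +-mono-≤ ≤-refl (fromℕ-mono le)

    fromℕ-suc≉0 : ∀ n → ¬ (fromℕ (suc n) ≈ 0#)
    fromℕ-suc≉0 n e = 0≉1 (antisym 0≤1 (≤-trans (x≤x+y (fromℕ-nonneg n)) (≤-reflexive e)))

    -- Replace the loss `2 * u` by the larger `ε * (suc k) * u` and cancel the factor `suc k`, which
    -- is what the number of shifts is chosen for.
    approximation : ∀ {ε k u l} → fromℕ 2 ≤ ε * fromℕ (suc k) →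
                    suc k ℕ.* u ℕ.≤ suc k ℕ.* l ℕ.+ 2 ℕ.* u → (1# - ε) * fromℕ u ≤ fromℕ l
    approximation {ε} {k} {u} {l} 2≤ le =
      ≤-respˡ (sym expand) (≤+⇒-≤ (≤-respʳ (+-comm L (ε * U)) (*-cancelˡ-≤ (fromℕ-nonneg (suc k)) (fromℕ-suc≉0 k) (≤-respʳ (sym (distribˡ K L (ε * U))) bound))))
      where
      K = fromℕ (suc k)
      U = fromℕ u
      L = fromℕ l
      expand : (1# - ε) * U ≈ U - ε * U
      expand = trans (distribʳ U 1# (- ε)) (+-cong (*-identityˡ U) (sym (-‿distribˡ-* ε U)))
      bound : K * U ≤ K * L + K * (ε * U)
      bound = ≤-respˡ (fromℕ-* (suc k) u) (≤-trans (fromℕ-mono le)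
        (≤-respˡ (sym (fromℕ-+ (suc k ℕ.* l) (2 ℕ.* u)))
          (+-mono-≤ (≤-reflexive (fromℕ-* (suc k) l))
            (≤-respˡ (sym (fromℕ-* 2 u))
              (≤-respˡ (*-comm U (fromℕ 2)) (≤-respʳ shuffle (*-monoˡ-≤ (fromℕ-nonneg u) 2≤)))))))
        where
        shuffle : U * (ε * K) ≈ K * (ε * U)
        shuffle = trans (sym (*-assoc U ε K)) (trans (*-comm (U * ε) K) (*-cong refl (*-comm U ε)))

-- Combinatorics: the dynamic program, shifted strips, and sets encoded by weights.

module Combinatorics where

  open import Data.Bool using (Bool; true; false; not; _∧_; if_then_else_; _∨_)
  open import Data.Empty using (⊥-elim)
  open import Data.Fin as Fin using (Fin; toℕ)
  open import Data.Fin.Subset using (Subset; _∈_; ∣_∣)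
  open import Data.List using (List; []; _∷_; _++_; map)
  open import Data.List.Membership.Propositional using () renaming (_∈_ to _∈ᴸ_)
  open import Data.List.Properties using (map-++)
  open import Data.List.Relation.Unary.All as All using (All; []; _∷_)
  import Data.List.Relation.Unary.All.Properties as Allₚ
  open import Data.List.Relation.Unary.AllPairs using (AllPairs; []; _∷_)
  import Data.List.Relation.Unary.AllPairs.Properties as AllPairsₚ
  open import Data.List.Relation.Unary.Any using (here; there)
  open import Data.Nat
  open import Data.Nat.DivMod
  open import Data.Nat.ListAction using (sum)
  open import Data.Nat.ListAction.Properties using (sum-++)
  open import Data.Nat.Properties
  open import Data.Nat.Solver using (module +-*-Solver)
  open import Data.Product using (∃-syntax; _×_; _,_; proj₁; proj₂)
  open import Data.Sum using (_⊎_; inj₁; inj₂)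
  open import Data.Vec as Vec using ([]; _∷_; tabulate)
  open import Function using (_∘_; case_of_)
  open import Relation.Binary.PropositionalEquality
  open FiniteSumsAndRunningTimes

  -- A heaviest independent set of items 0, …, M - 1 whose conflicts join only
  -- items of the same or of consecutive groups.  The table D lists all
  -- m-tuples; an entry of at least M stands for "no item".

  module DynamicProgram (M m N : ℕ) (D : ℕ → ℕ → ℕ) (conf : ℕ → ℕ → Bool) (γ : ℕ → ℕ) (w : ℕ → ℕ) where
    open Finite

    item : ℕ → Bool
    item d = suc d ≤ᵇ M

    clash : ℕ → ℕ → Bool
    clash d d′ = item d ∧ (item d′ ∧ conf d d′)

    fits : ℕ → ℕ → Bool
    fits g d = not (item d ∧ not ((γ d ≤ᵇ g) ∧ (g ≤ᵇ γ d)))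

    valid : ℕ → ℕ → Bool
    valid g c = allTo m λ j → fits g (D j c) ∧ allTo j λ j′ → not (clash (D j c) (D j′ c))

    compatible : ℕ → ℕ → Bool
    compatible c c′ = allTo m λ j → allTo m λ j′ → not (clash (D j c) (D j′ c′))

    weight : ℕ → ℕ
    weight c = sumTo m λ j → w (D j c)

    -- `value (suc g) c` is for groups up to `g`, with `c` the tuple of group `g` and `c′` that of
    -- the group before. A rejected transition yields 0, which the empty set attains, so no value
    -- for "impossible" is needed.
    value : ℕ → ℕ → ℕ
    value zero    c = 0
    value (suc g) c = maxTo N λ c′ → only (valid g c ∧ compatible c c′) (value g c′ + weight c)

    Independent : List ℕ → Set
    Independent L = All (_< M) L × AllPairs (λ a b → conf a b ≡ false) L

    ¬clash⇒ : ∀ {d d′} → not (clash d d′) ≡ true → d < M → d′ < M → conf d d′ ≡ false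
    ¬clash⇒ {d} {d′} h d<M d′<M rewrite ≤ᵇ-true {suc d} d<M | ≤ᵇ-true {suc d′} d′<M with conf d d′ | h
    ... | false | _ = refl

    ¬clash⇐ : ∀ {d d′} → (d < M → d′ < M → conf d d′ ≡ false) → not (clash d d′) ≡ true
    ¬clash⇐ {d} {d′} h with item d in e | item d′ in e′
    ... | false | _     = refl
    ... | true  | false = refl
    ... | true  | true rewrite h (≤ᵇ-true⁻ {suc d} e) (≤ᵇ-true⁻ {suc d′} e′) = refl

    fits⇒ : ∀ {g d} → fits g d ≡ true → d < M → γ d ≡ g
    fits⇒ {g} {d} h d<M rewrite ≤ᵇ-true {suc d} d<M with γ d ≤ᵇ g in e | g ≤ᵇ γ d in e′ | h
    ... | true | true  | _ = ≤-antisym (≤ᵇ-true⁻ e) (≤ᵇ-true⁻ e′)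
    ... | true | false | ()
    ... | false | _ | ()

    fits⇐ : ∀ {g d} → (d < M → γ d ≡ g) → fits g d ≡ true
    fits⇐ {g} {d} h with item d in e
    ... | false = refl
    ... | true rewrite h (≤ᵇ-true⁻ {suc d} e) | ≤ᵇ-true (≤-refl {g}) = refl

    module Soundness
      (w-none : ∀ a → M ≤ a → w a ≡ 0)
      (Γ : ℕ)
      (near : ∀ {a b} → a < M → b < M → γ a < Γ → γ b < Γ → conf a b ≡ true → γ a ≤ suc (γ b))
      where

      -- `remembered` is the reason why a single tuple of memory is enough: a chosen item either is
      -- visible in `c`, where the next compatibility test sees it, or lies too far back to conflict
      -- with the next group.
      record Witness (g c v : ℕ) : Set where
        field
          chosen      : List ℕ
          independent : Independent chosen
          early       : All (λ a → γ a < g) chosen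
          total       : sum (map w chosen) ≡ v
          remembered  : All (λ a → suc (γ a) < g ⊎ ∃[ j ] j < m × D j c ≡ a) chosen
      open Witness

      items : ℕ → ℕ → List ℕ
      items zero    c = []
      items (suc j) c = if item (D j c) then D j c ∷ items j c else items j c

      items-All : ∀ j c {P : ℕ → Set} → (∀ i → i < j → D i c < M → P (D i c)) → All P (items j c)
      items-All zero    c h = []
      items-All (suc j) c h with item (D j c) in e
      ... | true  = h j ≤-refl (≤ᵇ-true⁻ {suc (D j c)} e) ∷ items-All j c λ i i<j → h i (m<n⇒m<1+n i<j)
      ... | false = items-All j c λ i i<j → h i (m<n⇒m<1+n i<j)

      items-AllPairs : ∀ j c → (∀ i i′ → i < j → i′ < i → not (clash (D i c) (D i′ c)) ≡ true) →
                       AllPairs (λ a b → conf a b ≡ false) (items j c)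
      items-AllPairs zero    c h = []
      items-AllPairs (suc j) c h with item (D j c) in e
      ... | true  = items-All j c (λ i i<j → ¬clash⇒ (h j i ≤-refl i<j) (≤ᵇ-true⁻ {suc (D j c)} e))
                    ∷ items-AllPairs j c λ i i′ i<j → h i i′ (m<n⇒m<1+n i<j)
      ... | false = items-AllPairs j c λ i i′ i<j → h i i′ (m<n⇒m<1+n i<j)

      items-total : ∀ j c → sum (map w (items j c)) ≡ sumTo j λ i → w (D i c)
      items-total zero    c = refl
      items-total (suc j) c with item (D j c) in e
      ... | true  = trans (cong (w (D j c) +_) (items-total j c)) (+-comm (w (D j c)) _)
      ... | false rewrite w-none (D j c) (≤-pred (≤ᵇ-false⁻ {suc (D j c)} e)) =
        trans (items-total j c) (sym (+-identityʳ _))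

      nothing-chosen : ∀ g c → Witness g c 0
      nothing-chosen g c = record
        { chosen = [] ; independent = [] , [] ; early = [] ; total = refl ; remembered = [] }

      extend : ∀ {g c c′ v} → g < Γ → valid g c ≡ true → compatible c c′ ≡ true → Witness g c′ v →
               Witness (suc g) c (v + weight c)
      extend {g} {c} {c′} {v} g<Γ val com W = record
        { chosen      = new ++ chosen W
        ; independent = Allₚ.++⁺ new<M (proj₁ (independent W))
                      , AllPairsₚ.++⁺ (items-AllPairs m c pairs) (proj₂ (independent W))
                          (items-All m c across)
        ; early       = Allₚ.++⁺ (items-All m c λ i i<m d<M → s≤s (≤-reflexive (group i i<m d<M)))
                                 (All.map m<n⇒m<1+n (early W))
        ; total       = trans (cong sum (map-++ w new (chosen W)))
                          (trans (sum-++ (map w new) (map w (chosen W)))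
                            (trans (cong₂ _+_ (items-total m c) (total W)) (+-comm (weight c) v)))
        ; remembered  = Allₚ.++⁺ (items-All m c λ i i<m _ → inj₂ (i , i<m , refl))
                                 (All.map (inj₁ ∘ s≤s) (early W))
        }
        where
        new = items m c
        new<M : All (_< M) new
        new<M = items-All m c λ _ _ d<M → d<M
        slotwise : ∀ i → i < m → fits g (D i c) ≡ true × allTo i (λ i′ → not (clash (D i c) (D i′ c))) ≡ true
        slotwise i i<m = ∧-elim (allTo-elim (λ j → fits g (D j c) ∧ allTo j λ j′ → not (clash (D j c) (D j′ c))) val i<m)
        group : ∀ i → i < m → D i c < M → γ (D i c) ≡ g
        group i i<m = fits⇒ (proj₁ (slotwise i i<m))
        pairs : ∀ i i′ → i < m → i′ < i → not (clash (D i c) (D i′ c)) ≡ true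
        pairs i i′ i<m = allTo-elim (λ i′ → not (clash (D i c) (D i′ c))) (proj₂ (slotwise i i<m))
        across : ∀ i → i < m → D i c < M → All (λ b → conf (D i c) b ≡ false) (chosen W)
        across i i<m d<M = All.tabulate λ {b} b∈ →
          step (All.lookup (proj₁ (independent W)) b∈) (All.lookup (early W) b∈) (All.lookup (remembered W) b∈)
          where
          step : ∀ {b} → b < M → γ b < g → suc (γ b) < g ⊎ (∃[ j ] j < m × D j c′ ≡ b) → conf (D i c) b ≡ false
          step b<M _ (inj₂ (j , j<m , refl)) =
            ¬clash⇒ (allTo-elim (λ j′ → not (clash (D i c) (D j′ c′)))
                       (allTo-elim (λ j → allTo m λ j′ → not (clash (D j c) (D j′ c′))) com i<m) j<m) d<M b<M
          -- An item missing from `c′` lies at least two groups before group `g`, where `near` rules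
          -- out a conflict.
          step {b} b<M b<g (inj₁ b≪g) with conf (D i c) b in e
          ... | false = refl
          ... | true  = ⊥-elim (<⇒≱ b≪g (subst (_≤ suc (γ b)) (group i i<m d<M)
                          (near d<M b<M (subst (_< Γ) (sym (group i i<m d<M)) g<Γ) (<-trans b<g g<Γ) e)))

      value-sound : ∀ g c → g ≤ Γ → Witness g c (value g c)
      value-sound zero    c _ = nothing-chosen 0 c
      value-sound (suc g) c g<Γ
        with maxTo-attained N (λ c′ → only (valid g c ∧ compatible c c′) (value g c′ + weight c))
      ... | inj₁ e = subst (Witness (suc g) c) (sym e) (nothing-chosen (suc g) c)
      ... | inj₂ (c′ , _ , e) with valid g c ∧ compatible c c′ in ok
      ... | false = subst (Witness (suc g) c) (sym e) (nothing-chosen (suc g) c)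
      ... | true  = subst (Witness (suc g) c) (sym e)
                      (extend g<Γ (proj₁ (∧-elim ok)) (proj₂ (∧-elim {valid g c} ok)) (value-sound g c′ (<⇒≤ g<Γ)))

    -- `U` is an arbitrary competitor of the table. Its members of one group occupy distinct slots,
    -- which is why tuples of length `m` can represent them.
    module Completeness
      (tabulated : ∀ (t : ℕ → ℕ) → (∀ j → j < m → t j ≤ M) → ∃[ c ] c < N × ∀ j → j < m → D j c ≡ t j)
      (Γ : ℕ) (U : ℕ → Bool)
      (U-independent : ∀ {a b} → a < M → b < M → U a ≡ true → U b ≡ true → a ≢ b → conf a b ≡ false)
      (slot : ℕ → ℕ) (slot< : ∀ {a} → a < M → slot a < m)
      (slot-injective : ∀ {a b} → a < M → b < M → U a ≡ true → U b ≡ true → γ a < Γ → γ a ≡ γ b →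
                        slot a ≡ slot b → a ≡ b)
      where

      search : ∀ n (p : ℕ → Bool) → (∃[ i ] i < n × p i ≡ true) ⊎ (∀ i → i < n → p i ≡ false)
      search zero    p = inj₂ λ _ ()
      search (suc n) p with p n in e | search n p
      ... | true  | _ = inj₁ (n , ≤-refl , e)
      ... | false | inj₁ (i , i<n , h) = inj₁ (i , m<n⇒m<1+n i<n , h)
      ... | false | inj₂ h = inj₂ λ i i<1+n → case m<1+n-cases i<1+n of λ where
        (inj₁ i<n)  → h i i<n
        (inj₂ refl) → e

      module Group (g : ℕ) (g<Γ : g < Γ) where

        member : ℕ → Bool
        member a = U a ∧ (γ a ≡ᵇ g)

        member⇒ : ∀ {a} → member a ≡ true → U a ≡ true × γ a ≡ g
        member⇒ {a} h = let u , e = ∧-elim {U a} h in u , ≡ᵇ-true⁻ e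

        occupant : (j : ℕ) → ℕ
        occupant j with search M (λ a → member a ∧ (slot a ≡ᵇ j))
        ... | inj₁ (a , _) = a
        ... | inj₂ _       = M

        occupant≤ : ∀ j → occupant j ≤ M
        occupant≤ j with search M (λ a → member a ∧ (slot a ≡ᵇ j))
        ... | inj₁ (a , a<M , _) = <⇒≤ a<M
        ... | inj₂ _             = ≤-refl

        occupant⇒ : ∀ j → occupant j < M → (U (occupant j) ≡ true × γ (occupant j) ≡ g) × slot (occupant j) ≡ j
        occupant⇒ j o<M with search M (λ a → member a ∧ (slot a ≡ᵇ j))
        ... | inj₁ (a , _ , h) = let mem , e = ∧-elim {member a} h in member⇒ mem , ≡ᵇ-true⁻ e
        ... | inj₂ _           = ⊥-elim (<-irrefl refl o<M)

        occupies : ∀ a → a < M → member a ≡ true → occupant (slot a) ≡ a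
        occupies a a<M mem with search M (λ b → member b ∧ (slot b ≡ᵇ slot a))
        ... | inj₁ (b , b<M , h) =
          let mem′ , e = ∧-elim {member b} h
              ua , γa  = member⇒ mem
              ub , γb  = member⇒ mem′
          in slot-injective b<M a<M ub ua (subst (_< Γ) (sym γb) g<Γ) (trans γb (sym γa)) (≡ᵇ-true⁻ e)
        ... | inj₂ none = true≢false (cong₂ _∧_ mem (≡ᵇ-true {slot a} refl)) (none a a<M)

      -- Needed because `U-independent` speaks of distinct items only: items of earlier groups are
      -- certainly distinct from those of the current one.
      Past : ℕ → ℕ → Set
      Past g c = ∀ j → j < m → D j c < M → U (D j c) ≡ true × γ (D j c) < g

      optimum : ℕ → ℕ
      optimum g = sumTo M λ a → only (U a ∧ (suc (γ a) ≤ᵇ g)) (w a)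

      -- Follow `U` itself through the recursion. The tuple holding the members of `U` in group `g`,
      -- each at its slot, is tabulated; independence of `U` makes it valid and compatible with the
      -- tuple chosen for the preceding groups.
      value-complete : ∀ g → g ≤ Γ → ∃[ c ] c < N × Past g c × optimum g ≤ value g c
      value-complete zero _ =
        -- The tuple without items, for which `Past` holds vacuously.
        let c , c<N , eq = tabulated (λ _ → M) (λ _ _ → ≤-refl)
        in c , c<N , (λ j j<m d<M → ⊥-elim (<-irrefl (eq j j<m) d<M)) ,
           ≤-reflexive (sumTo-zero M λ a _ → cong (λ b → only b (w a)) (∧-false (U a)))
        where
        ∧-false : ∀ b → b ∧ false ≡ false
        ∧-false true  = refl
        ∧-false false = refl
      value-complete (suc g) g<Γ =
        let c′ , c′<N , past , le = value-complete g (<⇒≤ g<Γ)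
            c , c<N , eq = tabulated occupant (λ j _ → occupant≤ j)
        in c , c<N , present c eq , bound c eq c′ c′<N past le
        where
        open Group g g<Γ

        entry : ∀ c → (∀ j → j < m → D j c ≡ occupant j) → ∀ j → j < m → D j c < M →
                (U (D j c) ≡ true × γ (D j c) ≡ g) × slot (D j c) ≡ j
        entry c eq j j<m d<M rewrite eq j j<m = occupant⇒ j d<M

        present : ∀ c → (∀ j → j < m → D j c ≡ occupant j) → Past (suc g) c
        present c eq j j<m d<M = let (u , e) , _ = entry c eq j j<m d<M in u , s≤s (≤-reflexive e)

        bound : ∀ c → (∀ j → j < m → D j c ≡ occupant j) → ∀ c′ → c′ < N → Past g c′ →
                optimum g ≤ value g c′ → optimum (suc g) ≤ value (suc g) c
        bound c eq c′ c′<N past le = begin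
          optimum (suc g)
            ≤⟨ sumTo-mono M (λ a _ → split a) ⟩
          sumTo M (λ a → only (U a ∧ (suc (γ a) ≤ᵇ g)) (w a) + only (member a) (w a))
            ≡⟨ sumTo-+ M _ _ ⟩
          optimum g + sumTo M (λ a → only (member a) (w a))
            ≤⟨ +-mono-≤ le (sumTo-cover M m member (λ j → D j c) w λ a a<M mem →
                 slot a , slot< a<M , trans (eq (slot a) (slot< a<M)) (occupies a a<M mem)) ⟩
          value g c′ + weight c
            ≡⟨ cong (λ b → only b (value g c′ + weight c)) (sym (cong₂ _∧_ ok ok′)) ⟩
          only (valid g c ∧ compatible c c′) (value g c′ + weight c)
            ≤⟨ maxTo-upper (λ c′ → only (valid g c ∧ compatible c c′) (value g c′ + weight c)) c′<N ⟩
          value (suc g) c ∎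
          where
          open ≤-Reasoning
          split : ∀ a → only (U a ∧ (suc (γ a) ≤ᵇ suc g)) (w a) ≤
                        only (U a ∧ (suc (γ a) ≤ᵇ g)) (w a) + only (member a) (w a)
          split a with U a
          ... | false = z≤n
          ... | true with suc (γ a) ≤ᵇ suc g in e
          ... | false = z≤n
          ... | true with m<1+n-cases (≤ᵇ-true⁻ {suc (γ a)} {suc g} e)
          ... | inj₁ lt rewrite ≤ᵇ-true {suc (γ a)} lt = m≤m+n _ _
          ... | inj₂ γ≡ rewrite ≡ᵇ-true γ≡ = m≤n+m (w a) _
          ok : valid g c ≡ true
          ok = allTo-intro m λ j j<m → cong₂ _∧_
            (fits⇐ λ d<M → proj₂ (proj₁ (entry c eq j j<m d<M)))
            (allTo-intro j λ j′ j′<j → ¬clash⇐ λ d<M d′<M →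
              let (u , _) , s = entry c eq j j<m d<M
                  (u′ , _) , s′ = entry c eq j′ (<-trans j′<j j<m) d′<M
              in U-independent d<M d′<M u u′ λ same → <⇒≢ j′<j (trans (sym s′) (trans (cong slot (sym same)) s)))
          ok′ : compatible c c′ ≡ true
          ok′ = allTo-intro m λ j j<m → allTo-intro m λ j′ j′<m → ¬clash⇐ λ d<M d′<M →
              let (u , e) , _ = entry c eq j j<m d<M
                  u′ , γ< = past j′ j′<m d′<M
              in U-independent d<M d′<M u u′ λ same → <⇒≢ γ< (trans (cong γ (sym same)) e)

  -- Shift s cuts the rows into strips of k and discards the last two rows of
  -- each strip; a group is one strip within two consecutive columns.

  module Groups (M : ℕ) (k : ℕ) {{k≢0 : NonZero k}} (row col : ℕ → ℕ) where

    K : ℕ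
    K = suc M

    strip : ℕ → ℕ
    strip t = (t / k) * K

    -- Exceeds the number of every group of a surviving item, so it serves both as the number of
    -- rounds and as the mark of dropped items, which no round ever admits.
    Γ : ℕ
    Γ = strip (suc M + k) + K

    -- A row is not among the last two of its strip iff two rows further on the strip is still the
    -- same. Multiples of `K` are compared since these are what the program tabulates.
    alive : ℕ → ℕ → Bool
    alive s a = strip (2 + (row a + s)) ≤ᵇ strip (row a + s)

    group : ℕ → ℕ → ℕ
    group s a = if alive s a then strip (row a + s) + col a / 2 else Γ

    group-alive : ∀ {s a} → alive s a ≡ true → group s a ≡ strip (row a + s) + col a / 2
    group-alive e rewrite e = refl

  module Shifting (M : ℕ) (k : ℕ) {{k≢0 : NonZero k}} (row col colour : ℕ → ℕ)
                  (row≤ : ∀ a → row a ≤ M) (col≤ : ∀ a → col a ≤ M) (colour<2 : ∀ a → colour a < 2) where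
    open Finite
    open Groups M k row col public

    strip-mono : ∀ {t u} → t ≤ u → strip t ≤ strip u
    strip-mono t≤u = *-monoˡ-≤ K (/-monoˡ-≤ k t≤u)

    group<Γ⇒alive : ∀ {s a} → group s a < Γ → alive s a ≡ true
    group<Γ⇒alive {s} {a} lt with alive s a
    ... | true  = refl
    ... | false = ⊥-elim (<-irrefl refl lt)

    col/2<K : ∀ a → col a / 2 < K
    col/2<K a = s≤s (≤-trans (m/n≤m (col a) 2) (col≤ a))

    alive⇒group<Γ : ∀ {s a} → s < k → alive s a ≡ true → group s a < Γ
    alive⇒group<Γ {s} {a} s<k al rewrite al =
      +-mono-≤-< (strip-mono (≤-trans (+-mono-≤ (row≤ a) (<⇒≤ s<k)) (n≤1+n _))) (col/2<K a)

    alive⇒strip≤ : ∀ {s a b} → alive s b ≡ true → row a ≤ 2 + row b → strip (row a + s) ≤ strip (row b + s)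
    alive⇒strip≤ {s} al le = ≤-trans (strip-mono (+-monoˡ-≤ s le)) (≤ᵇ-true⁻ al)

    -- As `b` survives, the two rows after it belong to its own strip, so `a` cannot lie in a later
    -- strip. Two columns are one pair of columns, hence one group.
    group-near : ∀ {s a b} → group s a < Γ → group s b < Γ → row a ≤ 2 + row b → row b ≤ 2 + row a →
                 col a ≤ 2 + col b → group s a ≤ suc (group s b)
    group-near {s} {a} {b} a<Γ b<Γ ra rb c
      rewrite group<Γ⇒alive {s} {a} a<Γ | group<Γ⇒alive {s} {b} b<Γ = begin
        strip (row a + s) + col a / 2
          ≤⟨ +-mono-≤ (alive⇒strip≤ {s} {a} {b} (group<Γ⇒alive {s} {b} b<Γ) ra) (/-monoˡ-≤ 2 c) ⟩
        strip (row b + s) + (2 + col b) / 2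
          ≡⟨ cong (λ x → strip (row b + s) + x / 2) (+-comm 2 (col b)) ⟩
        strip (row b + s) + (col b + 2) / 2
          ≡⟨ cong (strip (row b + s) +_) ([m+n]/n (col b) 2) ⟩
        strip (row b + s) + suc (col b / 2)
          ≡⟨ +-suc _ _ ⟩
        suc (strip (row b + s) + col b / 2) ∎
      where open ≤-Reasoning

    -- The cell of an item within its group: row within the strip, column within the pair, and
    -- colour, as digits of radix `k`, 2 and 2.
    slot : ℕ → ℕ → ℕ
    slot s a = (row a + s) % k + k * (col a % 2 + 2 * colour a)

    slot< : ∀ s a → slot s a < k * 4
    slot< s a = begin-strict
      slot s a                                 <⟨ +-monoˡ-< (k * z) (m%n<n (row a + s) k) ⟩
      k + k * z                                ≡⟨ sym (*-suc k z) ⟩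
      k * suc z                                ≤⟨ *-monoʳ-≤ k (+-mono-≤ (m%n<n (col a) 2) (*-monoʳ-≤ 2 (≤-pred (colour<2 a)))) ⟩
      k * 4                                    ∎
      where
      open ≤-Reasoning
      z = col a % 2 + 2 * colour a

    divMod-injective : ∀ {x y} n {{_ : NonZero n}} → x % n ≡ y % n → x / n ≡ y / n → x ≡ y
    divMod-injective {x} {y} n r q =
      trans (m≡m%n+[m/n]*n x n) (trans (cong₂ (λ r q → r + q * n) r q) (sym (m≡m%n+[m/n]*n y n)))

    -- The group number holds the quotients of shifted row and column, the slot their remainders and
    -- the colour; together they determine the cell.
    slot-group-injective : ∀ {s a b} → group s a < Γ → group s a ≡ group s b → slot s a ≡ slot s b →
                           row a ≡ row b × col a ≡ col b × colour a ≡ colour b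
    slot-group-injective {s} {a} {b} a<Γ same-group same-slot =
      +-cancelʳ-≡ s (row a) (row b) (divMod-injective k (proj₁ outer) (proj₂ blocks)) ,
      divMod-injective 2 (proj₁ inner) (proj₁ blocks) ,
      proj₂ inner
      where
      arrange : ∀ c → group s c < Γ → group s c ≡ col c / 2 + K * ((row c + s) / k)
      arrange c c<Γ = trans (group-alive (group<Γ⇒alive {s} {c} c<Γ))
        (trans (+-comm _ (col c / 2)) (cong (col c / 2 +_) (*-comm ((row c + s) / k) K)))
      blocks : col a / 2 ≡ col b / 2 × (row a + s) / k ≡ (row b + s) / k
      blocks = digits-unique _ _ (col/2<K a) (col/2<K b)
        (trans (sym (arrange a a<Γ)) (trans same-group (arrange b (subst (_< Γ) same-group a<Γ))))
      outer : (row a + s) % k ≡ (row b + s) % k × col a % 2 + 2 * colour a ≡ col b % 2 + 2 * colour b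
      outer = digits-unique _ _ (m%n<n (row a + s) k) (m%n<n (row b + s) k) same-slot
      inner : col a % 2 ≡ col b % 2 × colour a ≡ colour b
      inner = digits-unique _ _ (m%n<n (col a) 2) (m%n<n (col b) 2) (proj₂ outer)

    sumTo-shift : ∀ n f → sumTo n (f ∘ suc) + f 0 ≡ sumTo n f + f n
    sumTo-shift zero    f = refl
    sumTo-shift (suc n) f = begin
      sumTo n (f ∘ suc) + f (suc n) + f 0    ≡⟨ +-assoc (sumTo n (f ∘ suc)) _ _ ⟩
      sumTo n (f ∘ suc) + (f (suc n) + f 0)  ≡⟨ cong (sumTo n (f ∘ suc) +_) (+-comm (f (suc n)) (f 0)) ⟩
      sumTo n (f ∘ suc) + (f 0 + f (suc n))  ≡⟨ sym (+-assoc (sumTo n (f ∘ suc)) _ _) ⟩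
      sumTo n (f ∘ suc) + f 0 + f (suc n)    ≡⟨ cong (_+ f (suc n)) (sumTo-shift n f) ⟩
      sumTo n f + f n + f (suc n)            ∎
      where open ≡-Reasoning

    dead : ℕ → ℕ → ℕ
    dead s a = only (not (alive s a)) 1

    -- The strip number of row r + s advances by 1 while s runs through a
    -- period, so it jumps within two rows for at most two shifts s.
    dead-twice : ∀ a → sumTo k (λ s → dead s a) ≤ 2
    dead-twice a = +-cancelʳ-≤ (sumTo k f) _ 2 (begin
      sumTo k (λ s → dead s a) + sumTo k f      ≡⟨ sym (sumTo-+ k _ f) ⟩
      sumTo k (λ s → dead s a + f s)            ≤⟨ sumTo-mono k (λ s _ → jump s) ⟩
      sumTo k (f ∘ suc ∘ suc)                   ≡⟨ +-cancelʳ-≡ (f 0 + f 1) _ _ telescope ⟩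
      2 + sumTo k f                             ∎)
      where
      open ≤-Reasoning
      f : ℕ → ℕ
      f s = (row a + s) / k
      -- For a dropped row the strip number increases within the next two rows, and moving two rows
      -- on is the same as increasing the shift by 2.
      jump : ∀ s → dead s a + f s ≤ f (2 + s)
      jump s rewrite +-suc (row a) (suc s) | +-suc (row a) s with alive s a in e
      ... | true  = /-monoˡ-≤ k (≤-trans (n≤1+n _) (n≤1+n _))
      ... | false = *-cancelʳ-< K (f s) _ (≤ᵇ-false⁻ e)
      period : ∀ s → f (k + s) ≡ suc (f s)
      period s = trans (cong (_/ k) (trans (cong (row a +_) (+-comm k s)) (sym (+-assoc (row a) s k))))
                       ([m+n]/n (row a + s) k)
      -- Moving the index by 2 trades `f 0` and `f 1` for `f k` and `f (suc k)`, each larger by one.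
      -- Both old terms are added on either side to avoid subtraction.
      telescope : sumTo k (f ∘ suc ∘ suc) + (f 0 + f 1) ≡ 2 + sumTo k f + (f 0 + f 1)
      telescope = begin-equality
        sumTo k (f ∘ suc ∘ suc) + (f 0 + f 1)      ≡⟨ cong (sumTo k (f ∘ suc ∘ suc) +_) (+-comm (f 0) (f 1)) ⟩
        sumTo k (f ∘ suc ∘ suc) + (f 1 + f 0)      ≡⟨ sym (+-assoc _ (f 1) (f 0)) ⟩
        sumTo k (f ∘ suc ∘ suc) + f 1 + f 0        ≡⟨ cong (_+ f 0) (sumTo-shift k (f ∘ suc)) ⟩
        sumTo k (f ∘ suc) + f (suc k) + f 0        ≡⟨ +-assoc _ (f (suc k)) (f 0) ⟩
        sumTo k (f ∘ suc) + (f (suc k) + f 0)      ≡⟨ cong (sumTo k (f ∘ suc) +_) (+-comm (f (suc k)) (f 0)) ⟩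
        sumTo k (f ∘ suc) + (f 0 + f (suc k))      ≡⟨ sym (+-assoc _ (f 0) (f (suc k))) ⟩
        sumTo k (f ∘ suc) + f 0 + f (suc k)        ≡⟨ cong (_+ f (suc k)) (sumTo-shift k f) ⟩
        sumTo k f + f k + f (suc k)                ≡⟨ cong₂ (λ x y → sumTo k f + x + y)
                                                        (trans (cong f (sym (+-identityʳ k))) (period 0))
                                                        (trans (cong f (+-comm 1 k)) (period 1)) ⟩
        sumTo k f + suc (f 0) + suc (f 1)          ≡⟨ shuffle (sumTo k f) (f 0) (f 1) ⟩
        2 + sumTo k f + (f 0 + f 1)                ∎
        where
        open +-*-Solver
        shuffle : ∀ x y z → x + suc y + suc z ≡ 2 + x + (y + z)
        shuffle = solve 3 (λ x y z → x :+ (con 1 :+ y) :+ (con 1 :+ z) := con 2 :+ x :+ (y :+ z)) refl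

    module _ (U : ℕ → Bool) where

      fullSize : ℕ
      fullSize = sumTo M λ a → only (U a) 1

      aliveSize : ℕ → ℕ
      aliveSize s = sumTo M λ a → only (U a ∧ alive s a) 1

      -- Averaging: count pairs of a member and a shift. The pairs in which the member survives
      -- number at most `k * l`, and each member is dropped by at most two shifts.
      shifting : ∀ {l} → (∀ s → s < k → aliveSize s ≤ l) → k * fullSize ≤ k * l + 2 * fullSize
      shifting {l} bound = begin
        k * fullSize
          ≡⟨ sym (sumTo-const k fullSize) ⟩
        sumTo k (λ _ → fullSize)
          ≤⟨ sumTo-mono k (λ s _ → ≤-trans (sumTo-mono M λ a _ → split s a) (≤-reflexive (sumTo-+ M _ _))) ⟩
        sumTo k (λ s → aliveSize s + sumTo M λ a → only (U a) (dead s a))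
          ≡⟨ sumTo-+ k aliveSize _ ⟩
        sumTo k aliveSize + sumTo k (λ s → sumTo M λ a → only (U a) (dead s a))
          ≤⟨ +-mono-≤ (sumTo-mono k bound) (≤-reflexive (sumTo-swap k M _)) ⟩
        sumTo k (λ _ → l) + sumTo M (λ a → sumTo k λ s → only (U a) (dead s a))
          ≤⟨ +-mono-≤ (≤-reflexive (sumTo-const k l)) (sumTo-mono M λ a _ → twice a) ⟩
        k * l + sumTo M (λ a → only (U a) 1 * 2)
          ≡⟨ cong (k * l +_) (trans (sumTo-* M (λ a → only (U a) 1) 2) (*-comm fullSize 2)) ⟩
        k * l + 2 * fullSize ∎
        where
        open ≤-Reasoning
        split : ∀ s a → only (U a) 1 ≤ only (U a ∧ alive s a) 1 + only (U a) (dead s a)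
        split s a with U a | alive s a
        ... | false | _     = z≤n
        ... | true  | true  = s≤s z≤n
        ... | true  | false = s≤s z≤n
        twice : ∀ a → sumTo k (λ s → only (U a) (dead s a)) ≤ only (U a) 1 * 2
        twice a with U a
        ... | true  = dead-twice a
        ... | false = ≤-reflexive (sumTo-zero k λ _ _ → refl)

  module Characteristic where
    open Finite

    occurs : List ℕ → ℕ → Bool
    occurs []       i = false
    occurs (x ∷ xs) i = (x ≡ᵇ i) ∨ occurs xs i

    occurs⇒∈ : ∀ xs {i} → occurs xs i ≡ true → i ∈ᴸ xs
    occurs⇒∈ (x ∷ xs) {i} h with x ≡ᵇ i in e
    ... | true  = here (sym (≡ᵇ-true⁻ e))
    ... | false = there (occurs⇒∈ xs h)

    absent : ∀ {xs i} → All (i ≢_) xs → occurs xs i ≡ false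
    absent []                          = refl
    absent {x ∷ _} (i≢x ∷ rest) rewrite ≡ᵇ-false (i≢x ∘ sym) = absent rest

    sumTo-occurs : ∀ n f {xs} → All (_< n) xs → AllPairs _≢_ xs →
                   sum (map f xs) ≡ sumTo n (λ i → only (occurs xs i) (f i))
    sumTo-occurs n f []              []             = sym (sumTo-zero n λ _ _ → refl)
    sumTo-occurs n f {x ∷ xs} (x<n ∷ xs<n) (x∉ ∷ distinct) = begin
      f x + sum (map f xs)
        ≡⟨ cong₂ _+_ (sym (single n x<n)) (sumTo-occurs n f xs<n distinct) ⟩
      sumTo n (λ i → only (x ≡ᵇ i) (f i)) + sumTo n (λ i → only (occurs xs i) (f i))
        ≡⟨ sym (sumTo-+ n _ _) ⟩
      sumTo n (λ i → only (x ≡ᵇ i) (f i) + only (occurs xs i) (f i))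
        ≡⟨ sumTo-cong n (λ i _ → merge i) ⟩
      sumTo n (λ i → only (occurs (x ∷ xs) i) (f i)) ∎
      where
      open ≡-Reasoning
      merge : ∀ i → only (x ≡ᵇ i) (f i) + only (occurs xs i) (f i) ≡ only (occurs (x ∷ xs) i) (f i)
      merge i with x ≡ᵇ i in e
      ... | false = refl
      ... | true rewrite sym (≡ᵇ-true⁻ {x} {i} e) | absent x∉ = +-identityʳ (f x)
      single : ∀ n → x < n → sumTo n (λ i → only (x ≡ᵇ i) (f i)) ≡ f x
      single (suc n) x<1+n with m<1+n-cases x<1+n
      ... | inj₁ x<n  rewrite single n x<n | ≡ᵇ-false (<⇒≢ x<n) = +-identityʳ (f x)
      ... | inj₂ refl rewrite ≡ᵇ-true {x} refl =
        cong (_+ f x) (sumTo-zero x λ i i<x → cong (λ b → only b (f i)) (≡ᵇ-false (>⇒≢ i<x)))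

    member : ∀ {n} → Subset n → ℕ → Bool
    member []      _       = false
    member (b ∷ p) zero    = b
    member (b ∷ p) (suc i) = member p i

    ∣∣-sumTo : ∀ {n} (p : Subset n) → ∣ p ∣ ≡ sumTo n λ i → only (member p i) 1
    ∣∣-sumTo [] = refl
    ∣∣-sumTo {suc n} (b ∷ p) = trans (front b) (sym (sumTo-append 1 n (λ i → only (member (b ∷ p) i) 1)))
      where
      front : ∀ b → ∣ b ∷ p ∣ ≡ only b 1 + sumTo n λ i → only (member p i) 1
      front true  = cong suc (∣∣-sumTo p)
      front false = ∣∣-sumTo p

    ∈⇒member : ∀ {n} {p : Subset n} {i} → i ∈ p → member p (toℕ i) ≡ true
    ∈⇒member Vec.here      = refl
    ∈⇒member (Vec.there q) = ∈⇒member q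

    member⇒∈ : ∀ {n} (p : Subset n) i → member p (toℕ i) ≡ true → i ∈ p
    member⇒∈ (true ∷ p) Fin.zero    refl = Vec.here
    member⇒∈ (b ∷ p)    (Fin.suc i) h    = Vec.there (member⇒∈ p i h)

    member-tabulate : ∀ n (f : ℕ → Bool) i → i < n → member (tabulate {n = n} (f ∘ toℕ)) i ≡ f i
    member-tabulate (suc n) f zero    _         = refl
    member-tabulate (suc n) f (suc i) (s≤s i<n) = member-tabulate n (f ∘ suc) i i<n

    -- The number with binary digits `χ 0` up to `χ (i - 1)`.
    prefix : (ℕ → Bool) → ℕ → ℕ
    prefix χ i = sumTo i λ j → only (χ j) (2 ^ j)

    2^-double : ∀ i → 2 ^ suc i ≡ 2 ^ i + 2 ^ i
    2^-double i = cong (2 ^ i +_) (+-identityʳ (2 ^ i))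

    prefix< : ∀ χ i → prefix χ i < 2 ^ i
    prefix< χ zero    = s≤s z≤n
    prefix< χ (suc i) = subst (prefix χ (suc i) <_) (sym (2^-double i)) (+-mono-<-≤ (prefix< χ i) (bit (χ i)))
      where
      bit : ∀ b → only b (2 ^ i) ≤ 2 ^ i
      bit true  = ≤-refl
      bit false = z≤n

    -- The lower digits sum to less than `2 ^ i`, so one comparison reads the top digit; this
    -- replaces division when the answer is decoded.
    leading-bit : ∀ χ i → (2 ^ i ≤ᵇ prefix χ (suc i)) ≡ χ i
    leading-bit χ i with χ i
    ... | true  = ≤ᵇ-true (m≤n+m (2 ^ i) (prefix χ i))
    ... | false = ≤ᵇ-false (subst (_< 2 ^ i) (sym (+-identityʳ (prefix χ i))) (prefix< χ i))

  -- The weight 2 ^ n + 2 ^ i of disk i makes a heaviest set a largest one and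
  -- lets the set be read off its weight.

  module Weights (n : ℕ) where
    open Finite
    open Characteristic

    point : ℕ → ℕ
    point a = if suc a ≤ᵇ n then a else a ∸ n

    point-low : ∀ {a} → a < n → point a ≡ a
    point-low {a} lt rewrite ≤ᵇ-true {suc a} lt = refl

    point-high : ∀ i → point (n + i) ≡ i
    point-high i rewrite ≤ᵇ-false {suc (n + i)} {n} (s≤s (m≤m+n n i)) = m+n∸m≡n n i

    point< : ∀ {a} → a < n + n → point a < n
    point< {a} a<2n with suc a ≤ᵇ n in e
    ... | true  = ≤ᵇ-true⁻ {suc a} {n} e
    ... | false = +-cancelˡ-< n (a ∸ n) n (subst (_< n + n) (sym (m+[n∸m]≡n (≤-pred (≤ᵇ-false⁻ {suc a} {n} e)))) a<2n)

    module Decode (w : ℕ → ℕ) (w-item : ∀ a → a < n + n → w a ≡ 2 ^ n + 2 ^ point a)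
                  (L : List ℕ) (L< : All (_< n + n) L) (distinct : AllPairs (λ a b → point a ≢ point b) L) where

      points : List ℕ
      points = map point L

      points< : All (_< n) points
      points< = Allₚ.map⁺ (All.map point< L<)

      points-distinct : AllPairs _≢_ points
      points-distinct = AllPairsₚ.map⁺ distinct

      χ : ℕ → Bool
      χ = occurs points

      mask : ℕ
      mask = prefix χ n

      size : ℕ
      size = sumTo n λ i → only (χ i) 1

      size≤n : size ≤ n
      size≤n = ≤-trans (sumTo-mono n λ i _ → one (χ i)) (≤-reflexive (trans (sumTo-const n 1) (*-identityʳ n)))
        where
        one : ∀ b → only b 1 ≤ 1
        one true  = ≤-refl
        one false = z≤n

      total : sum (map w L) ≡ size * 2 ^ n + mask
      total = begin
        sum (map w L)                                          ≡⟨ weights L< ⟩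
        sum (map (λ i → 2 ^ n + 2 ^ i) points)                 ≡⟨ sumTo-occurs n _ points< points-distinct ⟩
        sumTo n (λ i → only (χ i) (2 ^ n + 2 ^ i))             ≡⟨ sumTo-cong n (λ i _ → split (χ i) i) ⟩
        sumTo n (λ i → only (χ i) 1 * 2 ^ n + only (χ i) (2 ^ i)) ≡⟨ sumTo-+ n _ _ ⟩
        sumTo n (λ i → only (χ i) 1 * 2 ^ n) + mask            ≡⟨ cong (_+ mask) (sumTo-* n _ (2 ^ n)) ⟩
        size * 2 ^ n + mask ∎
        where
        open ≡-Reasoning
        weights : ∀ {L} → All (_< n + n) L → sum (map w L) ≡ sum (map (λ i → 2 ^ n + 2 ^ i) (map point L))
        weights []         = refl
        weights (a< ∷ as<) = cong₂ _+_ (w-item _ a<) (weights as<)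
        split : ∀ b i → only b (2 ^ n + 2 ^ i) ≡ only b 1 * 2 ^ n + only b (2 ^ i)
        split true  i = cong (_+ 2 ^ i) (sym (*-identityˡ (2 ^ n)))
        split false i = refl

      -- An item weighs at least `2 ^ n`, whereas the mask contributes less than `2 ^ n` in all. So
      -- the low bits, added for decoding, never outweigh one more item.
      dominates : ∀ (p : ℕ → Bool) → sumTo (n + n) (λ a → only (p a) (w a)) ≤ sum (map w L) →
                  sumTo (n + n) (λ a → only (p a) 1) ≤ size
      dominates p le = ≤-pred (*-cancelʳ-< (2 ^ n) _ (suc size) (begin-strict
        sumTo (n + n) (λ a → only (p a) 1) * 2 ^ n      ≡⟨ sym (sumTo-* (n + n) _ (2 ^ n)) ⟩
        sumTo (n + n) (λ a → only (p a) 1 * 2 ^ n)      ≤⟨ sumTo-mono (n + n) heavy ⟩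
        sumTo (n + n) (λ a → only (p a) (w a))          ≤⟨ le ⟩
        sum (map w L)                                   ≡⟨ total ⟩
        size * 2 ^ n + mask                             <⟨ +-monoʳ-< (size * 2 ^ n) (prefix< χ n) ⟩
        size * 2 ^ n + 2 ^ n                            ≡⟨ +-comm (size * 2 ^ n) (2 ^ n) ⟩
        suc size * 2 ^ n                                ∎))
        where
        open ≤-Reasoning
        heavy : ∀ a → a < n + n → only (p a) 1 * 2 ^ n ≤ only (p a) (w a)
        heavy a a< with p a
        ... | false = z≤n
        ... | true rewrite w-item a a< | +-identityʳ (2 ^ n) = m≤m+n (2 ^ n) _

      -- What is left of the total after `i` attempts to subtract `2 ^ n`. As `size` is at most `n`,
      -- the remainder modulo `2 ^ n` is reached after `n` attempts without a division.
      reduced : ℕ → ℕ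
      reduced i = (size ∸ i) * 2 ^ n + mask

      reduce-step : ∀ i → (if 2 ^ n ≤ᵇ reduced i then reduced i ∸ 2 ^ n else reduced i) ≡ reduced (suc i)
      reduce-step i with size ∸ i in e
      ... | zero rewrite ≤ᵇ-false (prefix< χ n) = cong (λ x → x * 2 ^ n + mask) (sym (m≤n⇒m∸n≡0 {size} {suc i} (m≤n⇒m≤1+n (m∸n≡0⇒m≤n {size} {i} e))))
      ... | suc r rewrite ≤ᵇ-true (≤-trans (m≤m+n (2 ^ n) (r * 2 ^ n)) (m≤m+n _ mask)) =
        trans (cong (_∸ 2 ^ n) (+-assoc (2 ^ n) (r * 2 ^ n) mask))
          (trans (m+n∸m≡n (2 ^ n) _)
            (cong (λ x → x * 2 ^ n + mask) (sym (trans (sym (pred[m∸n]≡m∸[1+n] size i)) (cong pred e)))))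

      reduced-end : reduced n ≡ mask
      reduced-end = cong (λ x → x * 2 ^ n + mask) (m≤n⇒m∸n≡0 size≤n)

-- Geometry: two-coloured disks as points in space.

module Geometry where

  open import Data.Bool using (Bool; true; false; not; if_then_else_)
  import Data.Bool.Properties as Boolₚ
  open import Data.Empty using (⊥; ⊥-elim)
  open import Data.Fin using (Fin; toℕ; fromℕ<)
  open import Data.Fin.Properties using (toℕ-fromℕ<; toℕ-injective)
  open import Data.Fin.Subset using (Subset; _∈_; ∣_∣)
  open import Data.Fin.Subset.Properties using (_∈?_)
  open import Data.List using (List; []; _∷_; map)
  open import Data.List.Membership.Propositional using () renaming (_∈_ to _∈ᴸ_)
  open import Data.List.Membership.Propositional.Properties using (∈-map⁻)
  open import Data.List.Relation.Unary.All as All using (All; []; _∷_)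
  open import Data.List.Relation.Unary.AllPairs using (AllPairs; []; _∷_)
  open import Data.List.Relation.Unary.Any using (here; there)
  open import Data.Nat as ℕ using (ℕ; suc; z≤n; s≤s)
  import Data.Nat.Properties as ℕₚ
  open import Data.Product using (∃-syntax; _×_; _,_; proj₁; proj₂)
  open import Data.Sum using (_⊎_; inj₁; inj₂)
  open import Data.Vec.Properties.WithK using ([]=-irrelevant)
  open import Relation.Binary.PropositionalEquality as ≡ using (_≡_; _≢_)
  open import Relation.Nullary using (yes; no)
  open import Relation.Nullary.Decidable using (⌊_⌋)
  open FiniteSumsAndRunningTimes
  open RealNumbers
  open Combinatorics

  module Intersection (ℝ : RealField) where
    open RealField ℝ
    open MBS ℝ
    open OrderedFieldProperties orderedField

    -- The midpoint of the centres lies in both disks.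
    near⇒Intersect : ∀ {a b c d} → (a - b) * (a - b) + (c - d) * (c - d) ≤ 2# * 2# →
                     Intersect (disk (a , c)) (disk (b , d))
    near⇒Intersect {a} {b} {c} {d} le =
      (midpoint a b , midpoint c d) ,
      midpoint-near (≤-respˡ (+-cong (-sq-sym a b) (-sq-sym c d)) le) ,
      ≤-respˡ (+-cong (swap a b) (swap c d)) (midpoint-near le)
      where
      swap : ∀ a b → (midpoint b a - b) * (midpoint b a - b) ≈ (midpoint a b - b) * (midpoint a b - b)
      swap a b = *-cong (+-cong (midpoint-comm b a) refl) (+-cong (midpoint-comm b a) refl)

    -- Applied to both coordinates of a common point, `parallelogram` bounds the squared distance of
    -- the centres by twice the sum of its squared distances to them, hence by 2 (1 + 1).
    Intersect⇒near : ∀ {a b c d} → Intersect (disk (a , c)) (disk (b , d)) →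
                     (a - b) * (a - b) + (c - d) * (c - d) ≤ 2# * 2#
    Intersect⇒near {a} {b} {c} {d} ((p , q) , in₁ , in₂) =
      ≤-trans (+-mono-≤ (parallelogram {p} {a} {b}) (parallelogram {q} {c} {d}))
        (≤-respˡ (shuffle _ _ _ _) (≤-respʳ (sym (double 2#)) (+-mono-≤ both both)))
      where
      u = (p - a) * (p - a)
      v = (q - c) * (q - c)
      u′ = (p - b) * (p - b)
      v′ = (q - d) * (q - d)
      both : (u + v) + (u′ + v′) ≤ 2#
      both = +-mono-≤ (≤-respʳ (*-identityˡ 1#) in₁) (≤-respʳ (*-identityˡ 1#) in₂)
      shuffle : ∀ u v u′ v′ → ((u + v) + (u′ + v′)) + ((u + v) + (u′ + v′)) ≈
                ((u + u′) + (u + u′)) + ((v + v′) + (v + v′))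
      shuffle = solve 4 (λ u v u′ v′ → ((u :+ v) :+ (u′ :+ v′)) :+ ((u :+ v) :+ (u′ :+ v′)) :=
                  ((u :+ u′) :+ (u :+ u′)) :+ ((v :+ v′) :+ (v :+ v′))) refl

  -- A 2-coloured set of disks is a set of points in space: the items i and
  -- n + i are the centre of disk i at heights 0 and 2.  A set of disks is
  -- bipartite iff it lifts to items at pairwise distance more than 2.

  module Items (ℝ : RealField) {n : ℕ} (S : MBS.DiskSet ℝ n) (X Y Z : ℕ → RealField.Carrier ℝ) where
    open RealField ℝ
    open MBS ℝ
    open OrderedFieldProperties orderedField
    open DecidableOrder orderedField
    open Intersection ℝ
    open Finite
    open Characteristic
    open Weights n

    M : ℕ
    M = n ℕ.+ n

    colour : ℕ → ℕ
    colour a = if suc a ℕ.≤ᵇ n then 0 else 1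

    conf : ℕ → ℕ → Bool
    conf a b = ⌊ dist² (X a - X b) (Y a - Y b) (Z a - Z b) ≤? 2# * 2# ⌋

    open Layers orderedField M Y public using () renaming (layer to row; layer≤M to row≤)
    open Layers orderedField M X public using () renaming (layer to col; layer≤M to col≤)
    private
      module Row = Layers orderedField M Y
      module Col = Layers orderedField M X

    colour<2 : ∀ a → colour a ℕ.< 2
    colour<2 a with suc a ℕ.≤ᵇ n
    ... | true  = s≤s z≤n
    ... | false = s≤s (s≤s z≤n)

    colour-point-injective : ∀ {a b} → colour a ≡ colour b → point a ≡ point b → a ≡ b
    colour-point-injective {a} {b} c p with suc a ℕ.≤ᵇ n in e | suc b ℕ.≤ᵇ n in e′
    ... | true  | true  = p
    ... | false | false = ℕₚ.∸-cancelʳ-≡ (ℕₚ.≤-pred (≤ᵇ-false⁻ {suc a} {n} e)) (ℕₚ.≤-pred (≤ᵇ-false⁻ {suc b} {n} e′)) p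
    colour-point-injective () _ | true | false
    colour-point-injective () _ | false | true

    coordinate-at : ∀ π {i} (i<n : i ℕ.< n) → coordinate S π i ≡ π (centre (disks S (fromℕ< i<n)))
    coordinate-at π {i} i<n with i ℕ.<? n
    ... | yes _  = ≡.refl
    ... | no i≮n = ⊥-elim (i≮n i<n)

    -- `X`, `Y` and `Z` stand for entire arrays of the memory; what they contain is prescribed only
    -- for items.
    module _ (X≡ : ∀ {a} → a ℕ.< M → X a ≡ coordinate S proj₁ (point a))
             (Y≡ : ∀ {a} → a ℕ.< M → Y a ≡ coordinate S proj₂ (point a))
             (Z≡ : ∀ {a} → a ℕ.< M → Z a ≡ (if suc a ℕ.≤ᵇ n then 0# else 2#)) where

      index : ∀ {a} → a ℕ.< M → Fin n
      index a<M = fromℕ< (point< a<M)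

      toℕ-index : ∀ {a} (a<M : a ℕ.< M) → toℕ (index a<M) ≡ point a
      toℕ-index a<M = toℕ-fromℕ< (point< a<M)

      X-at : ∀ {a} (a<M : a ℕ.< M) → X a ≡ proj₁ (centre (disks S (index a<M)))
      X-at a<M = ≡.trans (X≡ a<M) (coordinate-at proj₁ (point< a<M))

      Y-at : ∀ {a} (a<M : a ℕ.< M) → Y a ≡ proj₂ (centre (disks S (index a<M)))
      Y-at a<M = ≡.trans (Y≡ a<M) (coordinate-at proj₂ (point< a<M))

      Z-colour : ∀ {a b} → a ℕ.< M → b ℕ.< M → colour a ≡ colour b → Z a ≡ Z b
      Z-colour {a} {b} a<M b<M e rewrite Z≡ a<M | Z≡ b<M with suc a ℕ.≤ᵇ n | suc b ℕ.≤ᵇ n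
      ... | true  | true  = ≡.refl
      ... | false | false = ≡.refl
      Z-colour _ _ () | true | false
      Z-colour _ _ () | false | true

      Z-apart : ∀ {a b} → a ℕ.< M → b ℕ.< M → colour a ≢ colour b → (Z a - Z b) * (Z a - Z b) ≈ 2# * 2#
      Z-apart {a} {b} a<M b<M ne rewrite Z≡ a<M | Z≡ b<M with suc a ℕ.≤ᵇ n | suc b ℕ.≤ᵇ n
      ... | true  | true  = ⊥-elim (ne ≡.refl)
      ... | false | false = ⊥-elim (ne ≡.refl)
      ... | true  | false = trans (*-cong (+-identityˡ (- 2#)) (+-identityˡ (- 2#))) (neg-sq 2#)
      ... | false | true  = *-cong 2-0 2-0
        where
        2-0 : 2# - 0# ≈ 2#
        2-0 = trans (+-cong refl -0#≈0#) (+-identityʳ 2#)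

      conf⇒ : ∀ {a b} → conf a b ≡ true → dist² (X a - X b) (Y a - Y b) (Z a - Z b) ≤ 2# * 2#
      conf⇒ = ≤?-true⁻

      conf-rows : ∀ {a b} → b ℕ.< M → conf a b ≡ true → row a ℕ.≤ 2 ℕ.+ row b
      conf-rows b<M h = Row.near-layers b<M (dist²-nearʳ (conf⇒ h))

      conf-cols : ∀ {a b} → b ℕ.< M → conf a b ≡ true → col a ℕ.≤ 2 ℕ.+ col b
      conf-cols b<M h = Col.near-layers b<M (dist²-nearˡ (conf⇒ h))

      conf-sym : ∀ {a b} → conf a b ≡ true → conf b a ≡ true
      conf-sym {a} {b} h = ≤?-true (≤-respˡ (dist²-sym (X a) (X b) (Y a) (Y b) (Z a) (Z b)) (conf⇒ h))

      conf-clique : ∀ {a b} → a ℕ.< M → b ℕ.< M → row a ≡ row b → col a ≡ col b → colour a ≡ colour b →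
                    conf a b ≡ true
      conf-clique {a} {b} a<M b<M r c z =
        ≤?-true (≡.subst (λ w → dist² (X a - X b) (Y a - Y b) (Z a - w) ≤ 2# * 2#) (Z-colour a<M b<M z)
          (dist²-clique (Col.same-layer b<M c) (Col.same-layer a<M (≡.sym c))
                        (Row.same-layer b<M r) (Row.same-layer a<M (≡.sym r))))

      conf-flat : ∀ {a b} → a ℕ.< M → b ℕ.< M → colour a ≡ colour b →
                  dist² (X a - X b) (Y a - Y b) (Z a - Z b) ≈
                  (X a - X b) * (X a - X b) + (Y a - Y b) * (Y a - Y b)
      conf-flat {a} {b} a<M b<M z rewrite Z-colour a<M b<M z =
        trans (+-cong refl (trans (*-cong (-‿inverseʳ (Z b)) refl) (zeroˡ _))) (+-identityʳ _)

      -- The two items of one disk are at distance exactly 2, which the non-strict comparison counts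
      -- as a conflict. Hence an independent list selects no disk twice.
      conf-point : ∀ {a b} → a ℕ.< M → b ℕ.< M → point a ≡ point b → conf a b ≡ true
      conf-point {a} {b} a<M b<M p with colour a ℕ.≟ colour b
      ... | yes c rewrite colour-point-injective c p = conf-clique b<M b<M ≡.refl ≡.refl ≡.refl
      ... | no c = ≤?-true (≤-respˡ (sym (trans (+-cong planar refl) (+-identityˡ _))) (≤-reflexive (Z-apart a<M b<M c)))
        where
        zero-diff : ∀ {x y} → x ≡ y → (x - y) * (x - y) ≈ 0#
        zero-diff {x} ≡.refl = trans (*-cong (-‿inverseʳ x) refl) (zeroˡ _)
        planar : (X a - X b) * (X a - X b) + (Y a - Y b) * (Y a - Y b) ≈ 0#
        planar = trans (+-cong (zero-diff (≡.trans (X≡ a<M) (≡.trans (≡.cong (coordinate S proj₁) p) (≡.sym (X≡ b<M)))))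
                               (zero-diff (≡.trans (Y≡ a<M) (≡.trans (≡.cong (coordinate S proj₂) p) (≡.sym (Y≡ b<M))))))
                       (+-identityˡ 0#)

      conf-Intersect : ∀ {a b} (a<M : a ℕ.< M) (b<M : b ℕ.< M) → colour a ≡ colour b → conf a b ≡ true →
                       Intersect (disks S (index a<M)) (disks S (index b<M))
      conf-Intersect {a} {b} a<M b<M c h = near⇒Intersect flat
        where
        p = centre (disks S (index a<M))
        q = centre (disks S (index b<M))
        flat : (proj₁ p - proj₁ q) * (proj₁ p - proj₁ q) + (proj₂ p - proj₂ q) * (proj₂ p - proj₂ q) ≤ 2# * 2#
        flat rewrite ≡.sym (X-at a<M) | ≡.sym (X-at b<M) | ≡.sym (Y-at a<M) | ≡.sym (Y-at b<M) =
          ≤-respˡ (conf-flat a<M b<M c) (conf⇒ h)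

      Intersect-conf : ∀ {a b} (a<M : a ℕ.< M) (b<M : b ℕ.< M) → colour a ≡ colour b →
                       Intersect (disks S (index a<M)) (disks S (index b<M)) → conf a b ≡ true
      Intersect-conf {a} {b} a<M b<M c h = ≤?-true (≤-respˡ (sym (conf-flat a<M b<M c)) flat)
        where
        flat : (X a - X b) * (X a - X b) + (Y a - Y b) * (Y a - Y b) ≤ 2# * 2#
        flat rewrite X-at a<M | X-at b<M | Y-at a<M | Y-at b<M = Intersect⇒near h

      -- The difference of heights exhausts the distance 2, so the centres coincide. Here it matters
      -- that the disks form a set: equal centres belong to the same disk.
      conf-colours : ∀ {a b} (a<M : a ℕ.< M) (b<M : b ℕ.< M) → colour a ≢ colour b → conf a b ≡ true →
                     index a<M ≡ index b<M
      conf-colours {a} {b} a<M b<M c h = distinct S (x≈ , y≈)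
        where
        apart = dist²-apart (Z-apart a<M b<M c) (conf⇒ h)
        x≈ : proj₁ (centre (disks S (index a<M))) ≈ proj₁ (centre (disks S (index b<M)))
        x≈ rewrite ≡.sym (X-at a<M) | ≡.sym (X-at b<M) = proj₁ apart
        y≈ : proj₂ (centre (disks S (index a<M))) ≈ proj₂ (centre (disks S (index b<M)))
        y≈ rewrite ≡.sym (Y-at a<M) | ≡.sym (Y-at b<M) = proj₂ apart

      module _ (L : List ℕ) (L< : All (ℕ._< M) L) (L-independent : AllPairs (λ a b → conf a b ≡ false) L) where

        points-apart : AllPairs (λ a b → point a ≢ point b) L
        points-apart = go L< L-independent
          where
          go : ∀ {L} → All (ℕ._< M) L → AllPairs (λ a b → conf a b ≡ false) L →
               AllPairs (λ a b → point a ≢ point b) L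
          go []         []         = []
          go (a< ∷ as<) (ap ∷ aps) =
            All.zipWith (λ { (b< , f) p → true≢false (conf-point a< b< p) f }) (as< , ap) ∷ go as< aps

        pairwise : ∀ {a b} → a ∈ᴸ L → b ∈ᴸ L → a ≡ b ⊎ conf a b ≡ false
        pairwise = go L-independent
          where
          flip : ∀ {a b} → conf a b ≡ false → conf b a ≡ false
          flip {a} {b} f with conf b a in e
          ... | false = ≡.refl
          ... | true  = true≢false (conf-sym {b} {a} e) f
          go : ∀ {L a b} → AllPairs (λ a b → conf a b ≡ false) L → a ∈ᴸ L → b ∈ᴸ L → a ≡ b ⊎ conf a b ≡ false
          go _ (here ≡.refl) (here ≡.refl) = inj₁ ≡.refl
          go (ap ∷ _) (here ≡.refl) (there b∈) = inj₂ (All.lookup ap b∈)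
          go (ap ∷ _) (there a∈) (here ≡.refl) = inj₂ (flip (All.lookup ap a∈))
          go (_ ∷ aps) (there a∈) (there b∈) = go aps a∈ b∈

        -- A disk takes the colour of an item of `L` through which it was selected. Meeting disks of
        -- one colour would be two conflicting items of `L`.
        colourable : ∀ T → (∀ i → i ∈ T → occurs (map point L) (toℕ i) ≡ true) → BipartiteSubset S T
        colourable T T⊆ = (λ (i , i∈T) → side i i∈T) , differ
          where
          lift : ∀ i → i ∈ T → ∃[ a ] a ∈ᴸ L × toℕ i ≡ point a
          lift i i∈T = ∈-map⁻ point (occurs⇒∈ (map point L) (T⊆ i i∈T))
          side : ∀ i → i ∈ T → Bool
          side i i∈T = colour (proj₁ (lift i i∈T)) ℕ.≡ᵇ 0
          same-side : ∀ {a b} → (colour a ℕ.≡ᵇ 0) ≡ (colour b ℕ.≡ᵇ 0) → colour a ≡ colour b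
          same-side {a} {b} e with suc a ℕ.≤ᵇ n | suc b ℕ.≤ᵇ n
          ... | true  | true  = ≡.refl
          ... | false | false = ≡.refl
          same-side () | true | false
          same-side () | false | true
          differ : ∀ (u v : ∃[ i ] i ∈ T) → proj₁ u ≢ proj₁ v × Intersect (disks S (proj₁ u)) (disks S (proj₁ v)) →
                   side (proj₁ u) (proj₂ u) ≢ side (proj₁ v) (proj₂ v)
          differ (i , i∈T) (j , j∈T) (i≢j , meet) e with lift i i∈T | lift j j∈T
          ... | a , a∈ , pa | b , b∈ , pb with pairwise a∈ b∈
          ... | inj₁ ≡.refl = i≢j (toℕ-injective (≡.trans pa (≡.sym pb)))
          ... | inj₂ f = true≢false (Intersect-conf a< b< (same-side {a} {b} e) meet′) f
            where
            a< = All.lookup L< a∈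
            b< = All.lookup L< b∈
            meet′ : Intersect (disks S (index a<)) (disks S (index b<))
            meet′ = ≡.subst₂ (λ i j → Intersect (disks S i) (disks S j))
                      (toℕ-injective (≡.trans pa (≡.sym (toℕ-index a<))))
                      (toℕ-injective (≡.trans pb (≡.sym (toℕ-index b<)))) meet

      module _ (T : Subset n) (side : ∃[ i ] i ∈ T → Bool) where

        -- `side` can be consulted only with a proof of membership, hence the nested decisions. The
        -- argument `b` is the side that the item stands for.
        lift : Bool → ℕ → Bool
        lift b i with i ℕ.<? n
        ... | no _ = false
        ... | yes i<n with fromℕ< i<n ∈? T
        ... | no _ = false
        ... | yes i∈T = if b then side (fromℕ< i<n , i∈T) else not (side (fromℕ< i<n , i∈T))

        lift⇒ : ∀ b {i} (i<n : i ℕ.< n) → lift b i ≡ true →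
                ∃[ i∈T ] (if b then side (fromℕ< i<n , i∈T) else not (side (fromℕ< i<n , i∈T))) ≡ true
        lift⇒ b {i} i<n h with i ℕ.<? n
        lift⇒ b {i} i<n () | no _
        ... | yes p with fromℕ< p ∈? T
        lift⇒ b {i} i<n () | yes _ | no _
        ... | yes i∈T = i∈T , h

        lift-once : ∀ i → i ℕ.< n → only (lift true i) 1 ℕ.+ only (lift false i) 1 ≡ only (member T i) 1
        lift-once i i<n with i ℕ.<? n
        ... | no i≮n = ⊥-elim (i≮n i<n)
        ... | yes p with fromℕ< p ∈? T | member T i in e
        ... | no i∉T  | true  = ⊥-elim (i∉T (member⇒∈ T (fromℕ< p) (≡.trans (≡.cong (member T) (toℕ-fromℕ< p)) e)))
        ... | no _    | false = ≡.refl
        ... | yes i∈T | false = true≢false (≡.trans (≡.cong (member T) (≡.sym (toℕ-fromℕ< p))) (∈⇒member i∈T)) e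
        ... | yes i∈T | true  = exclusive (side (fromℕ< p , i∈T))
          where
          exclusive : ∀ b → only b 1 ℕ.+ only (not b) 1 ≡ 1
          exclusive true  = ≡.refl
          exclusive false = ≡.refl

        lifted : ℕ → Bool
        lifted a = lift (suc a ℕ.≤ᵇ n) (point a)

        lifted⇒ : ∀ {a} (a<M : a ℕ.< M) → lifted a ≡ true →
                  ∃[ i∈T ] (if suc a ℕ.≤ᵇ n then side (index a<M , i∈T) else not (side (index a<M , i∈T))) ≡ true
        lifted⇒ {a} a<M = lift⇒ (suc a ℕ.≤ᵇ n) (point< a<M)

        lifted-size : sumTo M (λ a → only (lifted a) 1) ≡ ∣ T ∣
        lifted-size = ≡.trans (sumTo-append n n _) (≡.trans (≡.sym (sumTo-+ n _ _))
                        (≡.trans (sumTo-cong n once) (≡.sym (∣∣-sumTo T))))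
          where
          once : ∀ i → i ℕ.< n → only (lifted i) 1 ℕ.+ only (lifted (n ℕ.+ i)) 1 ≡ only (member T i) 1
          once i i<n = ≡.trans (≡.cong₂ (λ b c → only b 1 ℕ.+ only c 1)
              (≡.cong₂ lift (≤ᵇ-true {suc i} i<n) (point-low i<n))
              (≡.cong₂ lift (≤ᵇ-false {suc (n ℕ.+ i)} {n} (s≤s (ℕₚ.m≤m+n n i))) (point-high i)))
            (lift-once i i<n)

        agree : ∀ s t → (if s then 0 else 1) ≡ (if t then 0 else 1) → ∀ {x y} →
                (if s then x else not x) ≡ true → (if t then y else not y) ≡ true → x ≡ y
        agree true  true  _ p q = ≡.trans p (≡.sym q)
        agree false false _ p q = Boolₚ.not-injective (≡.trans p (≡.sym q))
        agree true  false ()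
        agree false true  ()

        -- `side` might depend on the membership proof it is given; uniqueness of these proofs
        -- ensures that a disk has one colour.
        one-colour : ∀ s t → (if s then 0 else 1) ≢ (if t then 0 else 1) →
                     ∀ {i j} → i ≡ j → (i∈T : i ∈ T) (j∈T : j ∈ T) →
                     (if s then side (i , i∈T) else not (side (i , i∈T))) ≡ true →
                     (if t then side (j , j∈T) else not (side (j , j∈T))) ≡ true → ⊥
        one-colour s t c ≡.refl i∈T j∈T p q rewrite []=-irrelevant i∈T j∈T with s | t
        ... | true  | true  = c ≡.refl
        ... | false | false = c ≡.refl
        ... | true  | false = Boolₚ.not-¬ ≡.refl (≡.trans p (≡.sym q))
        ... | false | true  = Boolₚ.not-¬ ≡.refl (≡.trans q (≡.sym p))

        -- A conflict within a colour makes two disks of the same side intersect, against the proper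
        -- colouring. A conflict between the colours comes from a single disk, which would then be
        -- on both sides.
        lifted-independent :
          (∀ u v → proj₁ u ≢ proj₁ v × Intersect (disks S (proj₁ u)) (disks S (proj₁ v)) → side u ≢ side v) →
          ∀ {a b} → a ℕ.< M → b ℕ.< M → lifted a ≡ true → lifted b ≡ true → a ≢ b → conf a b ≡ false
        lifted-independent proper {a} {b} a<M b<M ua ub a≢b with conf a b in e
        ... | false = ≡.refl
        ... | true with lifted⇒ a<M ua | lifted⇒ b<M ub | colour a ℕ.≟ colour b
        ... | i∈T , sa | j∈T , sb | no c =
          ⊥-elim (one-colour (suc a ℕ.≤ᵇ n) (suc b ℕ.≤ᵇ n) c (conf-colours a<M b<M c e) i∈T j∈T sa sb)
        ... | i∈T , sa | j∈T , sb | yes c =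
          ⊥-elim (proper (index a<M , i∈T) (index b<M , j∈T) (i≢j , conf-Intersect a<M b<M c e)
                         (agree (suc a ℕ.≤ᵇ n) (suc b ℕ.≤ᵇ n) c sa sb))
          where
          i≢j : index a<M ≢ index b<M
          i≢j eq = a≢b (colour-point-injective c
                     (≡.trans (≡.sym (toℕ-index a<M)) (≡.trans (≡.cong toℕ eq) (toℕ-index b<M))))

-- The program: arrays, frame conditions and simultaneous updates.

module Algorithm where

  open import Data.Bool using (Bool; true; false; not; _∧_; _∨_; if_then_else_; T)
  open import Data.Empty using (⊥-elim)
  open import Data.Fin using (toℕ)
  open import Data.Fin.Properties using (toℕ<n)
  open import Data.Fin.Subset using (Subset; ∣_∣)
  open import Data.List using (List; []; _∷_; map; _++_)
  open import Data.List.Relation.Unary.All using (All; [])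
  open import Data.List.Relation.Unary.AllPairs using (AllPairs; [])
  open import Data.Nat
  open import Data.Nat.DivMod
  open import Data.Nat.ListAction using (sum)
  open import Data.Nat.Properties
  open import Data.Nat.Solver using (module +-*-Solver)
  open import Data.Product using (∃-syntax; _×_; _,_; proj₁; proj₂)
  open import Data.Sum using (_⊎_; inj₁; inj₂)
  open import Data.Unit using (tt)
  open import Function using (_∘_; case_of_)
  open import Relation.Binary.PropositionalEquality hiding ([_])
  open import Relation.Nullary using (yes; no)
  open import Relation.Nullary.Decidable using (⌊_⌋)
  open FiniteSumsAndRunningTimes
  open RealNumbers
  open Combinatorics
  open Geometry

  off : List ℕ → ℕ → Bool
  off []       a = true
  off (x ∷ xs) a = not (x ≡ᵇ a) ∧ off xs a

  occursᵇ : ℕ → List ℕ → Bool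
  occursᵇ a []       = false
  occursᵇ a (x ∷ xs) = (x ≡ᵇ a) ∨ occursᵇ a xs

  -- Bounds what a program writes by a list of arrays of naturals; a write to any array of reals is
  -- refused.
  within : Program → List ℕ → Bool
  within skip                  as = true
  within (a [ _ ]≔ᴺ _)         as = occursᵇ a as
  within (a [ _ ]≔ᴿ _)         as = false
  within (p ⨾ q)               as = within p as ∧ within q as
  within (ifᶜ _ then p else q) as = within p as ∧ within q as
  within (while _ loop p)      as = within p as

  pattern nᴬ = 0
  pattern outᴬ = 1
  pattern mᴬ = 2
  pattern tmpᴬ = 3
  pattern stepᴬ = 4
  pattern limitᴬ = 5
  pattern powᴬ = 6
  pattern weightᴬ = 7
  pattern groupᴬ = 8
  pattern bestᴬ = 9
  pattern countᴬ = 10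
  pattern choiceᴬ = 11
  pattern iᴬ = 12
  pattern jᴬ = 13
  pattern roundᴬ = 14
  pattern shiftᴬ = 15

  -- Arrays that programs take as a parameter lie above all others, so that
  -- comparing their names with literals computes.
  pattern paramᴬ b = suc (suc (suc (suc (suc (suc (suc (suc (suc (suc (suc (suc (suc (suc (suc (suc b)))))))))))))))

  pattern rowᴬ = paramᴬ 0
  pattern colᴬ = paramᴬ 1
  pattern halfᴬ = paramᴬ 2
  pattern stripᴬ = paramᴬ 3
  pattern valueᴬ = paramᴬ 4
  pattern tableᴬ j = paramᴬ (suc (suc (suc (suc (suc j)))))

  pattern xᴬ = 0
  pattern yᴬ = 1
  pattern zᴬ = 2

  -- Simultaneous update of the array v: all maxima are taken over old values.

  improve : NatExp → Cond → NatExp → Program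
  improve bound cond val =
    forᶜ jᴬ below bound loop
      (ifᶜ cond and (tmpᴬ [ var iᴬ ] ≤ᴺ val) then tmpᴬ [ var iᴬ ]≔ᴺ val else skip)

  relax₁ relax₂ relax : ℕ → NatExp → Cond → NatExp → Program
  relax₁ v bound cond val =
    forᶜ iᴬ below bound loop (tmpᴬ [ var iᴬ ]≔ᴺ lit 0 ⨾ improve bound cond val)
  relax₂ v bound cond val =
    forᶜ iᴬ below bound loop (v [ var iᴬ ]≔ᴺ tmpᴬ [ var iᴬ ])
  relax v bound cond val = relax₁ v bound cond val ⨾ relax₂ v bound cond val

  scratch : List ℕ
  scratch = tmpᴬ ∷ iᴬ ∷ jᴬ ∷ []

  module Pieces (ℝ : RealField) (B : ℕ) (64≤B : 64 ≤ B) where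
    open RealRAM ℝ
    open Finite
    open Execution ℝ B 64≤B
    open +-*-Solver using (solve; _:+_; _:*_; _:=_; con)

    ≡ᵇ-sym : ∀ a b → (a ≡ᵇ b) ≡ (b ≡ᵇ a)
    ≡ᵇ-sym zero    zero    = refl
    ≡ᵇ-sym zero    (suc b) = refl
    ≡ᵇ-sym (suc a) zero    = refl
    ≡ᵇ-sym (suc a) (suc b) = ≡ᵇ-sym a b

    off-occurs : ∀ as {x a} → T (occursᵇ x as) → T (off as a) → T (not (x ≡ᵇ a))
    off-occurs (y ∷ ys) {x} {a} o f with y ≡ᵇ x in e
    ... | false = off-occurs ys o (proj₂ (T-∧ (not (y ≡ᵇ a)) f))
    ... | true rewrite ≡ᵇ-true⁻ {y} {x} e = proj₁ (T-∧ (not (x ≡ᵇ a)) f)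

    within⇒keepsᴺ : ∀ p {as} → T (within p as) → ∀ a → T (off as a) → T (keepsᴺ p a)
    within⇒keepsᴺ skip w a f = tt
    within⇒keepsᴺ (x [ _ ]≔ᴺ _) {as} w a f = off-occurs as w f
    within⇒keepsᴺ (p ⨾ q) {as} w a f = let u , v = T-∧ (within p as) w in
      T-∧-intro (within⇒keepsᴺ p u a f) (within⇒keepsᴺ q v a f)
    within⇒keepsᴺ (ifᶜ _ then p else q) {as} w a f = let u , v = T-∧ (within p as) w in
      T-∧-intro (within⇒keepsᴺ p u a f) (within⇒keepsᴺ q v a f)
    within⇒keepsᴺ (while _ loop p) w a f = within⇒keepsᴺ p w a f

    within⇒keepsᴿ : ∀ p {as} → T (within p as) → ∀ a → T (keepsᴿ p a)
    within⇒keepsᴿ skip w a = tt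
    within⇒keepsᴿ (x [ _ ]≔ᴺ _) w a = tt
    within⇒keepsᴿ (p ⨾ q) {as} w a = let u , v = T-∧ (within p as) w in
      T-∧-intro (within⇒keepsᴿ p u a) (within⇒keepsᴿ q v a)
    within⇒keepsᴿ (ifᶜ _ then p else q) {as} w a = let u , v = T-∧ (within p as) w in
      T-∧-intro (within⇒keepsᴿ p u a) (within⇒keepsᴿ q v a)
    within⇒keepsᴿ (while _ loop p) w a = within⇒keepsᴿ p w a

    -- Unlike `Same` it does not mention a program, so it composes along a sequence of different
    -- programs.
    record SameOff (as : List ℕ) (σ τ : State) : Set where
      constructor sameOff
      field
        offᴺ : ∀ a {_ : T (off as a)} i → nats τ a i ≡ nats σ a i
        offᴿ : ∀ a i → reals τ a i ≡ reals σ a i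
    open SameOff public

    Same⇒SameOff : ∀ p {as σ τ} {_ : T (within p as)} → Same p σ τ → SameOff as σ τ
    Same⇒SameOff p {_} {_} {_} {w} (same n r) =
      sameOff (λ a {f} → n a {within⇒keepsᴺ p w a f}) (λ a → r a {within⇒keepsᴿ p w a})

    SameOff-trans : ∀ {as σ τ υ} → SameOff as σ τ → SameOff as τ υ → SameOff as σ υ
    SameOff-trans (sameOff n r) (sameOff n′ r′) =
      sameOff (λ a {f} i → trans (n′ a {f} i) (n a {f} i)) (λ a i → trans (r′ a i) (r a i))

    relaxation : (f : ℕ → ℕ → Bool) (g : ℕ → ℕ → ℕ) (A : ℕ) → ℕ → ℕ
    relaxation f g A a = maxTo A λ b → only (f a b) (g a b)

    -- `cond` and `val` may read `v` itself: up to the final copying only scratch arrays are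
    -- written, so it is enough to evaluate them in states that agree with `σ` elsewhere.
    relax-runs : ∀ {σ} v b {cond val} c d {A} f g → {_ : T (off scratch v)} {_ : T (off (v ∷ scratch) b)} →
      A ≤ B ^ d → costᶜ (cond and (tmpᴬ [ var iᴬ ] ≤ᴺ val)) ≤ B ^ c → 3 + costᴺ val ≤ B ^ c →
      nats σ b 0 ≡ A →
      (∀ τ i j → SameOff scratch σ τ → i < A → j < A → nats τ iᴬ 0 ≡ i → nats τ jᴬ 0 ≡ j →
        evalᶜ τ cond ≡ f i j × evalᴺ τ val ≡ g i j) →
      Runs (relax v (var b) cond val) σ (9 + (d + d + d + c + c))
        λ τ → ∀ a → a < A → nats τ v a ≡ relaxation f g A a
    relax-runs {σ} v b {cond} {val} c d {A} f g {v-off} {b-off} A≤ cost₁ cost₂ bound evals =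
      runs-weaken time-bound
        (runs-⨾ first λ τ sm done → second τ (Same⇒SameOff (relax₁ v (var b) cond val) {scratch} sm) done)
        λ _ _ h → h
      where
      h : ℕ → ℕ
      h = relaxation f g A
      b-off′ : T (off scratch b)
      b-off′ = proj₂ (T-∧ (not (v ≡ᵇ b)) b-off)

      Inner : ℕ → ℕ → State → Set
      Inner i j τ = (∀ a → a < i → nats τ tmpᴬ a ≡ h a) × nats τ tmpᴬ i ≡ maxTo j (λ b → only (f i b) (g i b))

      ∧-false : ∀ x → x ∧ false ≡ false
      ∧-false true  = refl
      ∧-false false = refl

      inner-step : ∀ i j τ → SameOff scratch σ τ → i < A → j < A → nats τ iᴬ 0 ≡ i → nats τ jᴬ 0 ≡ j → Inner i j τ →
        Runs (ifᶜ cond and (tmpᴬ [ var iᴬ ] ≤ᴺ val) then tmpᴬ [ var iᴬ ]≔ᴺ val else skip) τ (suc (c + (c + 1)))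
          λ τ′ → Inner i (suc j) (setᴺ τ′ jᴬ 0 (suc j))
      inner-step i j τ so i<A j<A vi vj (old , cur) with evals τ i j so i<A j<A vi vj
      ... | ec , ev = runs-if {c = c} {e = c + 1} cost₁ yes-case no-case
        where
        yes-case : evalᶜ τ cond ∧ (nats τ tmpᴬ (nats τ iᴬ 0) ≤ᵇ evalᴺ τ val) ≡ true → Runs (tmpᴬ [ var iᴬ ]≔ᴺ val) τ (c + 1) _
        yes-case t = runs-weaken (m≤m+n c 1)
          (runs-≔ᴺ {Q = λ τ′ → Inner i (suc j) (setᴺ τ′ jᴬ 0 (suc j))} cost₂ (keep , new)) λ _ _ h → h
          where
          test = ∧-elim {evalᶜ τ cond} t
          keep : ∀ a → a < i → write (nats τ) tmpᴬ (nats τ iᴬ 0) (evalᴺ τ val) tmpᴬ a ≡ h a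
          keep a a<i = trans (write-miss-at (nats τ) tmpᴬ vi (>⇒≢ a<i)) (old a a<i)
          new : write (nats τ) tmpᴬ (nats τ iᴬ 0) (evalᴺ τ val) tmpᴬ i ≡
                maxTo j (λ b → only (f i b) (g i b)) ⊔ only (f i j) (g i j)
          new = trans (write-hit (nats τ) tmpᴬ vi) (trans ev (sym
            (trans (cong (λ x → maxTo j (λ b → only (f i b) (g i b)) ⊔ only x (g i j)) (trans (sym ec) (proj₁ test)))
              (m≤n⇒m⊔n≡n (subst₂ _≤_ (trans (cong (nats τ tmpᴬ) vi) cur) ev (≤ᵇ-true⁻ (proj₂ test)))))))
        no-case : evalᶜ τ cond ∧ (nats τ tmpᴬ (nats τ iᴬ 0) ≤ᵇ evalᴺ τ val) ≡ false → Runs skip τ (c + 1) _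
        no-case t = runs-weaken (m≤n+m 1 c)
          (runs-skip {Q = λ τ′ → Inner i (suc j) (setᴺ τ′ jᴬ 0 (suc j))} (old , trans cur (sym stays))) λ _ _ h → h
          where
          stays : maxTo j (λ b → only (f i b) (g i b)) ⊔ only (f i j) (g i j) ≡ maxTo j (λ b → only (f i b) (g i b))
          stays with f i j | trans (cong (_∧ (nats τ tmpᴬ (nats τ iᴬ 0) ≤ᵇ evalᴺ τ val)) (sym ec)) t
          ... | false | _ = ⊔-identityʳ _
          ... | true  | e = m≥n⇒m⊔n≡m (<⇒≤ (subst₂ _<_ ev (trans (cong (nats τ tmpᴬ) vi) cur) (≤ᵇ-false⁻ e)))

      outer-step : ∀ i τ → SameOff scratch σ τ → i < A → nats τ iᴬ 0 ≡ i → (∀ a → a < i → nats τ tmpᴬ a ≡ h a) →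
        Runs (tmpᴬ [ var iᴬ ]≔ᴺ lit 0 ⨾ improve (var b) cond val) τ (suc (1 + suc (d + suc (c + (c + 1)))))
          λ τ′ → ∀ a → a < suc i → nats (setᴺ τ′ iᴬ 0 (suc i)) tmpᴬ a ≡ h a
      outer-step i τ so i<A vi old =
        runs-⨾ (runs-≔ᴺ {c = 1} {Q = λ τ′ → Inner i 0 τ′ × nats τ′ iᴬ 0 ≡ i} small (start , vi))
          λ τ′ sm (inn , vi′) →
            let so′ = SameOff-trans so (Same⇒SameOff (tmpᴬ [ var iᴬ ]≔ᴺ lit 0) {scratch} sm) in
            runs-weaken ≤-refl
              (runs-for A d _ (Inner i) A≤
                (λ τ″ sm′ → trans (offᴺ (Same⇒SameOff (improve (var b) cond val) {scratch} sm′) b {b-off′} 0)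
                                  (trans (offᴺ so′ b {b-off′} 0) bound))
                inn
                λ j τ″ j<A vj sm′ inn′ →
                  inner-step i j τ″ (SameOff-trans so′ (Same⇒SameOff (improve (var b) cond val) {scratch} sm′)) i<A j<A
                    (trans (sameᴺ sm′ iᴬ 0) vi′) vj inn′)
              λ τ″ _ (old′ , cur) a a<1+i → case m<1+n-cases a<1+i of λ where
                (inj₁ a<i)  → old′ a a<i
                (inj₂ refl) → cur
        where
        start : Inner i 0 (setᴺ τ tmpᴬ (nats τ iᴬ 0) 0)
        start = (λ a a<i → trans (write-miss-at (nats τ) tmpᴬ vi (>⇒≢ a<i)) (old a a<i)) , write-hit (nats τ) tmpᴬ vi

      first : Runs (relax₁ v (var b) cond val) σ (suc (d + suc (1 + suc (d + suc (c + (c + 1))))))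
                λ τ → ∀ a → a < A → nats τ tmpᴬ a ≡ h a
      first = runs-for A d _ (λ i τ → ∀ a → a < i → nats τ tmpᴬ a ≡ h a) A≤
        (λ τ sm → trans (offᴺ (Same⇒SameOff (relax₁ v (var b) cond val) {scratch} sm) b {b-off′} 0) bound)
        (λ _ ())
        λ i τ i<A vi sm old → outer-step i τ (Same⇒SameOff (relax₁ v (var b) cond val) {scratch} sm) i<A vi old

      tmp≢v : (v ≡ᵇ tmpᴬ) ≡ false
      tmp≢v = trans (≡ᵇ-sym v tmpᴬ) (T-not (proj₁ (T-∧ (not (tmpᴬ ≡ᵇ v)) v-off)))
      i≢v : (iᴬ ≡ᵇ v) ≡ false
      i≢v = T-not (proj₁ (T-∧ (not (iᴬ ≡ᵇ v)) (proj₂ (T-∧ (not (tmpᴬ ≡ᵇ v)) v-off))))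
      v-kept : T (not (v ≡ᵇ iᴬ))
      v-kept rewrite ≡ᵇ-sym v iᴬ | i≢v = tt

      second : ∀ τ → SameOff scratch σ τ → (∀ a → a < A → nats τ tmpᴬ a ≡ h a) →
        Runs (relax₂ v (var b) cond val) τ (suc (d + 1)) λ τ′ → ∀ a → a < A → nats τ′ v a ≡ h a
      second τ so done =
        runs-weaken ≤-refl
          (runs-for A d 1 {_} {v-kept} Copied A≤
            (λ τ′ sm → trans (sameᴺ sm b {b-kept} 0)
                             (trans (offᴺ so b {b-off′} 0) bound))
            ((λ _ ()) , done)
            step)
          λ _ _ → proj₁
        where
        b-off″ = T-∧ (not (tmpᴬ ≡ᵇ b)) b-off′
        i≢b = proj₁ (T-∧ (not (iᴬ ≡ᵇ b)) (proj₂ b-off″))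
        b-kept : T (keepsᴺ (relax₂ v (var b) cond val) b)
        b-kept = T-∧-intro i≢b (T-∧-intro (proj₁ (T-∧ (not (v ≡ᵇ b)) b-off)) i≢b)
        Copied : ℕ → State → Set
        Copied i τ = (∀ a → a < i → nats τ v a ≡ h a) × (∀ a → a < A → nats τ tmpᴬ a ≡ h a)
        step : ∀ i τ′ → i < A → nats τ′ iᴬ 0 ≡ i → _ → Copied i τ′ →
          Runs (v [ var iᴬ ]≔ᴺ tmpᴬ [ var iᴬ ]) τ′ 1 λ τ″ → Copied (suc i) (setᴺ τ″ iᴬ 0 (suc i))
        step i τ′ i<A vi sm (copied , source) =
          runs-≔ᴺ {Q = λ τ″ → Copied (suc i) (setᴺ τ″ iᴬ 0 (suc i))} small (here , there)
          where
          μ = write (nats τ′) v (nats τ′ iᴬ 0) (nats τ′ tmpᴬ (nats τ′ iᴬ 0))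
          here : ∀ a → a < suc i → write μ iᴬ 0 (suc i) v a ≡ h a
          here a a<1+i = trans (write-elsewhere μ iᴬ 0 (suc i) i≢v) (lemma (m<1+n-cases a<1+i))
            where
            lemma : a < i ⊎ a ≡ i → μ v a ≡ h a
            lemma (inj₁ a<i) = trans (write-miss-at (nats τ′) v vi (>⇒≢ a<i)) (copied a a<i)
            lemma (inj₂ refl) = trans (write-hit (nats τ′) v vi) (trans (cong (nats τ′ tmpᴬ) vi) (source i i<A))
          there : ∀ a → a < A → μ tmpᴬ a ≡ h a
          there a a<A = trans (write-elsewhere (nats τ′) v (nats τ′ iᴬ 0) _ tmp≢v) (source a a<A)

      time-bound : suc (suc (d + suc (1 + suc (d + suc (c + (c + 1))))) + suc (d + 1)) ≤ 9 + (d + d + d + c + c)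
      time-bound = ≤-reflexive (solve 2 (λ c d →
        con 1 :+ ((con 1 :+ (d :+ (con 1 :+ (con 1 :+ (con 1 :+ (d :+ (con 1 :+ (c :+ (c :+ con 1))))))))) :+
          (con 1 :+ (d :+ con 1))) := con 9 :+ (d :+ d :+ d :+ c :+ c)) refl c d)

  -- Preprocessing and decoding: layers, quotients, weights and bits.

  layering : ℕ → ℕ → Program
  layering b r = forᶜ roundᴬ below var mᴬ loop
    relax (paramᴬ b) (var mᴬ) (notᶜ (r [ var iᴬ ] ≤ᴿ r [ var jᴬ ] ⊕ oneᴿ)) (lit 1 ⊕ paramᴬ b [ var jᴬ ])

  -- Division by tabulation: moving on by `k` raises the quotient by one, that is, the entry by
  -- `step`. The first `k` entries keep their initial 0.
  multiples : ℕ → ℕ → NatExp → NatExp → Program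
  multiples b k bound step = forᶜ iᴬ below bound loop
    (paramᴬ b [ lit k ⊕ var iᴬ ]≔ᴺ step ⊕ paramᴬ b [ var iᴬ ])

  doubleItems : Program
  doubleItems = forᶜ iᴬ below var nᴬ loop
    (xᴬ [ var nᴬ ⊕ var iᴬ ]≔ᴿ xᴬ [ var iᴬ ] ⨾
     yᴬ [ var nᴬ ⊕ var iᴬ ]≔ᴿ yᴬ [ var iᴬ ] ⨾
     zᴬ [ var nᴬ ⊕ var iᴬ ]≔ᴿ oneᴿ ⊕ oneᴿ)

  powers : Program
  powers = powᴬ [ lit 0 ]≔ᴺ lit 1 ⨾
    forᶜ iᴬ below var nᴬ loop (powᴬ [ lit 1 ⊕ var iᴬ ]≔ᴺ powᴬ [ var iᴬ ] ⊕ powᴬ [ var iᴬ ])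

  weights : Program
  weights = forᶜ iᴬ below var nᴬ loop
    (weightᴬ [ var iᴬ ]≔ᴺ powᴬ [ var nᴬ ] ⊕ powᴬ [ var iᴬ ] ⨾
     weightᴬ [ var nᴬ ⊕ var iᴬ ]≔ᴺ powᴬ [ var nᴬ ] ⊕ powᴬ [ var iᴬ ])

  -- The first loop strips the multiples of `2 ^ n`, which count the chosen disks; `n` rounds
  -- suffice as there are at most `n` of them. The second reads the remaining bits from the highest
  -- down.
  decode : Program
  decode =
    forᶜ iᴬ below var nᴬ loop
      (ifᶜ powᴬ [ var nᴬ ] ≤ᴺ var bestᴬ then bestᴬ [ lit 0 ]≔ᴺ var bestᴬ ⊖ powᴬ [ var nᴬ ] else skip) ⨾
    forᶜ iᴬ below var nᴬ loop
      (ifᶜ powᴬ [ var nᴬ ⊖ (lit 1 ⊕ var iᴬ) ] ≤ᴺ var bestᴬ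
       then (outᴬ [ var nᴬ ⊖ (lit 1 ⊕ var iᴬ) ]≔ᴺ lit 1 ⨾
             bestᴬ [ lit 0 ]≔ᴺ var bestᴬ ⊖ powᴬ [ var nᴬ ⊖ (lit 1 ⊕ var iᴬ) ])
       else skip)

  module Preprocessing (ℝ : RealField) (B : ℕ) (64≤B : 64 ≤ B) where
    open RealField ℝ using (Carrier; 0#; 1#; orderedField) renaming (_+_ to _+ᴿ_; _≤?_ to _≤?ᴿ_)
    open RealRAM ℝ
    open Finite
    open Execution ℝ B 64≤B
    open Pieces ℝ B 64≤B

    -- Each round raises the array from `height ρ` to `height (suc ρ)`. For this invariant the
    -- update has to be simultaneous: with old and new values mixed, the array would match neither.
    layering-runs : ∀ {σ} b r {M} (y : ℕ → Carrier) → M ≤ B ^ 1 → nats σ mᴬ 0 ≡ M →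
      (∀ a → a < M → nats σ (paramᴬ b) a ≡ 0) → (∀ a → a < M → reals σ r a ≡ y a) →
      Runs (layering b r) σ 16 λ τ → ∀ a → a < M → nats τ (paramᴬ b) a ≡ Layers.layer orderedField M y a
    layering-runs {σ} b r {M} y M≤ m-is zeros y-is =
      runs-for M 1 14 (λ ρ τ → ∀ a → a < M → nats τ (paramᴬ b) a ≡ height ρ a) M≤
        (λ τ sm → trans (sameᴺ sm mᴬ 0) m-is)
        zeros
        λ ρ τ _ _ sm heights →
          relax-runs (paramᴬ b) mᴬ 1 1 (λ i j → below j i) (λ i j → suc (height ρ j)) M≤ small small
            (trans (sameᴺ sm mᴬ 0) m-is)
            λ τ′ i j so i<M j<M vi vj →
              cong not (cong₂ (λ u v → ⌊ u ≤?ᴿ (v +ᴿ 1#) ⌋)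
                (trans (offᴿ so r _) (trans (sameᴿ sm r {kr} _) (trans (cong (reals σ r) vi) (y-is i i<M))))
                (trans (offᴿ so r _) (trans (sameᴿ sm r {kr} _) (trans (cong (reals σ r) vj) (y-is j j<M))))) ,
              cong suc (trans (offᴺ so (paramᴬ b) _) (trans (cong (nats τ (paramᴬ b)) vj) (heights j j<M)))
      where
      open Layers orderedField M y
      kr : T (keepsᴿ (layering b r) r)
      kr = tt

    multiples-runs : ∀ {σ} b k {{_ : NonZero k}} {bound step} L d c → {_ : T (costᴺ bound ≤ᵇ 9)} {_ : T (costᴺ step ≤ᵇ 9)} →
      L ≤ B ^ d → (∀ a → nats σ (paramᴬ b) a ≡ 0) →
      (∀ τ → Same (multiples b k bound step) σ τ → evalᴺ τ bound ≡ L × evalᴺ τ step ≡ c) →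
      Runs (multiples b k bound step) σ (suc (d + 1)) λ τ → ∀ t → t < L + k → nats τ (paramᴬ b) t ≡ (t / k) * c
    multiples-runs {σ} b k {bound} {step} L d c {cb} {cs} L≤ zeros evals =
      runs-for L d 1 {cb} I L≤ (λ τ sm → proj₁ (evals τ sm)) start
        λ i τ i<L vi sm inv → runs-≔ᴺ {Q = λ τ′ → I (suc i) (setᴺ τ′ iᴬ 0 (suc i))} cost (update i τ vi (proj₂ (evals τ sm)) inv)
      where
      I : ℕ → State → Set
      I i τ = ∀ t → t < i + k → nats τ (paramᴬ b) t ≡ (t / k) * c
      start : ∀ t → t < k → nats σ (paramᴬ b) t ≡ (t / k) * c
      start t t<k = trans (zeros t) (cong (_* c) (sym (m<n⇒m/n≡0 t<k)))
      cost : suc (4 + suc (costᴺ step + 3)) ≤ B ^ 1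
      cost = ≤-trans (+-monoʳ-≤ 6 (+-monoˡ-≤ 3 (≤ᵇ⇒≤ (costᴺ step) 9 cs))) (small {18})
      update : ∀ i τ → nats τ iᴬ 0 ≡ i → evalᴺ τ step ≡ c → I i τ → ∀ t → t < suc (i + k) →
        write (nats τ) (paramᴬ b) (k + nats τ iᴬ 0) (evalᴺ τ step + nats τ (paramᴬ b) (nats τ iᴬ 0)) (paramᴬ b) t ≡ (t / k) * c
      update i τ vi vs inv t t< = case m<1+n-cases t< of λ where
        (inj₁ t<i+k) → trans (write-miss-at (nats τ) (paramᴬ b) (trans (cong (k +_) vi) (+-comm k i)) (>⇒≢ t<i+k)) (inv t t<i+k)
        (inj₂ refl)  → trans (write-hit (nats τ) (paramᴬ b) (trans (cong (k +_) vi) (+-comm k i)))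
          -- Since `k` is positive, entry `i` is among the first `i + k`, which are filled already.
          (trans (cong₂ _+_ vs (trans (cong (nats τ (paramᴬ b)) vi) (inv i (m<m+n i (>-nonZero⁻¹ k)))))
            (cong (_* c) (sym ([m+n]/n i k))))

    Appended : {A : Set} (n i : ℕ) (lo hi : ℕ → A) → (ℕ → A) → Set
    Appended n i lo hi m = (∀ j → j < n → m j ≡ lo j) × (∀ j → j < i → m (n + j) ≡ hi j)

    append-write : ∀ {A : Set} (m : Memory A) a {idx x n i} {lo hi : ℕ → A} → idx ≡ n + i → x ≡ hi i →
                   Appended n i lo hi (m a) → Appended n (suc i) lo hi (write m a idx x a)
    append-write m a {n = n} {i} refl refl (low , high) =
      (λ j j<n → trans (write-miss m a (>⇒≢ (≤-trans j<n (m≤m+n n i)))) (low j j<n)) ,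
      λ j j<1+i → case m<1+n-cases j<1+i of λ where
        (inj₁ j<i)  → trans (write-miss m a (λ e → <⇒≢ j<i (sym (+-cancelˡ-≡ n i j e)))) (high j j<i)
        (inj₂ refl) → write-hit m a refl

    record Doubled (n : ℕ) (σ τ : State) : Set where
      field
        x-doubled : Appended n n (reals σ xᴬ) (reals σ xᴬ) (reals τ xᴬ)
        y-doubled : Appended n n (reals σ yᴬ) (reals σ yᴬ) (reals τ yᴬ)
        z-doubled : Appended n n (reals σ zᴬ) (λ _ → 1# +ᴿ 1#) (reals τ zᴬ)

    doubleItems-runs : ∀ {σ n} → n ≤ B ^ 1 → nats σ nᴬ 0 ≡ n → Runs doubleItems σ 7 (Doubled n σ)
    doubleItems-runs {σ} {n} n≤ n-is =
      runs-weaken ≤-refl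
        (runs-for n 1 5 I n≤ (λ τ sm → trans (sameᴺ sm nᴬ 0) n-is)
          (((λ _ _ → refl) , λ _ ()) , ((λ _ _ → refl) , λ _ ()) , ((λ _ _ → refl) , λ _ ()))
          λ i τ i<n vi sm inv → body i τ i<n vi (trans (sameᴺ sm nᴬ 0) n-is) inv)
        λ τ _ (x , y , z) → record { x-doubled = x ; y-doubled = y ; z-doubled = z }
      where
      I : ℕ → State → Set
      I i τ = Appended n i (reals σ xᴬ) (reals σ xᴬ) (reals τ xᴬ) ×
              Appended n i (reals σ yᴬ) (reals σ yᴬ) (reals τ yᴬ) ×
              Appended n i (reals σ zᴬ) (λ _ → 1# +ᴿ 1#) (reals τ zᴬ)
      body : ∀ i τ → i < n → nats τ iᴬ 0 ≡ i → nats τ nᴬ 0 ≡ n → I i τ →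
        Runs (xᴬ [ var nᴬ ⊕ var iᴬ ]≔ᴿ xᴬ [ var iᴬ ] ⨾ yᴬ [ var nᴬ ⊕ var iᴬ ]≔ᴿ yᴬ [ var iᴬ ] ⨾
              zᴬ [ var nᴬ ⊕ var iᴬ ]≔ᴿ oneᴿ ⊕ oneᴿ) τ 5 λ τ′ → I (suc i) (setᴺ τ′ iᴬ 0 (suc i))
      body i τ i<n vi vn (x , y , z) =
        runs-⨾ {P = _≡_ _} (runs-≔ᴿ {c = 1} small refl) λ { _ _ refl →
        runs-⨾ {P = _≡_ _} (runs-≔ᴿ {c = 1} small refl) λ { _ _ refl →
        runs-≔ᴿ {c = 1} small
          ( append-write (reals τ) xᴬ (cong₂ _+_ vn vi) (trans (cong (reals τ xᴬ) vi) (proj₁ x i i<n)) x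
          , append-write (reals τ) yᴬ (cong₂ _+_ vn vi) (trans (cong (reals τ yᴬ) vi) (proj₁ y i i<n)) y
          , append-write (reals τ) zᴬ (cong₂ _+_ vn vi) refl z) } }

    powers-runs : ∀ {σ n} → n ≤ B ^ 1 → nats σ nᴬ 0 ≡ n →
      Runs powers σ 5 λ τ → ∀ i → i ≤ n → nats τ powᴬ i ≡ 2 ^ i
    powers-runs {σ} {n} n≤ n-is =
      runs-weaken ≤-refl
        (runs-⨾ {P = _≡_ _} (runs-≔ᴺ {c = 1} small refl) λ { _ _ refl →
          runs-for n 1 1 (λ i τ → ∀ j → j ≤ i → nats τ powᴬ j ≡ 2 ^ j) n≤
            (λ τ sm → trans (sameᴺ sm nᴬ 0) n-is)
            (λ { zero z≤n → refl })
            λ i τ i<n vi sm inv → runs-≔ᴺ {c = 1} small (update i τ vi inv) })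
        λ _ _ h → h
      where
      update : ∀ i τ → nats τ iᴬ 0 ≡ i → (∀ j → j ≤ i → nats τ powᴬ j ≡ 2 ^ j) → ∀ j → j ≤ suc i →
        write (nats τ) powᴬ (suc (nats τ iᴬ 0)) (nats τ powᴬ (nats τ iᴬ 0) + nats τ powᴬ (nats τ iᴬ 0)) powᴬ j ≡ 2 ^ j
      update i τ vi inv j j≤ with m<1+n-cases (s≤s j≤)
      ... | inj₁ j<1+i = trans (write-miss-at (nats τ) powᴬ (cong suc vi) (>⇒≢ j<1+i)) (inv j (≤-pred j<1+i))
      ... | inj₂ refl  = trans (write-hit (nats τ) powᴬ (cong suc vi))
                           (trans (cong₂ _+_ at-i at-i) (sym (Characteristic.2^-double i)))
        where
        at-i : nats τ powᴬ (nats τ iᴬ 0) ≡ 2 ^ i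
        at-i = trans (cong (nats τ powᴬ) vi) (inv i ≤-refl)

    record Weighted (n : ℕ) (w : ℕ → ℕ) : Set where
      field
        w-item : ∀ a → a < n + n → w a ≡ 2 ^ n + 2 ^ Weights.point n a
        w-none : ∀ a → n + n ≤ a → w a ≡ 0

    weights-runs : ∀ {σ n} → n ≤ B ^ 1 → nats σ nᴬ 0 ≡ n → (∀ i → i ≤ n → nats σ powᴬ i ≡ 2 ^ i) →
      (∀ a → nats σ weightᴬ a ≡ 0) → Runs weights σ 5 λ τ → Weighted n (nats τ weightᴬ)
    weights-runs {σ} {n} n≤ n-is pow-is zeros =
      runs-weaken ≤-refl
        (runs-for n 1 3 I n≤ (λ τ sm → trans (sameᴺ sm nᴬ 0) n-is)
          ((λ _ ()) , (λ _ ()) , λ a _ → zeros a)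
          λ i τ i<n vi sm inv →
            runs-⨾ {P = _≡_ _} (runs-≔ᴺ {c = 1} small refl) λ { _ _ refl →
            runs-≔ᴺ {c = 1} small (update i τ i<n vi (trans (sameᴺ sm nᴬ 0) n-is)
              (λ j j≤n → trans (sameᴺ sm powᴬ j) (pow-is j j≤n)) inv) })
        λ τ _ (low , high , none) → record { w-item = item τ low high ; w-none = none }
      where
      open Weights n
      I : ℕ → State → Set
      I i τ = (∀ j → j < i → nats τ weightᴬ j ≡ 2 ^ n + 2 ^ j) ×
              (∀ j → j < i → nats τ weightᴬ (n + j) ≡ 2 ^ n + 2 ^ j) ×
              (∀ a → n + n ≤ a → nats τ weightᴬ a ≡ 0)
      item : ∀ τ → (∀ j → j < n → nats τ weightᴬ j ≡ 2 ^ n + 2 ^ j) →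
             (∀ j → j < n → nats τ weightᴬ (n + j) ≡ 2 ^ n + 2 ^ j) →
             ∀ a → a < n + n → nats τ weightᴬ a ≡ 2 ^ n + 2 ^ point a
      item τ low high a a<2n with a <? n
      ... | yes a<n rewrite point-low a<n = low a a<n
      ... | no a≮n with m+[n∸m]≡n (≮⇒≥ a≮n)
      ... | e = subst (λ b → nats τ weightᴬ b ≡ 2 ^ n + 2 ^ point b) e
                  (trans (high (a ∸ n) (+-cancelˡ-< n (a ∸ n) n (subst (_< n + n) (sym e) a<2n)))
                         (cong (λ p → 2 ^ n + 2 ^ p) (sym (point-high (a ∸ n)))))
      update : ∀ i τ → i < n → nats τ iᴬ 0 ≡ i → nats τ nᴬ 0 ≡ n → (∀ j → j ≤ n → nats τ powᴬ j ≡ 2 ^ j) → I i τ →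
        let v = nats τ powᴬ (nats τ nᴬ 0) + nats τ powᴬ (nats τ iᴬ 0) in
        I (suc i) ⟪ write (write (nats τ) weightᴬ (nats τ iᴬ 0) v) weightᴬ (nats τ nᴬ 0 + nats τ iᴬ 0) v , reals τ ⟫
      update i τ i<n vi vn pow-is (low , high , none) = low′ , high′ , none′
        where
        idx = nats τ iᴬ 0
        v = nats τ powᴬ (nats τ nᴬ 0) + nats τ powᴬ idx
        v-is : v ≡ 2 ^ n + 2 ^ i
        v-is = cong₂ _+_ (trans (cong (nats τ powᴬ) vn) (pow-is n ≤-refl)) (trans (cong (nats τ powᴬ) vi) (pow-is i (<⇒≤ i<n)))
        μ = write (nats τ) weightᴬ idx v
        n+i : nats τ nᴬ 0 + idx ≡ n + i
        n+i = cong₂ _+_ vn vi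
        ν = write μ weightᴬ (nats τ nᴬ 0 + idx) v
        low′ : ∀ j → j < suc i → ν weightᴬ j ≡ 2 ^ n + 2 ^ j
        low′ j j< = trans (write-miss-at μ weightᴬ n+i (>⇒≢ (≤-trans (<-≤-trans j< i<n) (m≤m+n n i))))
          (case m<1+n-cases j< of λ where
            (inj₁ j<i)  → trans (write-miss-at (nats τ) weightᴬ vi (>⇒≢ j<i)) (low j j<i)
            (inj₂ refl) → trans (write-hit (nats τ) weightᴬ vi) v-is)
        high′ : ∀ j → j < suc i → ν weightᴬ (n + j) ≡ 2 ^ n + 2 ^ j
        high′ j j< = case m<1+n-cases j< of λ where
            (inj₁ j<i)  → trans (write-miss-at μ weightᴬ n+i (λ e → <⇒≢ j<i (sym (+-cancelˡ-≡ n i j e))))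
                            (trans (write-miss-at (nats τ) weightᴬ vi (<⇒≢ (<-≤-trans i<n (m≤m+n n j)))) (high j j<i))
            (inj₂ refl) → trans (write-hit μ weightᴬ n+i) v-is
        none′ : ∀ a → n + n ≤ a → ν weightᴬ a ≡ 0
        none′ a le = trans (write-miss-at μ weightᴬ n+i (<⇒≢ (<-≤-trans (+-monoʳ-< n i<n) le)))
                       (trans (write-miss-at (nats τ) weightᴬ vi (<⇒≢ (<-≤-trans i<n (≤-trans (m≤m+n n n) le)))) (none a le))

    module _ {σ : State} {n : ℕ} (n≤ : n ≤ B ^ 1) (n-is : nats σ nᴬ 0 ≡ n)
             (pow-is : ∀ i → i ≤ n → nats σ powᴬ i ≡ 2 ^ i)
             (χ : ℕ → Bool) (reduced : ℕ → ℕ) (best-is : nats σ bestᴬ 0 ≡ reduced 0)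
             (reduce-step : ∀ i → (if 2 ^ n ≤ᵇ reduced i then reduced i ∸ 2 ^ n else reduced i) ≡ reduced (suc i))
             (reduced-end : reduced n ≡ Characteristic.prefix χ n)
             (zeros : ∀ i → nats σ outᴬ i ≡ 0) where
      open Characteristic

      decode-runs : Runs decode σ 14 λ τ → ∀ i → i < n → (0 <ᵇ nats τ outᴬ i) ≡ χ i
      decode-runs =
        runs-weaken ≤-refl
          (runs-⨾ {d = 5}
            (runs-for n 1 3 (λ i τ → nats τ bestᴬ 0 ≡ reduced i) n≤ (λ τ sm → trans (sameᴺ sm nᴬ 0) n-is) best-is
              λ i τ i<n vi sm inv → strip i τ (trans (sameᴺ sm nᴬ 0) n-is)
                (λ j j≤n → trans (sameᴺ sm powᴬ j) (pow-is j j≤n)) inv)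
            λ τ sm best →
              runs-for n 1 6 I n≤ (λ τ′ sm′ → trans (sameᴺ sm′ nᴬ 0) (trans (sameᴺ sm nᴬ 0) n-is))
                (trans best reduced-end , (λ j _ → trans (sameᴺ sm outᴬ j) (zeros j)) , λ j j≥n j<n → ⊥-elim (<⇒≱ j<n j≥n))
                λ i τ′ i<n vi sm′ inv →
                  emit i τ′ i<n vi (trans (sameᴺ sm′ nᴬ 0) (trans (sameᴺ sm nᴬ 0) n-is))
                    (λ j j≤n → trans (sameᴺ sm′ powᴬ j) (trans (sameᴺ sm powᴬ j) (pow-is j j≤n))) inv)
          λ τ _ inv i i<n → proj₂ (proj₂ inv) i (≤-trans (≤-reflexive (n∸n≡0 n)) z≤n) i<n
        where
        I : ℕ → State → Set
        I i τ = nats τ bestᴬ 0 ≡ prefix χ (n ∸ i) × (∀ j → j < n ∸ i → nats τ outᴬ j ≡ 0) ×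
                (∀ j → n ∸ i ≤ j → j < n → (0 <ᵇ nats τ outᴬ j) ≡ χ j)
        strip : ∀ i τ → nats τ nᴬ 0 ≡ n → (∀ j → j ≤ n → nats τ powᴬ j ≡ 2 ^ j) → nats τ bestᴬ 0 ≡ reduced i →
          Runs (ifᶜ powᴬ [ var nᴬ ] ≤ᴺ var bestᴬ then bestᴬ [ lit 0 ]≔ᴺ var bestᴬ ⊖ powᴬ [ var nᴬ ] else skip) τ 3
            λ τ′ → nats (setᴺ τ′ iᴬ 0 (suc i)) bestᴬ 0 ≡ reduced (suc i)
        strip i τ vn pow b = runs-if {c = 1} {e = 1} small
          (λ t → runs-≔ᴺ {c = 1} small (trans (cong₂ _∸_ b p)
            (trans (cong (if_then reduced i ∸ 2 ^ n else reduced i) (sym (trans (sym test) t))) (reduce-step i))))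
          (λ t → runs-skip (trans b
            (trans (cong (if_then reduced i ∸ 2 ^ n else reduced i) (sym (trans (sym test) t))) (reduce-step i))))
          where
          p : nats τ powᴬ (nats τ nᴬ 0) ≡ 2 ^ n
          p = trans (cong (nats τ powᴬ) vn) (pow n ≤-refl)
          test : (nats τ powᴬ (nats τ nᴬ 0) ≤ᵇ nats τ bestᴬ 0) ≡ (2 ^ n ≤ᵇ reduced i)
          test = cong₂ _≤ᵇ_ p b
        emit : ∀ i τ → i < n → nats τ iᴬ 0 ≡ i → nats τ nᴬ 0 ≡ n → (∀ j → j ≤ n → nats τ powᴬ j ≡ 2 ^ j) → I i τ →
          Runs (ifᶜ powᴬ [ var nᴬ ⊖ (lit 1 ⊕ var iᴬ) ] ≤ᴺ var bestᴬ
                then (outᴬ [ var nᴬ ⊖ (lit 1 ⊕ var iᴬ) ]≔ᴺ lit 1 ⨾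
                      bestᴬ [ lit 0 ]≔ᴺ var bestᴬ ⊖ powᴬ [ var nᴬ ⊖ (lit 1 ⊕ var iᴬ) ])
                else skip) τ 6
            λ τ′ → I (suc i) (setᴺ τ′ iᴬ 0 (suc i))
        emit i τ i<n vi vn pow (b , blank , done) = runs-if {c = 1} {e = 4} small
          (λ t → runs-weaken (n≤1+n 3)
            (runs-⨾ {P = _≡_ _} (runs-≔ᴺ {c = 1} small refl) λ { _ _ refl → runs-≔ᴺ {c = 1} small (yes-case t) })
            λ _ _ h → h)
          (λ t → runs-weaken (s≤s z≤n) (runs-skip (no-case t)) λ _ _ h → h)
          where
          d = n ∸ suc i
          n∸i : n ∸ i ≡ suc d
          n∸i = trans (cong (_∸ i) (sym (m+[n∸m]≡n i<n))) (trans (cong (_∸ i) (sym (+-suc i d))) (m+n∸m≡n i (suc d)))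
          d<n : d < n
          d<n = subst (_≤ n) n∸i (m∸n≤m n i)
          idx : nats τ nᴬ 0 ∸ suc (nats τ iᴬ 0) ≡ d
          idx = cong₂ (λ u v → u ∸ suc v) vn vi
          p : nats τ powᴬ (nats τ nᴬ 0 ∸ suc (nats τ iᴬ 0)) ≡ 2 ^ d
          p = trans (cong (nats τ powᴬ) idx) (pow d (<⇒≤ d<n))
          b′ : nats τ bestᴬ 0 ≡ prefix χ (suc d)
          b′ = trans b (cong (prefix χ) n∸i)
          test : (nats τ powᴬ (nats τ nᴬ 0 ∸ suc (nats τ iᴬ 0)) ≤ᵇ nats τ bestᴬ 0) ≡ χ d
          test = trans (cong₂ _≤ᵇ_ p b′) (leading-bit χ d)
          blank′ : ∀ j → j < d → nats τ outᴬ j ≡ 0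
          blank′ j j<d = blank j (subst (j <_) (sym n∸i) (m<n⇒m<1+n j<d))
          done′ : ∀ j → suc d ≤ j → j < n → (0 <ᵇ nats τ outᴬ j) ≡ χ j
          done′ j d<j = done j (subst (_≤ j) (sym n∸i) d<j)
          no-case : _ → I (suc i) (setᴺ τ iᴬ 0 (suc i))
          no-case t = trans b′ rest , blank′ , filled
            where
            χd : χ d ≡ false
            χd = trans (sym test) t
            rest : prefix χ (suc d) ≡ prefix χ d
            rest rewrite χd = +-identityʳ _
            filled : ∀ j → d ≤ j → j < n → (0 <ᵇ nats τ outᴬ j) ≡ χ j
            filled j d≤j j<n with m≤n⇒m<n∨m≡n d≤j
            ... | inj₁ d<j  = done′ j d<j j<n
            ... | inj₂ refl = trans (cong (0 <ᵇ_) (blank d (subst (d <_) (sym n∸i) ≤-refl))) (sym χd)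
          yes-case : _ → I (suc i) (setᴺ (setᴺ (setᴺ τ outᴬ (nats τ nᴬ 0 ∸ suc (nats τ iᴬ 0)) 1) bestᴬ 0
                                      (nats τ bestᴬ 0 ∸ nats τ powᴬ (nats τ nᴬ 0 ∸ suc (nats τ iᴬ 0)))) iᴬ 0 (suc i))
          yes-case t = trans (cong₂ _∸_ b′ p) rest
                     , (λ j j<d → trans (write-miss-at (nats τ) outᴬ idx (>⇒≢ j<d)) (blank′ j j<d))
                     , filled
            where
            χd : χ d ≡ true
            χd = trans (sym test) t
            rest : prefix χ (suc d) ∸ 2 ^ d ≡ prefix χ d
            rest rewrite χd = m+n∸n≡m (prefix χ d) (2 ^ d)
            filled : ∀ j → d ≤ j → j < n →
              (0 <ᵇ write (nats τ) outᴬ (nats τ nᴬ 0 ∸ suc (nats τ iᴬ 0)) 1 outᴬ j) ≡ χ j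
            filled j d≤j j<n with m≤n⇒m<n∨m≡n d≤j
            ... | inj₁ d<j  = trans (cong (0 <ᵇ_) (write-miss-at (nats τ) outᴬ idx (<⇒≢ d<j))) (done′ j d<j j<n)
            ... | inj₂ refl = trans (cong (0 <ᵇ_) (write-hit (nats τ) outᴬ idx)) (sym χd)

  -- Tabulating all tuples of items.

  copyRow : ℕ → Program
  copyRow zero    = skip
  copyRow (suc j) = copyRow j ⨾ tableᴬ j [ var countᴬ ]≔ᴺ tableᴬ j [ var jᴬ ]

  addRow : ℕ → Program
  addRow j = copyRow j ⨾ tableᴬ j [ var countᴬ ]≔ᴺ var iᴬ ⨾ countᴬ [ lit 0 ]≔ᴺ lit 1 ⊕ var countᴬ

  addRows : ℕ → Program
  addRows j = forᶜ jᴬ below var tmpᴬ loop addRow j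

  -- Because `countᴬ` restarts at 0, the pass for value 0 rewrites the old rows in place; later
  -- passes append rows copied from these first ones.
  lengthen : ℕ → Program
  lengthen j = tmpᴬ [ lit 0 ]≔ᴺ var countᴬ ⨾ countᴬ [ lit 0 ]≔ᴺ lit 0 ⨾
    forᶜ iᴬ below lit 1 ⊕ var mᴬ loop addRows j

  tabulateTuples : ℕ → Program
  tabulateTuples zero    = countᴬ [ lit 0 ]≔ᴺ lit 1
  tabulateTuples (suc j) = tabulateTuples j ⨾ lengthen j

  module Tables (ℝ : RealField) (B : ℕ) (64≤B : 64 ≤ B) where
    open RealRAM ℝ
    open Finite
    open Execution ℝ B 64≤B

    -- Sequencing at the cost of one in the exponent. Adding exponents as `runs-⨾` does would make
    -- that of `tabulateTuples m` quadratic in `m`, too much for a running time with exponent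
    -- O(1/ε).
    runs-⨾-≤ : ∀ {p q σ e P Q} → Runs p σ e P → (∀ τ → Same p σ τ → P τ → Runs q τ e Q) → Runs (p ⨾ q) σ (suc e) Q
    runs-⨾-≤ {e = e} (runs x t h) k with k _ (frame x) h
    ... | runs y u h′ = runs (seq x y) (≤-trans (+-mono-≤ t u) twice) h′
      where
      twice : B ^ e + B ^ e ≤ B ^ suc e
      twice = ≤-trans (≤-reflexive (cong (B ^ e +_) (sym (+-identityʳ (B ^ e)))))
                (*-monoˡ-≤ (B ^ e) (≤-trans (s≤s (s≤s z≤n)) 64≤B))

    -- When the length of a program is a variable, `keepsᴺ` no longer computes, so the frame
    -- conditions are proved by induction.
    copyRow-keeps : ∀ j a → (∀ i → i < j → T (not (tableᴬ i ≡ᵇ a))) → T (keepsᴺ (copyRow j) a)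
    copyRow-keeps zero    a h = tt
    copyRow-keeps (suc j) a h = T-∧-intro (copyRow-keeps j a λ i i<j → h i (m<n⇒m<1+n i<j)) (h j ≤-refl)

    addRow-keeps : ∀ j a → (∀ i → T (not (tableᴬ i ≡ᵇ a))) → T (not (countᴬ ≡ᵇ a)) → T (keepsᴺ (addRow j) a)
    addRow-keeps j a h c = T-∧-intro (copyRow-keeps j a λ i _ → h i) (T-∧-intro (h j) c)

    addRows-keeps : ∀ j a → (∀ i → T (not (tableᴬ i ≡ᵇ a))) → T (not (countᴬ ≡ᵇ a)) → T (not (jᴬ ≡ᵇ a)) →
                    T (keepsᴺ (addRows j) a)
    addRows-keeps j a h c l = T-∧-intro l (T-∧-intro (addRow-keeps j a h c) l)

    lengthen-keeps : ∀ j a → (∀ i → T (not (tableᴬ i ≡ᵇ a))) → T (off (countᴬ ∷ jᴬ ∷ iᴬ ∷ tmpᴬ ∷ []) a) →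
                     T (keepsᴺ (lengthen j) a)
    lengthen-keeps j a h o with T-∧ (not (countᴬ ≡ᵇ a)) o
    ... | c , o₁ with T-∧ (not (jᴬ ≡ᵇ a)) o₁
    ... | l , o₂ with T-∧ (not (iᴬ ≡ᵇ a)) o₂
    ... | i , o₃ with T-∧ (not (tmpᴬ ≡ᵇ a)) o₃
    ... | t , _ = T-∧-intro t (T-∧-intro c (T-∧-intro i (T-∧-intro (addRows-keeps j a h c l) i)))

    tabulateTuples-keeps : ∀ m a → (∀ i → T (not (tableᴬ i ≡ᵇ a))) → T (off (countᴬ ∷ jᴬ ∷ iᴬ ∷ tmpᴬ ∷ []) a) →
                           T (keepsᴺ (tabulateTuples m) a)
    tabulateTuples-keeps zero    a h o = proj₁ (T-∧ (not (countᴬ ≡ᵇ a)) o)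
    tabulateTuples-keeps (suc j) a h o = T-∧-intro (tabulateTuples-keeps j a h o) (lengthen-keeps j a h o)

    copyRow-keepsᴿ : ∀ j a → T (keepsᴿ (copyRow j) a)
    copyRow-keepsᴿ zero    a = tt
    copyRow-keepsᴿ (suc j) a = T-∧-intro (copyRow-keepsᴿ j a) tt

    tabulateTuples-keepsᴿ : ∀ m a → T (keepsᴿ (tabulateTuples m) a)
    tabulateTuples-keepsᴿ zero    a = tt
    tabulateTuples-keepsᴿ (suc j) a =
      T-∧-intro (tabulateTuples-keepsᴿ j a) (T-∧-intro (T-∧-intro (T-∧-intro (copyRow-keepsᴿ j a) tt) tt) tt)

    tables-differ : ∀ {i j} → i ≢ j → T (not (tableᴬ i ≡ᵇ tableᴬ j))
    tables-differ {i} {j} i≢j rewrite ≡ᵇ-false i≢j = tt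

    record RowCopied (j p c : ℕ) (τ τ′ : State) : Set where
      field
        copied : ∀ i → i < j → nats τ′ (tableᴬ i) p ≡ nats τ (tableᴬ i) c
        others : ∀ i → i < j → ∀ x → p ≢ x → nats τ′ (tableᴬ i) x ≡ nats τ (tableᴬ i) x
    open RowCopied

    copyRow-runs : ∀ {τ} j {p c} → nats τ countᴬ 0 ≡ p → nats τ jᴬ 0 ≡ c →
                   Runs (copyRow j) τ (1 + j) (RowCopied j p c τ)
    copyRow-runs zero _ _ = runs-skip record { copied = λ _ () ; others = λ _ () }
    copyRow-runs {τ} (suc j) {p} {c} p-is c-is =
      runs-⨾-≤ (copyRow-runs j p-is c-is) λ τ₁ sm row →
        runs-weaken (s≤s z≤n) (runs-≔ᴺ {c = 1} small (final τ₁ sm row)) λ _ _ h → h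
      where
      final : ∀ τ₁ → Same (copyRow j) τ τ₁ → RowCopied j p c τ τ₁ →
        RowCopied (suc j) p c τ (setᴺ τ₁ (tableᴬ j) (nats τ₁ countᴬ 0) (nats τ₁ (tableᴬ j) (nats τ₁ jᴬ 0)))
      final τ₁ sm row = record
        { copied = λ i i< → case m<1+n-cases i< of λ where
            (inj₁ i<j) → trans (elsewhere (<⇒≢ i<j)) (copied row i i<j)
            (inj₂ refl) → trans (write-hit (nats τ₁) (tableᴬ j) p₁) (trans (cong (nats τ₁ (tableᴬ j)) c₁) (old c))
        ; others = λ i i< x p≢x → case m<1+n-cases i< of λ where
            (inj₁ i<j) → trans (elsewhere (<⇒≢ i<j)) (others row i i<j x p≢x)
            (inj₂ refl) → trans (write-miss-at (nats τ₁) (tableᴬ j) p₁ p≢x) (old x)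
        }
        where
        p₁ : nats τ₁ countᴬ 0 ≡ p
        p₁ = trans (sameᴺ sm countᴬ {copyRow-keeps j countᴬ λ _ _ → tt} 0) p-is
        c₁ : nats τ₁ jᴬ 0 ≡ c
        c₁ = trans (sameᴺ sm jᴬ {copyRow-keeps j jᴬ λ _ _ → tt} 0) c-is
        old : ∀ x → nats τ₁ (tableᴬ j) x ≡ nats τ (tableᴬ j) x
        old = sameᴺ sm (tableᴬ j) {copyRow-keeps j (tableᴬ j) λ i i<j → tables-differ (<⇒≢ i<j)}
        elsewhere : ∀ {i x} → i ≢ j →
          write (nats τ₁) (tableᴬ j) (nats τ₁ countᴬ 0) (nats τ₁ (tableᴬ j) (nats τ₁ jᴬ 0)) (tableᴬ i) x ≡ nats τ₁ (tableᴬ i) x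
        elsewhere i≢j = write-elsewhere (nats τ₁) (tableᴬ j) (nats τ₁ countᴬ 0) _ (≡ᵇ-false (i≢j ∘ sym))

    Tabulated : ℕ → ℕ → ℕ → State → Set
    Tabulated M m N σ = nats σ countᴬ 0 ≡ N ×
      (∀ (t : ℕ → ℕ) → (∀ i → i < m → t i ≤ M) → ∃[ c ] c < N × ∀ i → i < m → nats σ (tableᴬ i) c ≡ t i)

    -- Row c + N * v of the longer tuples is row c extended by v.
    module _ (j : ℕ) {N M : ℕ} (N≤ : N ≤ B ^ j) (M≤ : suc M ≤ B ^ 1) (σ : State) where

      record Filled (v c : ℕ) (τ : State) : Set where
        field
          count-is : nats τ countᴬ 0 ≡ c + N * v
          last     : ∀ v′ c′ → c′ < N → c′ + N * v′ < c + N * v → nats τ (tableᴬ j) (c′ + N * v′) ≡ v′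
          front    : ∀ v′ c′ → c′ < N → c′ + N * v′ < c + N * v →
                     ∀ i → i < j → nats τ (tableᴬ i) (c′ + N * v′) ≡ nats σ (tableᴬ i) c′
          original : ∀ i → i < j → ∀ c′ → c′ < N → nats τ (tableᴬ i) c′ ≡ nats σ (tableᴬ i) c′
      open Filled

      addRow-runs : ∀ v c τ → c < N → nats τ iᴬ 0 ≡ v → nats τ jᴬ 0 ≡ c → Filled v c τ →
        Runs (addRow j) τ (3 + j) λ τ′ → Filled v (suc c) (setᴺ τ′ jᴬ 0 (suc c))
      addRow-runs v c τ c<N vi vj F =
        runs-⨾-≤ (runs-weaken (n≤1+n (1 + j)) (copyRow-runs j (count-is F) vj) λ _ _ h → h) λ τ₁ sm row →
          runs-weaken (s≤s (s≤s z≤n))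
            (runs-⨾-≤ {e = 1} {P = _≡_ _} (runs-≔ᴺ {c = 1} small refl) λ { _ _ refl →
              runs-≔ᴺ {c = 1} small (final τ₁ sm row) })
            λ _ _ h → h
        where
        p = c + N * v
        final : ∀ τ₁ → Same (copyRow j) τ τ₁ → RowCopied j p c τ τ₁ →
          Filled v (suc c) (setᴺ (setᴺ (setᴺ τ₁ (tableᴬ j) (nats τ₁ countᴬ 0) (nats τ₁ iᴬ 0))
                                      countᴬ 0 (suc (nats τ₁ countᴬ 0))) jᴬ 0 (suc c))
        final τ₁ sm row = record
          { count-is = cong suc p₁
          ; last = λ v′ c′ c′<N lt → case m<1+n-cases lt of λ where
              (inj₁ lt′) → trans (write-miss-at (nats τ₁) (tableᴬ j) p₁ (>⇒≢ lt′))
                             (trans (sameᴺ sm (tableᴬ j) {copyRow-keeps j (tableᴬ j) λ i i<j → tables-differ (<⇒≢ i<j)} _)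
                                    (last F v′ c′ c′<N lt′))
              (inj₂ eq)  → trans (write-hit (nats τ₁) (tableᴬ j) (trans p₁ (sym eq)))
                             (trans v₁ (sym (proj₂ (digits-unique v′ v c′<N c<N eq))))
          ; front = λ v′ c′ c′<N lt i i<j → trans (elsewhere i<j) (case m<1+n-cases lt of λ where
              (inj₁ lt′) → trans (others row i i<j _ (>⇒≢ lt′)) (front F v′ c′ c′<N lt′ i i<j)
              (inj₂ eq)  → trans (cong (nats τ₁ (tableᴬ i)) eq) (trans (copied row i i<j)
                             (trans (original F i i<j c c<N)
                               (cong (nats σ (tableᴬ i)) (sym (proj₁ (digits-unique v′ v c′<N c<N eq)))))))
          ; original = λ i i<j c′ c′<N → trans (elsewhere i<j) (unchanged i i<j c′ c′<N)
          }
          where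
          p₁ : nats τ₁ countᴬ 0 ≡ p
          p₁ = trans (sameᴺ sm countᴬ {copyRow-keeps j countᴬ λ _ _ → tt} 0) (count-is F)
          v₁ : nats τ₁ iᴬ 0 ≡ v
          v₁ = trans (sameᴺ sm iᴬ {copyRow-keeps j iᴬ λ _ _ → tt} 0) vi
          elsewhere : ∀ {i x} → i < j →
            write (nats τ₁) (tableᴬ j) (nats τ₁ countᴬ 0) (nats τ₁ iᴬ 0) (tableᴬ i) x ≡ nats τ₁ (tableᴬ i) x
          elsewhere i<j = write-elsewhere (nats τ₁) (tableᴬ j) (nats τ₁ countᴬ 0) (nats τ₁ iᴬ 0) (≡ᵇ-false (>⇒≢ i<j))
          unchanged : ∀ i → i < j → ∀ c′ → c′ < N → nats τ₁ (tableᴬ i) c′ ≡ nats σ (tableᴬ i) c′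
          unchanged i i<j c′ c′<N with p ≟ c′
          ... | no p≢c′ = trans (others row i i<j c′ p≢c′) (original F i i<j c′ c′<N)
          -- The row being written is one of the original rows only in the pass for value 0, and
          -- then it is the row being copied.
          ... | yes eq  = trans (cong (nats τ₁ (tableᴬ i)) (sym eq)) (trans (copied row i i<j)
                            (trans (original F i i<j c c<N) (cong (nats σ (tableᴬ i))
                              (proj₁ (digits-unique v 0 c<N c′<N
                                (trans eq (trans (sym (+-identityʳ c′)) (cong (c′ +_) (sym (*-zeroʳ N))))))))))

      addRows-runs : ∀ v τ → nats τ tmpᴬ 0 ≡ N → nats τ iᴬ 0 ≡ v → Filled v 0 τ →
        Runs (addRows j) τ (4 + (j + j)) λ τ′ → Filled (suc v) 0 (setᴺ τ′ iᴬ 0 (suc v))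
      addRows-runs v τ t-is vi F =
        runs-weaken (≤-reflexive (cong suc (shape j)))
          (runs-for N j (3 + j) {_} {addRow-keeps j jᴬ (λ _ → tt) tt} (Filled v) N≤
            (λ τ′ sm → trans (sameᴺ sm tmpᴬ {addRows-keeps j tmpᴬ (λ _ → tt) tt tt} 0) t-is)
            record { count-is = count-is F ; last = last F ; front = front F ; original = original F }
            λ c τ′ c<N vj sm F′ → addRow-runs v c τ′ c<N (trans (sameᴺ sm iᴬ {addRows-keeps j iᴬ (λ _ → tt) tt tt} 0) vi) vj F′)
          λ τ′ _ F′ → record
            { count-is = trans (count-is F′) (sym (*-suc N v))
            ; last     = λ v′ c′ c′<N lt → last F′ v′ c′ c′<N (subst (c′ + N * v′ <_) (*-suc N v) lt)
            ; front    = λ v′ c′ c′<N lt → front F′ v′ c′ c′<N (subst (c′ + N * v′ <_) (*-suc N v) lt)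
            ; original = original F′ }
        where
        shape : ∀ j → j + (3 + j) ≡ 3 + (j + j)
        shape = solve 1 (λ j → j :+ (con 3 :+ j) := con 3 :+ (j :+ j)) refl
          where open +-*-Solver

      lengthen-runs : nats σ mᴬ 0 ≡ M → Tabulated M j N σ →
        Runs (lengthen j) σ (8 + (j + j)) (Tabulated M (suc j) (N * suc M))
      lengthen-runs m-is (count-N , tuples) =
        runs-weaken ≤-refl
          (runs-⨾-≤ {P = _≡_ _} (runs-weaken (s≤s z≤n) (runs-≔ᴺ {c = 1} small refl) λ _ _ h → h) λ { _ _ refl →
            runs-⨾-≤ {P = _≡_ _} (runs-weaken (s≤s z≤n) (runs-≔ᴺ {c = 1} small refl) λ _ _ h → h) λ { τ _ refl →
              runs-for (suc M) 1 (4 + (j + j)) {_} {addRows-keeps j iᴬ (λ _ → tt) tt tt} (λ v → Filled v 0) M≤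
                (λ τ′ sm → cong suc (trans (sameᴺ sm mᴬ {outer-keeps mᴬ (λ _ → tt) tt} 0) m-is))
                record { count-is = sym (*-zeroʳ N) ; last = λ v′ c′ _ lt → ⊥-elim (<⇒≱ lt (≤-trans (≤-reflexive (*-zeroʳ N)) z≤n))
                       ; front = λ v′ c′ _ lt → ⊥-elim (<⇒≱ lt (≤-trans (≤-reflexive (*-zeroʳ N)) z≤n))
                       ; original = λ _ _ _ _ → refl }
                λ v τ′ v<1+M vi sm F → addRows-runs v τ′
                  (trans (sameᴺ sm tmpᴬ {outer-keeps tmpᴬ (λ _ → tt) tt} 0) count-N) vi F } })
          λ τ _ F → count-is F , λ t t≤M →
            let c , c<N , eq = tuples t (λ i i<j → t≤M i (m<n⇒m<1+n i<j))
                tj = t≤M j ≤-refl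
                lt : c + N * t j < N * suc M
                lt = <-≤-trans (+-monoˡ-< (N * t j) c<N) (≤-trans (≤-reflexive (sym (*-suc N (t j)))) (*-monoʳ-≤ N (s≤s tj)))
            in c + N * t j , lt , λ i i< → case m<1+n-cases i< of λ where
                 (inj₁ i<j)  → trans (front F (t j) c c<N lt i i<j) (eq i i<j)
                 (inj₂ refl) → last F (t j) c c<N lt
        where
        outer-keeps : ∀ a → (∀ i → T (not (tableᴬ i ≡ᵇ a))) → T (off (countᴬ ∷ jᴬ ∷ iᴬ ∷ []) a) →
          T (keepsᴺ (forᶜ iᴬ below lit 1 ⊕ var mᴬ loop addRows j) a)
        outer-keeps a h o with T-∧ (not (countᴬ ≡ᵇ a)) o
        ... | c , o₁ with T-∧ (not (jᴬ ≡ᵇ a)) o₁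
        ... | l , o₂ with T-∧ (not (iᴬ ≡ᵇ a)) o₂
        ... | i , _ = T-∧-intro i (T-∧-intro (addRows-keeps j a h c l) i)

    tabulateTuples-runs : ∀ {σ M} m → suc M ≤ B ^ 1 → nats σ mᴬ 0 ≡ M →
      Runs (tabulateTuples m) σ (8 + (m + m)) (Tabulated M m (suc M ^ m))
    tabulateTuples-runs zero M≤ m-is =
      runs-weaken (s≤s z≤n) (runs-≔ᴺ {c = 1} small (refl , λ t _ → 0 , s≤s z≤n , λ _ ())) λ _ _ h → h
    tabulateTuples-runs {σ} {M} (suc j) M≤ m-is =
      runs-weaken (s≤s (≤-trans (+-monoʳ-≤ 8 (≤-reflexive refl)) (≤-trans (n≤1+n _) (≤-reflexive (shape j)))))
        (runs-⨾-≤ (tabulateTuples-runs j M≤ m-is) λ τ sm tab →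
          lengthen-runs j (N≤ j) M≤ τ (trans (sameᴺ sm mᴬ {tabulateTuples-keeps j mᴬ (λ _ → tt) tt} 0) m-is) tab)
        λ τ _ h → subst (λ N → Tabulated M (suc j) N τ) (*-comm (suc M ^ j) (suc M)) h
      where
      N≤ : ∀ j → suc M ^ j ≤ B ^ j
      N≤ j = ^-monoˡ-≤ j (subst (suc M ≤_) (*-identityʳ B) M≤)
      shape : ∀ j → 9 + (j + j) ≡ 7 + (suc j + suc j)
      shape = solve 1 (λ j → con 9 :+ (j :+ j) := con 7 :+ ((con 1 :+ j) :+ (con 1 :+ j))) refl
        where open +-*-Solver

  -- The dynamic program for one shift.

  allᶜ : ℕ → (ℕ → Cond) → Cond
  allᶜ zero    f = lit 0 ≤ᴺ lit 0
  allᶜ (suc n) f = f n and allᶜ n f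

  sumᴺ : ℕ → (ℕ → NatExp) → NatExp
  sumᴺ zero    f = lit 0
  sumᴺ (suc n) f = sumᴺ n f ⊕ f n

  entry : ℕ → ℕ → NatExp
  entry v j = tableᴬ j [ var v ]

  itemᶜ : NatExp → Cond
  itemᶜ d = lit 1 ⊕ d ≤ᴺ var mᴬ

  confᶜ : NatExp → NatExp → Cond
  confᶜ d d′ = (xᴬ [ d ] ⊖ xᴬ [ d′ ]) ⊗ (xᴬ [ d ] ⊖ xᴬ [ d′ ])
             ⊕ (yᴬ [ d ] ⊖ yᴬ [ d′ ]) ⊗ (yᴬ [ d ] ⊖ yᴬ [ d′ ])
             ⊕ (zᴬ [ d ] ⊖ zᴬ [ d′ ]) ⊗ (zᴬ [ d ] ⊖ zᴬ [ d′ ])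
             ≤ᴿ (oneᴿ ⊕ oneᴿ) ⊗ (oneᴿ ⊕ oneᴿ)

  clashᶜ : NatExp → NatExp → Cond
  clashᶜ d d′ = itemᶜ d and (itemᶜ d′ and confᶜ d d′)

  fitsᶜ : NatExp → Cond
  fitsᶜ d = notᶜ (itemᶜ d and notᶜ ((groupᴬ [ d ] ≤ᴺ var roundᴬ) and (var roundᴬ ≤ᴺ groupᴬ [ d ])))

  -- `m` is fixed together with the program, so quantifiers over the entries of a tuple are unrolled
  -- into one long condition.
  validᶜ compatibleᶜ : ℕ → Cond
  validᶜ m = allᶜ m λ j → fitsᶜ (entry iᴬ j) and allᶜ j λ j′ → notᶜ (clashᶜ (entry iᴬ j) (entry iᴬ j′))
  compatibleᶜ m = allᶜ m λ j → allᶜ m λ j′ → notᶜ (clashᶜ (entry iᴬ j) (entry jᴬ j′))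

  extendedValue : ℕ → NatExp
  extendedValue m = valueᴬ [ var jᴬ ] ⊕ sumᴺ m λ j → weightᴬ [ entry iᴬ j ]

  assignGroups : Program
  assignGroups = forᶜ iᴬ below var mᴬ loop
    (ifᶜ stripᴬ [ lit 2 ⊕ (rowᴬ [ var iᴬ ] ⊕ var shiftᴬ) ] ≤ᴺ stripᴬ [ rowᴬ [ var iᴬ ] ⊕ var shiftᴬ ]
     then groupᴬ [ var iᴬ ]≔ᴺ stripᴬ [ rowᴬ [ var iᴬ ] ⊕ var shiftᴬ ] ⊕ halfᴬ [ colᴬ [ var iᴬ ] ]
     else (groupᴬ [ var iᴬ ]≔ᴺ var limitᴬ))

  clearValues : Program
  clearValues = forᶜ iᴬ below var countᴬ loop (valueᴬ [ var iᴬ ]≔ᴺ lit 0)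

  processGroups : ℕ → Program
  processGroups m = forᶜ roundᴬ below var limitᴬ loop
    relax valueᴬ (var countᴬ) (validᶜ m and compatibleᶜ m) (extendedValue m)

  recordBest : Program
  recordBest = forᶜ iᴬ below var countᴬ loop
    (ifᶜ var bestᴬ ≤ᴺ valueᴬ [ var iᴬ ] then bestᴬ [ lit 0 ]≔ᴺ valueᴬ [ var iᴬ ] else skip)

  solveShift : ℕ → Program
  solveShift m = assignGroups ⨾ clearValues ⨾ processGroups m ⨾ recordBest

  module ShiftPrograms (ℝ : RealField) (B : ℕ) (64≤B : 64 ≤ B) where
    open RealField ℝ using (Carrier; 0#; 1#; orderedField)
    open RealRAM ℝ
    open Finite
    open Execution ℝ B 64≤B
    open Pieces ℝ B 64≤B

    module _ (X Y Z : ℕ → Carrier) where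
      open RealField ℝ using () renaming (_-_ to _-ᴿ_; _*_ to _*ᴿ_; _≤?_ to _≤?ᴿ_)
      open OrderedFieldProperties orderedField using (dist²; 2#)

      -- Unfolds to `conf` of `Items`, but mentions no set of disks.
      conflict : ℕ → ℕ → Bool
      conflict a b = ⌊ dist² (X a -ᴿ X b) (Y a -ᴿ Y b) (Z a -ᴿ Z b) ≤?ᴿ (2# *ᴿ 2#) ⌋

    eval-allᶜ : ∀ τ n f → evalᶜ τ (allᶜ n f) ≡ allTo n (λ j → evalᶜ τ (f j))
    eval-allᶜ τ zero    f = refl
    eval-allᶜ τ (suc n) f = cong (evalᶜ τ (f n) ∧_) (eval-allᶜ τ n f)

    eval-sumᴺ : ∀ τ n f → evalᴺ τ (sumᴺ n f) ≡ sumTo n (λ j → evalᴺ τ (f j))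
    eval-sumᴺ τ zero    f = refl
    eval-sumᴺ τ (suc n) f = cong (_+ evalᴺ τ (f n)) (eval-sumᴺ τ n f)

    -- Lengths of conditions depend on ε and are not bounded in terms of `n`. This crude bound
    -- charges them to the exponent, which remains linear in `m`.
    m≤B^m : ∀ m → m ≤ B ^ m
    m≤B^m m = ≤-trans (<⇒≤ (n<2^n m)) (^-monoˡ-≤ m (≤-trans (s≤s (s≤s z≤n)) 64≤B))

    cost-allᶜ : ∀ {n f} d c → n ≤ B ^ d → (∀ j → j < n → costᶜ (f j) ≤ B ^ c) → costᶜ (allᶜ n f) ≤ B ^ suc (d + c)
    cost-allᶜ {n} {f} d c n≤ h = ≤-trans (go n h)
      (≤-trans (≤-reflexive (shape n (B ^ c))) (B^-bilinear d c {3} {1} {0} {1} n≤ ≤-refl))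
      where
      go : ∀ n → (∀ j → j < n → costᶜ (f j) ≤ B ^ c) → costᶜ (allᶜ n f) ≤ 3 + n * suc (B ^ c)
      go zero    h = ≤-refl
      go (suc n) h = ≤-trans (s≤s (+-mono-≤ (h n ≤-refl) (go n λ j j<n → h j (m<n⇒m<1+n j<n))))
                             (≤-reflexive (shape′ (B ^ c) (n * suc (B ^ c))))
        where
        shape′ : ∀ x y → suc (x + (3 + y)) ≡ 3 + (suc x + y)
        shape′ = solve 2 (λ x y → con 1 :+ (x :+ (con 3 :+ y)) := con 3 :+ ((con 1 :+ x) :+ y)) refl
          where open +-*-Solver
      shape : ∀ x y → 3 + x * suc y ≡ 3 + 1 * x + 0 * y + 1 * (x * y)
      shape = solve 2 (λ x y → con 3 :+ x :* (con 1 :+ y) := con 3 :+ con 1 :* x :+ con 0 :* y :+ con 1 :* (x :* y)) refl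
        where open +-*-Solver

    small² : ∀ {c} {_ : T (c ≤ᵇ 4096)} → c ≤ B ^ 2
    small² {c} {ok} = ≤-trans (≤ᵇ⇒≤ c 4096 ok) (≤-trans (*-mono-≤ 64≤B 64≤B) (≤-reflexive (cong (B *_) (sym (*-identityʳ B)))))

    module _ (m : ℕ) where

      cost-valid : costᶜ (validᶜ m) ≤ B ^ (6 + (m + m))
      cost-valid = ≤-trans (cost-allᶜ m (5 + m) (m≤B^m m) λ j j<m →
          ≤-trans (B^-+ 1 (3 + m) small (≤-trans (cost-allᶜ m 2 (≤-trans (<⇒≤ j<m) (m≤B^m m)) λ _ _ → small²)
                                                 (≤-reflexive (cong (B ^_) (cong suc (+-comm m 2)))))) ≤-refl)
        (≤-reflexive (cong (B ^_) (shape m)))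
        where
        shape : ∀ m → suc (m + (5 + m)) ≡ 6 + (m + m)
        shape = solve 1 (λ m → con 1 :+ (m :+ (con 5 :+ m)) := con 6 :+ (m :+ m)) refl
          where open +-*-Solver

      cost-compatible : costᶜ (compatibleᶜ m) ≤ B ^ (4 + (m + m))
      cost-compatible = ≤-trans (cost-allᶜ m (3 + m) (m≤B^m m) λ j _ →
          ≤-trans (cost-allᶜ m 2 (m≤B^m m) λ _ _ → small²) (≤-reflexive (cong (B ^_) (cong suc (+-comm m 2)))))
        (≤-reflexive (cong (B ^_) (shape m)))
        where
        shape : ∀ m → suc (m + (3 + m)) ≡ 4 + (m + m)
        shape = solve 1 (λ m → con 1 :+ (m :+ (con 3 :+ m)) := con 4 :+ (m :+ m)) refl
          where open +-*-Solver

      cost-value : suc (3 + costᴺ (extendedValue m)) ≤ B ^ (1 + m)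
      cost-value = ≤-trans (≤-reflexive (cong (λ c → 8 + c) (cost-sum m)))
        (≤-trans (≤-reflexive (shape m)) (≤-trans (B^-bilinear m 0 {9} {5} {0} {0} (m≤B^m m) (≤-refl {1}))
          (≤-reflexive (cong (λ x → B ^ suc x) (+-identityʳ m)))))
        where
        cost-sum : ∀ n → costᴺ (sumᴺ n λ j → weightᴬ [ entry iᴬ j ]) ≡ 1 + 5 * n
        cost-sum zero    = refl
        cost-sum (suc n) = trans (cong (λ c → suc (c + 4)) (cost-sum n)) (step n)
          where
          step : ∀ n → suc (1 + 5 * n + 4) ≡ 1 + 5 * suc n
          step = solve 1 (λ n → con 1 :+ (con 1 :+ con 5 :* n :+ con 4) := con 1 :+ con 5 :* (con 1 :+ n)) refl
            where open +-*-Solver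
        shape : ∀ m → 8 + (1 + 5 * m) ≡ 9 + 5 * m + 0 + 0
        shape = solve 1 (λ m → con 8 :+ (con 1 :+ con 5 :* m) := con 9 :+ con 5 :* m :+ con 0 :+ con 0) refl
          where open +-*-Solver

      cost-step : costᶜ ((validᶜ m and compatibleᶜ m) and (tmpᴬ [ var iᴬ ] ≤ᴺ extendedValue m)) ≤ B ^ (13 + 5 * m)
      cost-step = ≤-trans (B^-+ (11 + 4 * m) (1 + m)
          (≤-trans (B^-+ (6 + (m + m)) (4 + (m + m)) cost-valid cost-compatible) (≤-reflexive (cong (B ^_) (shape m))))
          cost-value) (≤-reflexive (cong (B ^_) (shape′ m)))
        where
        open +-*-Solver
        shape : ∀ m → suc ((6 + (m + m)) + (4 + (m + m))) ≡ 11 + 4 * m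
        shape = solve 1 (λ m → con 1 :+ ((con 6 :+ (m :+ m)) :+ (con 4 :+ (m :+ m))) := con 11 :+ con 4 :* m) refl
        shape′ : ∀ m → suc ((11 + 4 * m) + (1 + m)) ≡ 13 + 5 * m
        shape′ = solve 1 (λ m → con 1 :+ ((con 11 :+ con 4 :* m) :+ (con 1 :+ m)) := con 13 :+ con 5 :* m) refl

    module _ (M m N : ℕ) (D : ℕ → ℕ → ℕ) (X Y Z : ℕ → Carrier) (w : ℕ → ℕ) where

      record Loaded (τ : State) : Set where
        field
          m-is      : nats τ mᴬ 0 ≡ M
          count-is  : nats τ countᴬ 0 ≡ N
          table-is  : ∀ j c → nats τ (tableᴬ j) c ≡ D j c
          weight-is : ∀ a → nats τ weightᴬ a ≡ w a
          x-is      : ∀ a → reals τ xᴬ a ≡ X a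
          y-is      : ∀ a → reals τ yᴬ a ≡ Y a
          z-is      : ∀ a → reals τ zᴬ a ≡ Z a

    module GroupPrograms (M m N : ℕ) (D : ℕ → ℕ → ℕ) (X Y Z : ℕ → Carrier) (w γ : ℕ → ℕ) where
      open DynamicProgram M m N D (conflict X Y Z) γ w
      open Loaded

      record Agrees (τ : State) : Set where
        field
          loaded   : Loaded M m N D X Y Z w τ
          group-is : ∀ a → nats τ groupᴬ a ≡ γ a
      open Agrees

      module _ {τ : State} (ag : Agrees τ) where

        eval-item : ∀ {e d} → evalᴺ τ e ≡ d → evalᶜ τ (itemᶜ e) ≡ item d
        eval-item eq = cong₂ (λ d M → suc d ≤ᵇ M) eq (m-is (loaded ag))

        eval-conf : ∀ {e d e′ d′} → evalᴺ τ e ≡ d → evalᴺ τ e′ ≡ d′ → evalᶜ τ (confᶜ e e′) ≡ conflict X Y Z d d′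
        eval-conf {e} {d} {e′} {d′} eq eq′
          rewrite eq | eq′
                | x-is (loaded ag) d | x-is (loaded ag) d′
                | y-is (loaded ag) d | y-is (loaded ag) d′
                | z-is (loaded ag) d | z-is (loaded ag) d′ = refl

        eval-clash : ∀ {e d e′ d′} → evalᴺ τ e ≡ d → evalᴺ τ e′ ≡ d′ → evalᶜ τ (clashᶜ e e′) ≡ clash d d′
        eval-clash {e} {_} {e′} eq eq′ =
          cong₂ _∧_ (eval-item {e} eq) (cong₂ _∧_ (eval-item {e′} eq′) (eval-conf {e} {_} {e′} eq eq′))

        eval-fits : ∀ {e d g} → evalᴺ τ e ≡ d → nats τ roundᴬ 0 ≡ g → evalᶜ τ (fitsᶜ e) ≡ fits g d
        eval-fits {e} {d} eq rd = cong₂ (λ a b → not (a ∧ not b)) (eval-item {e} eq)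
          (cong₂ _∧_ (cong₂ _≤ᵇ_ gr rd) (cong₂ _≤ᵇ_ rd gr))
          where
          gr : nats τ groupᴬ (evalᴺ τ e) ≡ γ d
          gr = trans (cong (nats τ groupᴬ) eq) (group-is ag d)

        eval-entry : ∀ {v c} j → nats τ v 0 ≡ c → evalᴺ τ (entry v j) ≡ D j c
        eval-entry {c = c} j eq = trans (cong (nats τ (tableᴬ j)) eq) (table-is (loaded ag) j c)

        eval-valid : ∀ {c g} → nats τ iᴬ 0 ≡ c → nats τ roundᴬ 0 ≡ g → evalᶜ τ (validᶜ m) ≡ valid g c
        eval-valid vi rd = trans (eval-allᶜ τ m _) (allTo-cong m λ j _ →
          cong₂ _∧_ (eval-fits {entry iᴬ j} (eval-entry j vi) rd)
            (trans (eval-allᶜ τ j _) (allTo-cong j λ j′ _ →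
              cong not (eval-clash {entry iᴬ j} {_} {entry iᴬ j′} (eval-entry j vi) (eval-entry j′ vi)))))

        eval-compatible : ∀ {c c′} → nats τ iᴬ 0 ≡ c → nats τ jᴬ 0 ≡ c′ → evalᶜ τ (compatibleᶜ m) ≡ compatible c c′
        eval-compatible vi vj = trans (eval-allᶜ τ m _) (allTo-cong m λ j _ →
          trans (eval-allᶜ τ m _) (allTo-cong m λ j′ _ →
            cong not (eval-clash {entry iᴬ j} {_} {entry jᴬ j′} (eval-entry j vi) (eval-entry j′ vj))))

        eval-weight : ∀ {c} → nats τ iᴬ 0 ≡ c → evalᴺ τ (sumᴺ m λ j → weightᴬ [ entry iᴬ j ]) ≡ weight c
        eval-weight vi = trans (eval-sumᴺ τ m _) (sumTo-cong m λ j _ →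
          trans (cong (nats τ weightᴬ) (eval-entry j vi)) (weight-is (loaded ag) _))

      processGroups-runs : ∀ {σ Γ} → N ≤ B ^ m → Γ ≤ B ^ 2 → Agrees σ → nats σ limitᴬ 0 ≡ Γ →
        (∀ c → c < N → nats σ valueᴬ c ≡ 0) →
        Runs (processGroups m) σ (38 + 13 * m) λ τ → ∀ c → c < N → nats τ valueᴬ c ≡ value Γ c
      processGroups-runs {σ} {Γ} N≤ Γ≤ ag₀ Γ-is zeros =
        runs-weaken (≤-reflexive (shape m))
          (runs-for Γ 2 _ (λ g τ → ∀ c → c < N → nats τ valueᴬ c ≡ value g c) Γ≤
            (λ τ sm → trans (sameᴺ sm limitᴬ 0) Γ-is) zeros
            λ g τ _ rd sm values →
              relax-runs valueᴬ countᴬ (13 + 5 * m) m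
                (λ c c′ → valid g c ∧ compatible c c′) (λ c c′ → value g c′ + weight c) N≤
                (cost-step m) (≤-trans (n≤1+n _) (≤-trans (cost-value m) (B^-mono (exp≤ m))))
                (trans (sameᴺ sm countᴬ 0) (count-is (loaded ag₀)))
                λ τ′ c c′ so c<N c′<N vi vj →
                  let ag = agrees sm so
                      rd′ = trans (offᴺ so roundᴬ 0) rd
                  in cong₂ _∧_ (eval-valid ag vi rd′) (eval-compatible ag vi vj) ,
                     cong₂ _+_ (trans (offᴺ so valueᴬ _) (trans (cong (nats τ valueᴬ) vj) (values c′ c′<N))) (eval-weight ag vi))
          λ _ _ h → h
        where
        agrees : ∀ {τ τ′} → Same (processGroups m) σ τ → SameOff scratch τ τ′ → Agrees τ′
        agrees sm so = record
          { loaded = record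
            { m-is      = trans (offᴺ so mᴬ 0) (trans (sameᴺ sm mᴬ 0) (m-is (loaded ag₀)))
            ; count-is  = trans (offᴺ so countᴬ 0) (trans (sameᴺ sm countᴬ 0) (count-is (loaded ag₀)))
            ; table-is  = λ j c → trans (offᴺ so (tableᴬ j) c) (trans (sameᴺ sm (tableᴬ j) c) (table-is (loaded ag₀) j c))
            ; weight-is = λ a → trans (offᴺ so weightᴬ a) (trans (sameᴺ sm weightᴬ a) (weight-is (loaded ag₀) a))
            ; x-is      = λ a → trans (offᴿ so xᴬ a) (trans (sameᴿ sm xᴬ a) (x-is (loaded ag₀) a))
            ; y-is      = λ a → trans (offᴿ so yᴬ a) (trans (sameᴿ sm yᴬ a) (y-is (loaded ag₀) a))
            ; z-is      = λ a → trans (offᴿ so zᴬ a) (trans (sameᴿ sm zᴬ a) (z-is (loaded ag₀) a)) }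
          ; group-is = λ a → trans (offᴺ so groupᴬ a) (trans (sameᴺ sm groupᴬ a) (group-is ag₀ a)) }
        exp≤ : ∀ m → 1 + m ≤ 13 + 5 * m
        exp≤ m = +-mono-≤ {1} {13} (s≤s z≤n) (m≤n*m m 5)
        shape : ∀ m → suc (2 + (9 + (m + m + m + (13 + 5 * m) + (13 + 5 * m)))) ≡ 38 + 13 * m
        shape = solve 1 (λ m → con 1 :+ (con 2 :+ (con 9 :+ (m :+ m :+ m :+ (con 13 :+ con 5 :* m) :+ (con 13 :+ con 5 :* m))))
                  := con 38 :+ con 13 :* m) refl
          where open +-*-Solver

    clearValues-runs : ∀ {σ N} d → N ≤ B ^ d → nats σ countᴬ 0 ≡ N →
      Runs clearValues σ (suc (d + 1)) λ τ → ∀ c → c < N → nats τ valueᴬ c ≡ 0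
    clearValues-runs {σ} {N} d N≤ N-is =
      runs-for N d 1 (λ i τ → ∀ c → c < i → nats τ valueᴬ c ≡ 0) N≤ (λ τ sm → trans (sameᴺ sm countᴬ 0) N-is) (λ _ ())
        λ i τ _ vi _ inv → runs-≔ᴺ {c = 1} small λ c c< → case m<1+n-cases c< of λ where
          (inj₁ c<i)  → trans (write-miss-at (nats τ) valueᴬ vi (>⇒≢ c<i)) (inv c c<i)
          (inj₂ refl) → write-hit (nats τ) valueᴬ vi

    recordBest-runs : ∀ {σ N} d → N ≤ B ^ d → nats σ countᴬ 0 ≡ N →
      Runs recordBest σ (suc (d + 3)) λ τ → nats τ bestᴬ 0 ≡ nats σ bestᴬ 0 ⊔ maxTo N (nats σ valueᴬ)
    recordBest-runs {σ} {N} d N≤ N-is =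
      runs-for N d 3 (λ i τ → nats τ bestᴬ 0 ≡ nats σ bestᴬ 0 ⊔ maxTo i (nats σ valueᴬ)) N≤
        (λ τ sm → trans (sameᴺ sm countᴬ 0) N-is) (sym (⊔-identityʳ _))
        λ i τ _ vi sm inv →
          let v : nats τ valueᴬ (nats τ iᴬ 0) ≡ nats σ valueᴬ i
              v = trans (cong (nats τ valueᴬ) vi) (sameᴺ sm valueᴬ i)
          in runs-if {c = 1} {e = 1} small
            (λ t → runs-≔ᴺ {c = 1} small (trans v (trans
              (sym (m≤n⇒m⊔n≡n (subst₂ _≤_ inv v (≤ᵇ-true⁻ t)))) (⊔-assoc (nats σ bestᴬ 0) _ _))))
            (λ t → runs-skip (trans inv (trans
              (sym (m≥n⇒m⊔n≡m (<⇒≤ (subst₂ _<_ v inv (≤ᵇ-false⁻ t))))) (⊔-assoc (nats σ bestᴬ 0) _ _))))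

    module _ (M k : ℕ) {{k≢0 : NonZero k}} (row col : ℕ → ℕ)
             (m N : ℕ) (D : ℕ → ℕ → ℕ) (X Y Z : ℕ → Carrier) (w : ℕ → ℕ) where
      open Groups M k row col

      record Prepared (σ : State) : Set where
        field
          loaded   : Loaded M m N D X Y Z w σ
          limit-is : nats σ limitᴬ 0 ≡ Γ
          row-is   : ∀ a → a < M → nats σ rowᴬ a ≡ row a
          col-is   : ∀ a → a < M → nats σ colᴬ a ≡ col a
          half-is  : ∀ t → t ≤ M → nats σ halfᴬ t ≡ t / 2
          strip-is : ∀ t → t < suc (suc (M + k)) → nats σ stripᴬ t ≡ strip t
      -- The array of groups is known only below `M`. The recursion is therefore stated for its
      -- actual contents `γ`, which agree with `group s` on items.
      record Solved (s : ℕ) (σ τ : State) : Set where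
        field
          γ        : ℕ → ℕ
          γ-is     : ∀ a → a < M → γ a ≡ group s a
          best-new : nats τ bestᴬ 0 ≡
                     nats σ bestᴬ 0 ⊔ maxTo N (DynamicProgram.value M m N D (conflict X Y Z) γ w Γ)

    module _ {M k : ℕ} {{k≢0 : NonZero k}} {row col : ℕ → ℕ}
             (row≤ : ∀ a → row a ≤ M) (col≤ : ∀ a → col a ≤ M)
             {m N : ℕ} {D : ℕ → ℕ → ℕ} {X Y Z : ℕ → Carrier} {w : ℕ → ℕ} where
      open Groups M k row col
      open Loaded
      open Prepared

      assignGroups-runs : ∀ {σ s} → M ≤ B ^ 1 → s < k → nats σ shiftᴬ 0 ≡ s → Prepared M k row col m N D X Y Z w σ →
        Runs assignGroups σ 5 λ τ → ∀ a → a < M → nats τ groupᴬ a ≡ group s a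
      assignGroups-runs {σ} {s} M≤ s<k s-is P =
        runs-for M 1 3 (λ i τ → ∀ a → a < i → nats τ groupᴬ a ≡ group s a) M≤
          (λ τ sm → trans (sameᴺ sm mᴬ 0) (m-is (loaded P))) (λ _ ())
          λ i τ i<M vi sm inv →
            let ri : nats τ rowᴬ (nats τ iᴬ 0) + nats τ shiftᴬ 0 ≡ row i + s
                ri = cong₂ _+_ (trans (cong (nats τ rowᴬ) vi) (trans (sameᴺ sm rowᴬ i) (row-is P i i<M)))
                               (trans (sameᴺ sm shiftᴬ 0) s-is)
                hi : nats τ halfᴬ (nats τ colᴬ (nats τ iᴬ 0)) ≡ col i / 2
                hi = trans (cong (nats τ halfᴬ) (trans (cong (nats τ colᴬ) vi) (trans (sameᴺ sm colᴬ i) (col-is P i i<M))))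
                       (trans (sameᴺ sm halfᴬ _) (half-is P _ (col≤ i)))
                r≤ : row i + s ≤ M + k
                r≤ = +-mono-≤ (row≤ i) (<⇒≤ s<k)
                -- Strictness of `s < k` is used here: looking two rows ahead reaches index
                -- `M + k + 1` at most, the last one tabulated.
                r< : suc (row i + s) ≤ M + k
                r< = ≤-trans (≤-reflexive (sym (+-suc (row i) s))) (+-mono-≤ (row≤ i) s<k)
                st : nats τ stripᴬ (nats τ rowᴬ (nats τ iᴬ 0) + nats τ shiftᴬ 0) ≡ strip (row i + s)
                st = trans (cong (nats τ stripᴬ) ri) (trans (sameᴺ sm stripᴬ _) (strip-is P _ (s≤s (≤-trans r≤ (n≤1+n _)))))
                st₂ : nats τ stripᴬ (2 + (nats τ rowᴬ (nats τ iᴬ 0) + nats τ shiftᴬ 0)) ≡ strip (2 + (row i + s))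
                st₂ = trans (cong (λ x → nats τ stripᴬ (2 + x)) ri) (trans (sameᴺ sm stripᴬ _) (strip-is P _ (s≤s (s≤s r<))))
                test = cong₂ _≤ᵇ_ st₂ st
            in runs-if {c = 1} {e = 1} small
              (λ t → runs-≔ᴺ {c = 1} small (update i τ vi inv (trans (cong₂ _+_ st hi)
                (sym (group-alive {s} {i} (trans (sym test) t))))))
              (λ t → runs-≔ᴺ {c = 1} small (update i τ vi inv (trans (sameᴺ sm limitᴬ 0) (trans (limit-is P)
                (cong (if_then strip (row i + s) + col i / 2 else Γ) (sym (trans (sym test) t)))))))
        where
        update : ∀ i τ {x} → nats τ iᴬ 0 ≡ i → (∀ a → a < i → nats τ groupᴬ a ≡ group s a) → x ≡ group s i →
          ∀ a → a < suc i → write (nats τ) groupᴬ (nats τ iᴬ 0) x groupᴬ a ≡ group s a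
        update i τ vi inv x≡ a a< = case m<1+n-cases a< of λ where
          (inj₁ a<i)  → trans (write-miss-at (nats τ) groupᴬ vi (>⇒≢ a<i)) (inv a a<i)
          (inj₂ refl) → trans (write-hit (nats τ) groupᴬ vi) x≡

      solveShift-runs : ∀ {σ s} → M ≤ B ^ 1 → N ≤ B ^ m → Γ ≤ B ^ 2 → s < k → nats σ shiftᴬ 0 ≡ s → Prepared M k row col m N D X Y Z w σ →
        Runs (solveShift m) σ (52 + 15 * m) (Solved M k row col m N D X Y Z w s σ)
      solveShift-runs {σ} {s} M≤ N≤ Γ≤ s<k s-is P =
        runs-weaken (≤-reflexive (shape m))
          (runs-⨾ (assignGroups-runs M≤ s<k s-is P) λ τ₁ sm₁ groups →
           runs-⨾ (clearValues-runs m N≤ (trans (sameᴺ sm₁ countᴬ 0) (count-is (loaded P)))) λ τ₂ sm₂ zeros →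
           runs-⨾ (GroupPrograms.processGroups-runs M m N D X Y Z w (nats τ₂ groupᴬ) N≤ Γ≤
                    (record { loaded = after sm₁ sm₂ (loaded P) ; group-is = λ _ → refl })
                    (trans (sameᴺ sm₂ limitᴬ 0) (trans (sameᴺ sm₁ limitᴬ 0) (limit-is P))) zeros) λ τ₃ sm₃ values →
           runs-weaken ≤-refl (recordBest-runs m N≤
                    (trans (sameᴺ sm₃ countᴬ 0) (count-is (after sm₁ sm₂ (loaded P)))))
             λ τ₄ _ best → record
               { γ = nats τ₂ groupᴬ
               ; γ-is = λ a a<M → trans (sameᴺ sm₂ groupᴬ a) (groups a a<M)
               ; best-new = trans best (cong₂ _⊔_
                   (trans (sameᴺ sm₃ bestᴬ 0) (trans (sameᴺ sm₂ bestᴬ 0) (sameᴺ sm₁ bestᴬ 0)))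
                   (maxTo-cong N values)) })
          λ _ _ h → h
        where
        after : ∀ {τ₁ τ₂} → Same assignGroups σ τ₁ → Same clearValues τ₁ τ₂ →
                Loaded M m N D X Y Z w σ → Loaded M m N D X Y Z w τ₂
        after sm₁ sm₂ l = record
          { m-is      = trans (sameᴺ sm₂ mᴬ 0) (trans (sameᴺ sm₁ mᴬ 0) (m-is l))
          ; count-is  = trans (sameᴺ sm₂ countᴬ 0) (trans (sameᴺ sm₁ countᴬ 0) (count-is l))
          ; table-is  = λ j c → trans (sameᴺ sm₂ (tableᴬ j) c) (trans (sameᴺ sm₁ (tableᴬ j) c) (table-is l j c))
          ; weight-is = λ a → trans (sameᴺ sm₂ weightᴬ a) (trans (sameᴺ sm₁ weightᴬ a) (weight-is l a))
          ; x-is      = λ a → trans (sameᴿ sm₂ xᴬ a) (trans (sameᴿ sm₁ xᴬ a) (x-is l a))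
          ; y-is      = λ a → trans (sameᴿ sm₂ yᴬ a) (trans (sameᴿ sm₁ yᴬ a) (y-is l a))
          ; z-is      = λ a → trans (sameᴿ sm₂ zᴬ a) (trans (sameᴿ sm₁ zᴬ a) (z-is l a)) }
        shape : ∀ m → suc (5 + suc (suc (m + 1) + suc ((38 + 13 * m) + suc (m + 3)))) ≡ 52 + 15 * m
        shape = solve 1 (λ m → con 1 :+ (con 5 :+ (con 1 :+ ((con 1 :+ (m :+ con 1)) :+ (con 1 :+ ((con 38 :+ con 13 :* m) :+ (con 1 :+ (m :+ con 3)))))))
                  := con 52 :+ con 15 :* m) refl
          where open +-*-Solver

  -- Quality of the best value over all shifts.

  module Analysis (ℝ : RealField) {n : ℕ} (S : MBS.DiskSet ℝ n) (X Y Z : ℕ → RealField.Carrier ℝ)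
    (X≡ : ∀ {a} → a < n + n → X a ≡ MBS.coordinate ℝ S proj₁ (Weights.point n a))
    (Y≡ : ∀ {a} → a < n + n → Y a ≡ MBS.coordinate ℝ S proj₂ (Weights.point n a))
    (Z≡ : ∀ {a} → a < n + n → Z a ≡ (if suc a ≤ᵇ n then RealField.0# ℝ
                                     else OrderedFieldProperties.2# (RealField.orderedField ℝ)))
    (k : ℕ) {{k≢0 : NonZero k}} (w : ℕ → ℕ)
    (w-item : ∀ a → a < n + n → w a ≡ 2 ^ n + 2 ^ Weights.point n a) (w-none : ∀ a → n + n ≤ a → w a ≡ 0)
    (N : ℕ) (D : ℕ → ℕ → ℕ)
    (tabulated : ∀ (t : ℕ → ℕ) → (∀ j → j < k * 4 → t j ≤ n + n) → ∃[ c ] c < N × ∀ j → j < k * 4 → D j c ≡ t j)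
    where
    open MBS ℝ
    open Items ℝ S X Y Z
    open Weights n
    open Finite
    open Characteristic
    open Shifting M k row col colour row≤ col≤ colour<2

    IndependentSet : (ℕ → Bool) → Set
    IndependentSet U = ∀ {a b} → a < M → b < M → U a ≡ true → U b ≡ true → a ≢ b → conf a b ≡ false

    -- The final value has to satisfy two demands: an independent list attains it, so that it can be
    -- decoded, and for every shift it is at least the weight that survives of any independent set,
    -- which is `Covers`.
    Achieved : ℕ → Set
    Achieved v = ∃[ L ] (All (_< M) L × AllPairs (λ a b → conf a b ≡ false) L) × sum (map w L) ≡ v

    Covers : ℕ → ℕ → Set
    Covers s v = ∀ U → IndependentSet U → sumTo M (λ a → only (U a ∧ alive s a) (w a)) ≤ v

    module _ {s : ℕ} (s<k : s < k) (γ : ℕ → ℕ) (γ-is : ∀ a → a < M → γ a ≡ group s a) where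
      open DynamicProgram M (k * 4) N D conf γ w

      group< : ∀ {a} → a < M → γ a < Γ → group s a < Γ
      group< {a} a<M = subst (_< Γ) (γ-is a a<M)

      near : ∀ {a b} → a < M → b < M → γ a < Γ → γ b < Γ → conf a b ≡ true → γ a ≤ suc (γ b)
      near {a} {b} a<M b<M γa γb h = subst₂ (λ x y → x ≤ suc y) (sym (γ-is a a<M)) (sym (γ-is b b<M))
        (group-near {s} {a} {b} (group< a<M γa) (group< b<M γb)
          (conf-rows X≡ Y≡ Z≡ b<M h) (conf-rows X≡ Y≡ Z≡ a<M (conf-sym X≡ Y≡ Z≡ {a} {b} h)) (conf-cols X≡ Y≡ Z≡ b<M h))

      value-achieved : ∀ c → Achieved (value Γ c)
      value-achieved c = chosen , independent , total
        where open Soundness.Witness (Soundness.value-sound w-none Γ near Γ c ≤-refl)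

      -- Distinct members of an independent set never share group and slot: they would agree in row,
      -- column and colour and thus conflict. So completeness of the dynamic program applies.
      values-cover : Covers s (maxTo N (value Γ))
      values-cover U indep = ≤-trans (sumTo-mono M alive≤)
        (let c , c<N , _ , le = value-complete Γ ≤-refl in ≤-trans le (maxTo-upper (value Γ) c<N))
        where
        slot-separates : ∀ {a b} → a < M → b < M → U a ≡ true → U b ≡ true → γ a < Γ → γ a ≡ γ b →
                         slot s a ≡ slot s b → a ≡ b
        slot-separates {a} {b} a<M b<M ua ub γa eq same-slot with a ≟ b
        ... | yes e = e
        ... | no ne =
          let r , c , z = slot-group-injective {s} {a} {b} (group< a<M γa)
                            (trans (sym (γ-is a a<M)) (trans eq (γ-is b b<M))) same-slot
          in true≢false (conf-clique X≡ Y≡ Z≡ a<M b<M r c z) (indep a<M b<M ua ub ne)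
        open Completeness tabulated Γ U indep (slot s) (λ {a} _ → slot< s a) slot-separates
        alive≤ : ∀ a → a < M → only (U a ∧ alive s a) (w a) ≤ only (U a ∧ (suc (γ a) ≤ᵇ Γ)) (w a)
        alive≤ a a<M with U a | alive s a in al
        ... | false | _     = z≤n
        ... | true  | false = z≤n
        ... | true  | true
          rewrite ≤ᵇ-true {suc (γ a)} {Γ} (subst (_< Γ) (sym (γ-is a a<M)) (alive⇒group<Γ {s} {a} s<k al)) = ≤-refl

      new-best : ∀ {b} → Achieved b → Achieved (b ⊔ maxTo N (value Γ))
      new-best {b} old with ≤-total b (maxTo N (value Γ)) | maxTo-attained N (value Γ)
      ... | inj₂ ge | _ = subst Achieved (sym (m≥n⇒m⊔n≡m ge)) old
      ... | inj₁ le | inj₁ e = subst Achieved (sym (m≥n⇒m⊔n≡m (≤-trans (≤-reflexive e) z≤n))) old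
      ... | inj₁ le | inj₂ (c , _ , e) = subst Achieved (sym (trans (m≤n⇒m⊔n≡n le) e)) (value-achieved c)

    nothing-achieved : Achieved 0
    nothing-achieved = [] , ([] , []) , refl

    module _ {v : ℕ} (achieved : Achieved v) (covers : ∀ s → s < k → Covers s v) where

      L = proj₁ achieved
      L< = proj₁ (proj₁ (proj₂ achieved))
      L-independent = proj₂ (proj₁ (proj₂ achieved))

      open Decode w w-item L L< (points-apart X≡ Y≡ Z≡ L L< L-independent) public

      v-total : v ≡ reduced 0
      v-total = trans (sym (proj₂ (proj₂ achieved))) total

      module _ (S′ : Subset n) (S′-is : ∀ i → i < n → member S′ i ≡ χ i) where

        S′-bipartite : BipartiteSubset S S′
        S′-bipartite = colourable X≡ Y≡ Z≡ L L< L-independent S′ λ i i∈S′ →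
          trans (sym (S′-is (toℕ i) (toℕ<n i))) (∈⇒member i∈S′)

        S′-size : ∣ S′ ∣ ≡ size
        S′-size = trans (∣∣-sumTo S′) (sumTo-cong n λ i i<n → cong (λ b → only b 1) (S′-is i i<n))

        -- The lifted items of `T` compete in every shift. `dominates` turns the comparison of
        -- weights into one of sizes, and `shifting` averages over the shifts.
        S′-large : ∀ T → BipartiteSubset S T → k * ∣ T ∣ ≤ k * ∣ S′ ∣ + 2 * ∣ T ∣
        S′-large T (side , proper) = subst₂ (λ t l → k * t ≤ k * l + 2 * t)
          (lifted-size X≡ Y≡ Z≡ T side) (sym S′-size)
          (shifting U λ s s<k → dominates (λ a → U a ∧ alive s a)
            (≤-trans (covers s s<k U (lifted-independent X≡ Y≡ Z≡ T side proper)) (≤-reflexive (sym (proj₂ (proj₂ achieved))))))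
          where
          U = lifted X≡ Y≡ Z≡ T side

  -- The complete program and its running time.

  prepareTuples : ℕ → Program
  prepareTuples m = mᴬ [ lit 0 ]≔ᴺ var nᴬ ⊕ var nᴬ ⨾ tabulateTuples m

  prepareItems : ℕ → Program
  prepareItems k =
    doubleItems ⨾
    layering 0 yᴬ ⨾
    layering 1 xᴬ ⨾
    multiples 2 2 (var mᴬ) (lit 1) ⨾
    stepᴬ [ lit 0 ]≔ᴺ lit 1 ⊕ var mᴬ ⨾
    -- The sum of row and shift is below `M + k`, and `assignGroups` looks two rows further; the
    -- group limit uses the last entry.
    multiples 3 k (lit 2 ⊕ var mᴬ) (var stepᴬ) ⨾
    limitᴬ [ lit 0 ]≔ᴺ stripᴬ [ lit k ⊕ (lit 1 ⊕ var mᴬ) ] ⊕ var stepᴬ ⨾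
    powers ⨾
    weights

  solveShifts : ℕ → Program
  solveShifts k = forᶜ shiftᴬ below lit k loop solveShift (k * 4)

  scheme : ℕ → Program
  scheme k = (prepareTuples (k * 4) ⨾ prepareItems k) ⨾ solveShifts k ⨾ decode

  module Scheme (ℝ : RealField) {n : ℕ} (S : MBS.DiskSet ℝ n) (k : ℕ) {{k≢0 : NonZero k}} where
    open RealField ℝ using (Carrier; 0#; 1#; orderedField)
    open MBS ℝ
    open RealRAM ℝ
    open Finite
    open Weights n
    open OrderedFieldProperties orderedField using (2#)

    -- `B` bounds the number of items with room for the constants of the programs. It is opaque so
    -- that its powers are not unfolded.
    abstract

      B : ℕ
      B = (n + n) + 64

      B-is : B ≡ (n + n) + 64
      B-is = refl

      64≤B : 64 ≤ B
      64≤B = m≤n+m 64 (n + n)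

    open Execution ℝ B 64≤B
    open Pieces ℝ B 64≤B
    open Preprocessing ℝ B 64≤B
    open Tables ℝ B 64≤B
    open ShiftPrograms ℝ B 64≤B

    M m N : ℕ
    M = n + n
    m = k * 4
    N = suc M ^ m

    ≤B : ∀ {x} c {_ : T (c ≤ᵇ 64)} → x ≤ c + M → x ≤ B ^ 1
    ≤B c {ok} le = ≤-trans le (≤-trans (+-monoˡ-≤ M (≤ᵇ⇒≤ c 64 ok))
      (≤-reflexive (trans (+-comm 64 M) (trans (sym B-is) (sym (*-identityʳ B))))))

    M≤ : M ≤ B ^ 1
    M≤ = ≤B 0 ≤-refl

    n≤ : n ≤ B ^ 1
    n≤ = ≤-trans (m≤m+n n n) M≤

    SameOff-++ : ∀ {as bs σ τ υ} → SameOff as σ τ → SameOff bs τ υ → SameOff (as ++ bs) σ υ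
    SameOff-++ {as} {bs} (sameOff f g) (sameOff f′ g′) = sameOff
      (λ a {o} i → trans (f′ a {proj₂ (split as a o)} i) (f a {proj₁ (split as a o)} i))
      (λ a i → trans (g′ a i) (g a i))
      where
      split : ∀ as a → T (off (as ++ bs) a) → T (off as a) × T (off bs a)
      split []       a o = tt , o
      split (x ∷ as) a o = let p , q = T-∧ (not (x ≡ᵇ a)) o
                               r , s = split as a q
                           in T-∧-intro p r , s

    appended-at : ∀ {A : Set} {lo hi f : ℕ → A} → Appended n n lo hi f → ∀ {a} → a < n + n →
                  f a ≡ (if suc a ≤ᵇ n then lo (point a) else hi (point a))
    appended-at {lo = lo} {hi} {f} (low , high) {a} a<2n with a <? n
    ... | yes a<n rewrite ≤ᵇ-true {suc a} a<n = low a a<n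
    ... | no a≮n rewrite ≤ᵇ-false {suc a} {n} (s≤s (≮⇒≥ a≮n)) =
      trans (cong f (sym e)) (high (a ∸ n) (+-cancelˡ-< n (a ∸ n) n (subst (_< n + n) (sym e) a<2n)))
      where
      e = m+[n∸m]≡n (≮⇒≥ a≮n)

    both : ∀ {A : Set} (b : Bool) {x : A} → (if b then x else x) ≡ x
    both true  = refl
    both false = refl

    record Tuples (σ : State) : Set where
      field
        n-is      : nats σ nᴬ 0 ≡ n
        m-is      : nats σ mᴬ 0 ≡ M
        row-zero  : ∀ a → nats σ rowᴬ a ≡ 0
        col-zero  : ∀ a → nats σ colᴬ a ≡ 0
        half-zero : ∀ a → nats σ halfᴬ a ≡ 0
        strip-zero : ∀ a → nats σ stripᴬ a ≡ 0
        weight-zero : ∀ a → nats σ weightᴬ a ≡ 0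
        best-zero : nats σ bestᴬ 0 ≡ 0
        out-zero  : ∀ a → nats σ outᴬ a ≡ 0
        reals-is  : ∀ r a → reals σ r a ≡ inputReals S r a
        tabulated : Tabulated M m N σ

    prepareTuples-runs : Runs (prepareTuples m) (input S) (10 + (m + m)) Tuples
    prepareTuples-runs = runs-⨾ {P = _≡_ _} (runs-≔ᴺ {c = 1} small refl) λ { _ _ refl →
      runs-weaken ≤-refl (tabulateTuples-runs m (≤B 1 ≤-refl) refl) λ τ sm tab → record
        { n-is        = sameᴺ sm nᴬ {tabulateTuples-keeps m nᴬ (λ _ → tt) tt} 0
        ; m-is        = sameᴺ sm mᴬ {tabulateTuples-keeps m mᴬ (λ _ → tt) tt} 0
        ; row-zero    = sameᴺ sm rowᴬ {tabulateTuples-keeps m rowᴬ (λ _ → tt) tt}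
        ; col-zero    = sameᴺ sm colᴬ {tabulateTuples-keeps m colᴬ (λ _ → tt) tt}
        ; half-zero   = sameᴺ sm halfᴬ {tabulateTuples-keeps m halfᴬ (λ _ → tt) tt}
        ; strip-zero  = sameᴺ sm stripᴬ {tabulateTuples-keeps m stripᴬ (λ _ → tt) tt}
        ; weight-zero = sameᴺ sm weightᴬ {tabulateTuples-keeps m weightᴬ (λ _ → tt) tt}
        ; best-zero   = sameᴺ sm bestᴬ {tabulateTuples-keeps m bestᴬ (λ _ → tt) tt} 0
        ; out-zero    = sameᴺ sm outᴬ {tabulateTuples-keeps m outᴬ (λ _ → tt) tt}
        ; reals-is    = λ r → sameᴿ sm r {tabulateTuples-keepsᴿ m r}
        ; tabulated   = tab } }

    record Ready (σ : State) : Set where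
      field
        X Y Z : ℕ → Carrier
        D     : ℕ → ℕ → ℕ
        w     : ℕ → ℕ
        X≡ : ∀ {a} → a < M → X a ≡ coordinate S proj₁ (point a)
        Y≡ : ∀ {a} → a < M → Y a ≡ coordinate S proj₂ (point a)
        Z≡ : ∀ {a} → a < M → Z a ≡ (if suc a ≤ᵇ n then 0# else 2#)
        weighted  : Weighted n w
        tabulated : ∀ (t : ℕ → ℕ) → (∀ j → j < m → t j ≤ M) → ∃[ c ] c < N × ∀ j → j < m → D j c ≡ t j
      open Items ℝ S X Y Z using (row; col)
      field
        prepared  : Prepared M k row col m N D X Y Z w σ
        pow-is    : ∀ i → i ≤ n → nats σ powᴬ i ≡ 2 ^ i
        n-is      : nats σ nᴬ 0 ≡ n
        best-zero : nats σ bestᴬ 0 ≡ 0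
        out-zero  : ∀ a → nats σ outᴬ a ≡ 0

    prepareItems-runs : ∀ {σ} → Tuples σ → Runs (prepareItems k) σ 65 Ready
    prepareItems-runs {σ} start =
      runs-⨾ (doubleItems-runs n≤ (Tuples.n-is start)) λ τ₁ sm₁ doubled →
      let open Tuples start
          open Doubled doubled
          m₁ = trans (sameᴺ sm₁ mᴬ 0) m-is
      in
      runs-⨾ (layering-runs 0 yᴬ (reals τ₁ yᴬ) M≤ m₁ (λ a _ → trans (sameᴺ sm₁ rowᴬ a) (row-zero a)) (λ _ _ → refl)) λ τ₂ sm₂ rows →
      let s₂ = Same⇒SameOff (layering 0 yᴬ) {tmpᴬ ∷ iᴬ ∷ jᴬ ∷ roundᴬ ∷ rowᴬ ∷ []} sm₂
          m₂ = trans (offᴺ s₂ mᴬ 0) m₁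
      in
      runs-⨾ (layering-runs 1 xᴬ (reals τ₁ xᴬ) M≤ m₂
               (λ a _ → trans (offᴺ s₂ colᴬ a) (trans (sameᴺ sm₁ colᴬ a) (col-zero a))) (λ a _ → offᴿ s₂ xᴬ a)) λ τ₃ sm₃ cols →
      let s₃ = Same⇒SameOff (layering 1 xᴬ) {tmpᴬ ∷ iᴬ ∷ jᴬ ∷ roundᴬ ∷ colᴬ ∷ []} sm₃
          m₃ = trans (offᴺ s₃ mᴬ 0) m₂
          half₃ = λ a → trans (offᴺ s₃ halfᴬ a) (trans (offᴺ s₂ halfᴬ a) (trans (sameᴺ sm₁ halfᴬ a) (half-zero a)))
          strip₃ = λ a → trans (offᴺ s₃ stripᴬ a) (trans (offᴺ s₂ stripᴬ a) (trans (sameᴺ sm₁ stripᴬ a) (strip-zero a)))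
      in
      runs-⨾ (multiples-runs 2 2 M 1 1 M≤ half₃ λ τ sm → trans (sameᴺ sm mᴬ 0) m₃ , refl) λ τ₄ sm₄ halves →
      let s₄ = Same⇒SameOff (multiples 2 2 (var mᴬ) (lit 1)) {iᴬ ∷ halfᴬ ∷ []} sm₄
          m₄ = trans (offᴺ s₄ mᴬ 0) m₃
      in
      runs-⨾ {P = λ τ → nats τ stepᴬ 0 ≡ suc M} (runs-≔ᴺ {c = 1} small (cong suc m₄)) λ τ₅ sm₅ step₅ →
      let s₅ = Same⇒SameOff (stepᴬ [ lit 0 ]≔ᴺ lit 1 ⊕ var mᴬ) {stepᴬ ∷ []} sm₅
          m₅ = trans (offᴺ s₅ mᴬ 0) m₄
      in
      runs-⨾ (multiples-runs 3 k (2 + M) 1 (suc M) (≤B 2 ≤-refl)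
               (λ a → trans (offᴺ s₅ stripᴬ a) (trans (offᴺ s₄ stripᴬ a) (strip₃ a)))
               λ τ sm → cong (2 +_) (trans (sameᴺ sm mᴬ 0) m₅) , trans (sameᴺ sm stepᴬ 0) step₅) λ τ₆ sm₆ strips →
      let s₆ = Same⇒SameOff (multiples 3 k (lit 2 ⊕ var mᴬ) (var stepᴬ)) {iᴬ ∷ stripᴬ ∷ []} sm₆
          m₆ = trans (offᴺ s₆ mᴬ 0) m₅
          limit-index : k + suc (nats τ₆ mᴬ 0) ≡ suc M + k
          limit-index = trans (cong (λ x → k + suc x) m₆) (+-comm k (suc M))
      in
      runs-⨾ {P = λ τ → nats τ limitᴬ 0 ≡ (suc M + k) / k * suc M + suc M}
             (runs-≔ᴺ {c = 1} small (cong₂ _+_ (trans (cong (nats τ₆ stripᴬ) limit-index) (strips (suc M + k) (n<1+n _)))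
                                               (trans (offᴺ s₆ stepᴬ 0) step₅))) λ τ₇ sm₇ limit₇ →
      let s₇ = Same⇒SameOff (limitᴬ [ lit 0 ]≔ᴺ stripᴬ [ lit k ⊕ (lit 1 ⊕ var mᴬ) ] ⊕ var stepᴬ) {limitᴬ ∷ []} sm₇
          n₇ : nats τ₇ nᴬ 0 ≡ n
          n₇ = trans (offᴺ s₇ nᴬ 0) (trans (offᴺ s₆ nᴬ 0) (trans (offᴺ s₅ nᴬ 0) (trans (offᴺ s₄ nᴬ 0)
                 (trans (offᴺ s₃ nᴬ 0) (trans (offᴺ s₂ nᴬ 0) (trans (sameᴺ sm₁ nᴬ 0) n-is))))))
          weight₇ : ∀ a → nats τ₇ weightᴬ a ≡ 0
          weight₇ a = trans (offᴺ s₇ weightᴬ a) (trans (offᴺ s₆ weightᴬ a) (trans (offᴺ s₅ weightᴬ a) (trans (offᴺ s₄ weightᴬ a)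
                 (trans (offᴺ s₃ weightᴬ a) (trans (offᴺ s₂ weightᴬ a) (trans (sameᴺ sm₁ weightᴬ a) (weight-zero a)))))))
      in
      runs-⨾ (powers-runs n≤ n₇) λ τ₈ sm₈ pows →
      let s₈ = Same⇒SameOff powers {iᴬ ∷ powᴬ ∷ []} sm₈ in
      runs-weaken ≤-refl
        (weights-runs n≤ (trans (offᴺ s₈ nᴬ 0) n₇) pows (λ a → trans (offᴺ s₈ weightᴬ a) (weight₇ a))) λ τ₉ sm₉ ws →
      let s₉ = Same⇒SameOff weights {iᴬ ∷ weightᴬ ∷ []} sm₉
          t₈ = SameOff-++ s₈ s₉
          t₇ = SameOff-++ s₇ t₈
          t₆ = SameOff-++ s₆ t₇
          t₅ = SameOff-++ s₅ t₆
          t₄ = SameOff-++ s₄ t₅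
          t₃ = SameOff-++ s₃ t₄
          t₂ = SameOff-++ s₂ t₃
          count-N , tuples = tabulated
      in record
        { X = reals τ₁ xᴬ ; Y = reals τ₁ yᴬ ; Z = reals τ₁ zᴬ
        ; D = λ j → nats σ (tableᴬ j)
        ; w = nats τ₉ weightᴬ
        ; X≡ = λ {a} a<M → trans (appended-at x-doubled a<M) (trans (both (suc a ≤ᵇ n)) (reals-is xᴬ (point a)))
        ; Y≡ = λ {a} a<M → trans (appended-at y-doubled a<M) (trans (both (suc a ≤ᵇ n)) (reals-is yᴬ (point a)))
        ; Z≡ = λ {a} a<M → trans (appended-at z-doubled a<M) (cong (if suc a ≤ᵇ n then_else 2#) (reals-is zᴬ (point a)))
        ; weighted = ws
        ; tabulated = tuples
        ; prepared = record
          { loaded = record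
            { m-is      = trans (offᴺ t₂ mᴬ 0) m₁
            ; count-is  = trans (offᴺ t₂ countᴬ 0) (trans (sameᴺ sm₁ countᴬ 0) count-N)
            ; table-is  = λ j c → trans (offᴺ t₂ (tableᴬ j) c) (sameᴺ sm₁ (tableᴬ j) c)
            ; weight-is = λ _ → refl
            ; x-is      = offᴿ t₂ xᴬ
            ; y-is      = offᴿ t₂ yᴬ
            ; z-is      = offᴿ t₂ zᴬ }
          ; limit-is = trans (offᴺ t₈ limitᴬ 0) limit₇
          ; row-is   = λ a a<M → trans (offᴺ t₃ rowᴬ a) (rows a a<M)
          ; col-is   = λ a a<M → trans (offᴺ t₄ colᴬ a) (cols a a<M)
          ; half-is  = λ t t≤M → trans (offᴺ t₅ halfᴬ t) (trans (halves t (≤-<-trans t≤M (m<m+n M (s≤s z≤n)))) (*-identityʳ (t / 2)))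
          ; strip-is = λ t t< → trans (offᴺ t₇ stripᴬ t) (strips t t<) }
        ; pow-is = λ i i≤n → trans (offᴺ s₉ powᴬ i) (pows i i≤n)
        ; n-is = trans (offᴺ t₈ nᴬ 0) n₇
        ; best-zero = trans (offᴺ t₂ bestᴬ 0) (trans (sameᴺ sm₁ bestᴬ 0) best-zero)
        ; out-zero = λ a → trans (offᴺ t₂ outᴬ a) (trans (sameᴺ sm₁ outᴬ a) (out-zero a)) }

  module SchemeRuns (ℝ : RealField) {n : ℕ} (S : MBS.DiskSet ℝ n) (k : ℕ) {{k≢0 : NonZero k}} where
    open MBS ℝ
    open RealRAM ℝ
    open Finite
    open Characteristic
    open Scheme ℝ S k
    open Execution ℝ B 64≤B
    open Preprocessing ℝ B 64≤B
    open ShiftPrograms ℝ B 64≤B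

    module Solve {σ : State} (R : Ready σ) where
      open Ready R public
      open Items ℝ S X Y Z using (row; col; colour; row≤; col≤; colour<2)
      open Shifting M k row col colour row≤ col≤ colour<2
      open Analysis ℝ S X Y Z X≡ Y≡ Z≡ k w (Weighted.w-item weighted) (Weighted.w-none weighted) N D tabulated public

      Γ≤ : Γ ≤ B ^ 2
      Γ≤ = begin
        (suc M + k) / k * suc M + suc M   ≡⟨ cong (λ x → x * suc M + suc M) ([m+n]/n (suc M) k) ⟩
        suc (suc M / k) * suc M + suc M   ≡⟨ +-comm (suc (suc M / k) * suc M) (suc M) ⟩
        suc (suc (suc M / k)) * suc M     ≤⟨ *-mono-≤ (s≤s (s≤s (m/n≤m (suc M) k))) (≤-refl {suc M}) ⟩
        (3 + M) * suc M                   ≤⟨ B^-* 1 1 (≤B 3 ≤-refl) (≤B 1 ≤-refl) ⟩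
        B ^ 2                             ∎
        where open ≤-Reasoning

      N≤ : N ≤ B ^ m
      N≤ = ^-monoˡ-≤ m (subst (suc M ≤_) (*-identityʳ B) (≤B 1 ≤-refl))

      Progress : ℕ → State → Set
      Progress s τ = Achieved (nats τ bestᴬ 0) × (∀ s′ → s′ < s → Covers s′ (nats τ bestᴬ 0))

      still-prepared : ∀ {τ} → Same (solveShifts k) σ τ → Prepared M k row col m N D X Y Z w τ
      still-prepared sm = record
        { loaded = record
          { m-is      = trans (sameᴺ sm mᴬ 0) m-is
          ; count-is  = trans (sameᴺ sm countᴬ 0) count-is
          ; table-is  = λ j c → trans (sameᴺ sm (tableᴬ j) c) (table-is j c)
          ; weight-is = λ a → trans (sameᴺ sm weightᴬ a) (weight-is a)
          ; x-is      = λ a → trans (sameᴿ sm xᴬ a) (x-is a)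
          ; y-is      = λ a → trans (sameᴿ sm yᴬ a) (y-is a)
          ; z-is      = λ a → trans (sameᴿ sm zᴬ a) (z-is a) }
        ; limit-is = trans (sameᴺ sm limitᴬ 0) limit-is
        ; row-is   = λ a a<M → trans (sameᴺ sm rowᴬ a) (row-is a a<M)
        ; col-is   = λ a a<M → trans (sameᴺ sm colᴬ a) (col-is a a<M)
        ; half-is  = λ t t≤M → trans (sameᴺ sm halfᴬ t) (half-is t t≤M)
        ; strip-is = λ t t< → trans (sameᴺ sm stripᴬ t) (strip-is t t<) }
        where
        open Prepared prepared
        open Loaded loaded

      solveShifts-runs : Runs (solveShifts k) σ (suc (k + (52 + 15 * m))) (Progress k)
      solveShifts-runs = runs-for k k (52 + 15 * m) Progress (m≤B^m k) (λ _ _ → refl)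
        (subst Achieved (sym best-zero) nothing-achieved , λ _ ())
        λ s τ s<k vs sm (achieved , covers) →
          runs-weaken ≤-refl
            (solveShift-runs row≤ col≤ M≤ N≤ Γ≤ s<k vs (still-prepared sm))
            λ τ′ _ solved →
              let open Solved solved
                  old≤ = ≤-trans (m≤m⊔n (nats τ bestᴬ 0) _) (≤-reflexive (sym best-new))
                  new≤ = ≤-trans (m≤n⊔m (nats τ bestᴬ 0) _) (≤-reflexive (sym best-new))
              in subst Achieved (sym best-new) (new-best s<k γ γ-is achieved) ,
                 λ s′ s′< U indep → case m<1+n-cases s′< of λ where
                   (inj₁ s′<s) → ≤-trans (covers s′ s′<s U indep) old≤
                   (inj₂ refl) → ≤-trans (values-cover s<k γ γ-is U indep) new≤

    Good : Subset n → Set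
    Good S′ = BipartiteSubset S S′ × (∀ T → BipartiteSubset S T → k * ∣ T ∣ ≤ k * ∣ S′ ∣ + 2 * ∣ T ∣)

    finish-runs : ∀ {σ} → Ready σ → Runs (solveShifts k ⨾ decode) σ (68 + (k + 15 * m)) λ τ → Good (output n τ)
    finish-runs {σ} R = runs-weaken (≤-reflexive (shape k m))
      (runs-⨾ solveShifts-runs λ τ sm (achieved , covers) →
        runs-weaken ≤-refl
          (decode-runs n≤ (trans (sameᴺ sm nᴬ 0) n-is) (λ i i≤n → trans (sameᴺ sm powᴬ i) (pow-is i i≤n))
            (χ achieved covers) (reduced achieved covers) (v-total achieved covers)
            (reduce-step achieved covers) (reduced-end achieved covers)
            (λ i → trans (sameᴺ sm outᴬ i) (out-zero i)))
          λ τ′ _ bits →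
            let is = λ i i<n → trans (member-tabulate n (λ i → 0 <ᵇ nats τ′ outᴬ i) i i<n) (bits i i<n)
            in S′-bipartite achieved covers (output n τ′) is , S′-large achieved covers (output n τ′) is)
      λ _ _ h → h
      where
      open Solve R
      shape : ∀ k m → suc (suc (k + (52 + 15 * m)) + 14) ≡ 68 + (k + 15 * m)
      shape = solve 2 (λ k m → con 1 :+ ((con 1 :+ (k :+ (con 52 :+ con 15 :* m))) :+ con 14)
                := con 68 :+ (k :+ con 15 :* m)) refl
        where open +-*-Solver

    -- Of the exponent `69 * k`, tabulating the tuples accounts for `8 * k`, one shift for `60 * k`,
    -- and the number of shifts for `k`.
    scheme-runs : Runs (scheme k) (input S) (145 + 69 * k) λ τ → Good (output n τ)
    scheme-runs = runs-weaken (≤-reflexive (shape k))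
      (runs-⨾ (runs-⨾ prepareTuples-runs λ _ _ → prepareItems-runs) λ _ _ → finish-runs)
      λ _ _ h → h
      where
      shape : ∀ k → suc (suc ((10 + (k * 4 + k * 4)) + 65) + (68 + (k + 15 * (k * 4)))) ≡ 145 + 69 * k
      shape = solve 1 (λ k → con 1 :+ ((con 1 :+ ((con 10 :+ (k :* con 4 :+ k :* con 4)) :+ con 65)) :+ (con 68 :+ (k :+ con 15 :* (k :* con 4))))
                := con 145 :+ con 69 :* k) refl
        where open +-*-Solver

    -- The sum 2n + 64 is at most 3n, hence at most the square of n, as soon as n is at least 64.
    -- Passing to powers of `n` doubles every exponent.
    B≤n² : 64 ≤ n → B ≤ n ^ 2
    B≤n² 64≤n = begin
      B             ≡⟨ B-is ⟩
      n + n + 64    ≤⟨ +-monoʳ-≤ (n + n) 64≤n ⟩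
      n + n + n     ≡⟨ trans (+-assoc n n n) (cong (λ x → n + (n + x)) (sym (+-identityʳ n))) ⟩
      3 * n         ≤⟨ *-monoˡ-≤ n (≤-trans (s≤s (s≤s (s≤s z≤n))) 64≤n) ⟩
      n * n         ≡⟨ cong (n *_) (sym (*-identityʳ n)) ⟩
      n ^ 2         ∎
      where open ≤-Reasoning

    time-bound : ∀ {t} → t ≤ B ^ (145 + 69 * k) → 64 ≤ n → t ≤ 1 * (n ^ 290 * n ^ (138 * k))
    time-bound {t} t≤ 64≤n = begin
      t                             ≤⟨ t≤ ⟩
      B ^ (145 + 69 * k)            ≤⟨ ^-monoˡ-≤ (145 + 69 * k) (B≤n² 64≤n) ⟩
      (n ^ 2) ^ (145 + 69 * k)      ≡⟨ ^-*-assoc n 2 (145 + 69 * k) ⟩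
      n ^ (2 * (145 + 69 * k))      ≡⟨ cong (n ^_) {2 * (145 + 69 * k)} {290 + 138 * k} (shape k) ⟩
      n ^ (290 + 138 * k)           ≡⟨ ^-distribˡ-+-* n 290 (138 * k) ⟩
      n ^ 290 * n ^ (138 * k)       ≡⟨ sym (*-identityˡ _) ⟩
      1 * (n ^ 290 * n ^ (138 * k)) ∎
      where
      open ≤-Reasoning
      shape : ∀ k → 2 * (145 + 69 * k) ≡ 290 + 138 * k
      shape = solve 1 (λ k → con 2 :* (con 145 :+ con 69 :* k) := con 290 :+ con 138 :* k) refl
        where open +-*-Solver

-- The choice of the number of shifts, and the approximation scheme.

open import Data.Bool using (true; false)
open import Data.Empty using (⊥-elim)
open import Data.Fin using (toℕ)
open import Data.Fin.Properties using (toℕ<n)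
open import Data.Fin.Subset using (Subset; _∈_; ∣_∣)
open import Data.Nat as ℕ using (ℕ; zero; suc; z≤n; s≤s)
import Data.Nat.Properties as ℕₚ
open import Data.Product using (∃-syntax; _×_; _,_; proj₁; proj₂)
open import Data.Sum using (inj₁; inj₂)
open import Relation.Binary.PropositionalEquality as ≡ using (_≡_)
open import Relation.Nullary using (¬_; yes; no)
open FiniteSumsAndRunningTimes
open RealNumbers
open Combinatorics
open Geometry
open Algorithm

module Period (ℝ : RealField) where
  open RealField ℝ
  open OrderedFieldProperties orderedField
  open Embedding orderedField

  module _ {ε : Carrier} (0<ε : 0# < ε) where

    0≤ε : 0# ≤ ε
    0≤ε = proj₁ 0<ε

    ε≉0 : ¬ (ε ≈ 0#)
    ε≉0 e = proj₂ 0<ε (sym e)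

    2≈ : fromℕ 2 ≈ 2#
    2≈ = +-cong refl (+-identityʳ 1#)

    ε-cancel : ∀ x → ε * (x * ε ⁻¹) ≈ x
    ε-cancel x = trans (*-comm ε _) (trans (*-assoc x (ε ⁻¹) ε)
      (trans (*-cong refl (trans (*-comm (ε ⁻¹) ε) (⁻¹-inverse ε ε≉0))) (*-identityʳ x)))

    -- Downward search from a bound given by the archimedean property. It stops before 0, where the
    -- inequality would say that 2 is at most 0.
    period-below : ∀ K → fromℕ 2 ≤ ε * fromℕ K → ∃[ k ] fromℕ 2 ≤ ε * fromℕ (suc k) × ¬ (fromℕ 2 ≤ ε * fromℕ k)
    period-below zero    h = ⊥-elim (2≉0 (antisym (≤-respˡ 2≈ (≤-respʳ (zeroʳ ε) h)) 0≤2))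
    period-below (suc K) h with fromℕ 2 ≤? ε * fromℕ K
    ... | yes h′ = period-below K h′
    ... | no ¬h′ = K , h , ¬h′

    -- Minimality of k keeps the exponent of the running time in O(1/ε).
    period : ∃[ k ] fromℕ 2 ≤ ε * fromℕ (suc k) × ¬ (fromℕ 2 ≤ ε * fromℕ k)
    period = let K , bound = archimedean (fromℕ 2 * ε ⁻¹)
             in period-below K (≤-respˡ (ε-cancel (fromℕ 2)) (*-monoˡ-≤ 0≤ε bound))

    -- By minimality `ε * k` is at most 2, so `ε * (suc k)` is at most 3 when ε is at most 1. The
    -- factor is 138 * 3 = 414.
    period-small : ∀ {k} → ε ≤ 1# → ¬ (fromℕ 2 ≤ ε * fromℕ k) → fromℕ (138 ℕ.* suc k) ≤ fromℕ 414 * ε ⁻¹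
    period-small {k} ε≤1 ¬2≤ = ≤-respˡ (sym (fromℕ-* 138 (suc k)))
      (≤-respʳ (trans (sym (*-assoc (fromℕ 138) (fromℕ 3) (ε ⁻¹))) (*-cong (sym (fromℕ-* 138 3)) refl))
        (*-monoˡ-≤ (fromℕ-nonneg 138) (*-cancelˡ-≤ 0≤ε ε≉0
          (≤-respʳ (sym (ε-cancel (fromℕ 3)))
            (≤-respˡ (sym (trans (distribˡ ε 1# (fromℕ k)) (+-cong (*-identityʳ ε) refl)))
              (+-mono-≤ ε≤1 (≰⇒≥ ¬2≤)))))))

module Trivial (ℝ : RealField) {n : ℕ} (S : MBS.DiskSet ℝ n) where
  open RealField ℝ
  open MBS ℝ
  open OrderedFieldProperties orderedField
  open Embedding orderedField
  open Characteristic

  nothing-selected : ∀ i → ¬ (i ∈ output n (input S))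
  nothing-selected i i∈ with ≡.trans (≡.sym (∈⇒member i∈)) (member-tabulate n (λ _ → false) (toℕ i) (toℕ<n i))
  ... | ()

  nothing-bipartite : BipartiteSubset S (output n (input S))
  nothing-bipartite = (λ _ → true) , λ (i , i∈) _ _ → ⊥-elim (nothing-selected i i∈)

  nothing-suffices : ∀ {ε u l} → 1# ≤ ε → (1# - ε) * fromℕ u ≤ fromℕ l
  nothing-suffices {ε} {u} {l} 1≤ε = ≤-trans
    (≤-respˡ (*-comm (fromℕ u) (1# - ε)) (≤-respʳ (zeroʳ (fromℕ u))
      (*-monoˡ-≤ (fromℕ-nonneg u) (≤+⇒-≤ (≤-respʳ (sym (+-identityʳ ε)) 1≤ε)))))
    (fromℕ-nonneg l)

theorem10 : (ℝ : RealField) → let open RealField ℝ in let open MBS ℝ in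
    ∃[ a ] ∃[ b ] ∃[ C ] ∃[ n₀ ]
    ((ε : Carrier) → 0# < ε →
    ∃[ A ] ∃[ e ] (fromℕ e ≤ fromℕ b * ε ⁻¹) ×
    ((n : ℕ) (S : DiskSet n) →
    ∃[ S′ ] ∃[ t ]
    (Computes A on S result S′ time t) ×
    (n₀ ℕ.≤ n → t ℕ.≤ C ℕ.* (n ℕ.^ a ℕ.* n ℕ.^ e)) ×
    BipartiteSubset S S′ ×
    ((S* : Subset n) → MaximumBipartiteSubset S S* →
    (1# - ε) * fromℕ ∣ S* ∣ ≤ fromℕ ∣ S′ ∣)))
-- The time `B ^ (145 + 69 * k)` becomes `n ^ (290 + 138 * k)` for `n` at least 64, and the part
-- that depends on `k` is at most 414 / ε.
theorem10 ℝ = 290 , 414 , 1 , 64 , algorithm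
  where
  open RealField ℝ
  open MBS ℝ
  open OrderedFieldProperties orderedField
  open Embedding orderedField
  open Period ℝ

  algorithm : (ε : Carrier) → 0# < ε →
    ∃[ A ] ∃[ e ] (fromℕ e ≤ fromℕ 414 * ε ⁻¹) ×
    ((n : ℕ) (S : DiskSet n) →
    ∃[ S′ ] ∃[ t ]
    (Computes A on S result S′ time t) ×
    (64 ℕ.≤ n → t ℕ.≤ 1 ℕ.* (n ℕ.^ 290 ℕ.* n ℕ.^ e)) ×
    BipartiteSubset S S′ ×
    ((S* : Subset n) → MaximumBipartiteSubset S S* →
    (1# - ε) * fromℕ ∣ S* ∣ ≤ fromℕ ∣ S′ ∣))
  algorithm ε 0<ε with total 1# ε
  -- The required size is not positive here, so selecting nothing is enough; the output array is
  -- initially 0, and `skip` leaves it so. The other case needs ε at most 1 to absorb the rounding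
  -- of 2/ε.
  ... | inj₁ 1≤ε = skip , 0 ,
    *-cancelˡ-≤ (0≤ε 0<ε) (ε≉0 0<ε)
      (≤-respˡ (sym (zeroʳ ε)) (≤-respʳ (sym (ε-cancel 0<ε (fromℕ 414))) (fromℕ-nonneg 414))) ,
    λ n S → output n (input S) , 1 , (input S , RealRAM.skip , ≡.refl) ,
      one-step n , Trivial.nothing-bipartite ℝ S , λ S* _ → Trivial.nothing-suffices ℝ S {u = ∣ S* ∣} {∣ output n (input S) ∣} 1≤ε
    where
    one-step : ∀ n → 64 ℕ.≤ n → 1 ℕ.≤ 1 ℕ.* (n ℕ.^ 290 ℕ.* n ℕ.^ 0)
    one-step n 64≤n = ≡.subst (1 ℕ.≤_)
      (≡.sym (≡.trans (ℕₚ.*-identityˡ (n ℕ.^ 290 ℕ.* 1)) (ℕₚ.*-identityʳ (n ℕ.^ 290))))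
      (ℕₚ.m^n>0 n {{ℕ.>-nonZero (ℕₚ.≤-trans (s≤s z≤n) 64≤n)}} 290)
  ... | inj₂ ε≤1 with period 0<ε
  ... | k , 2≤ , ¬2≤ = scheme (suc k) , 138 ℕ.* suc k , period-small 0<ε {k} ε≤1 ¬2≤ , λ n S → solve-instance S
    where
    solve-instance : ∀ {n} (S : DiskSet n) →
      ∃[ S′ ] ∃[ t ]
      (Computes scheme (suc k) on S result S′ time t) ×
      (64 ℕ.≤ n → t ℕ.≤ 1 ℕ.* (n ℕ.^ 290 ℕ.* n ℕ.^ (138 ℕ.* suc k))) ×
      BipartiteSubset S S′ ×
      ((S* : Subset n) → MaximumBipartiteSubset S S* →
      (1# - ε) * fromℕ ∣ S* ∣ ≤ fromℕ ∣ S′ ∣)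
    solve-instance {n} S =
      output n final , _ , (final , exec , ≡.refl) , time-bound time≤ , proj₁ post ,
      λ S* maximum → approximation {ε} {k} {∣ S* ∣} {∣ output n final ∣} 2≤ (proj₂ post S* (proj₁ maximum))
      where
      open SchemeRuns ℝ S (suc k)
      open Scheme ℝ S (suc k) using (B; 64≤B)
      open Execution ℝ B 64≤B using (module Runs)
      open Runs scheme-runs
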